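{- Let $u(n,n)$ be the number of Hotelling protocols when each of the two players has $n$ strategy sets, let $\widehat u(n,n)=\Theta_n^2$, and let $Z=1/\log(1+\sqrt{\zeta})\approx 2.30322$ (all defined in the context). Then: a) $\widehat{u}(n,n)=(n!)^2\, Z^{2n}\, n^{O(1)}\approx (n!)^2\cdot 5.30482^n\cdot n^{O(1)}$; b) $u(n,n)=(n!)^2\, Z^{2n}\, n^{O(1)}\approx (n!)^2\cdot 5.30482^n\cdot n^{O(1)}$. Here $a(n)=b(n)\,n^{O(1)}$ means that there is a constant $C>0$ such that $n^{ -C}\le a(n)/b(n)\le n^{C}$ for all $n\ge 2$, and $5.30482$ is the rounded numerical value of $Z^2$.
   Context: Simple protocols: for integers $i,j\ge 0$, a simple $(i,j)$-protocol is a finite string of symbols, each equal to $[A]$, $[B]$ or $[AB]$, in which no $[A]$ is immediately followed by $[A]$, no $[B]$ is immediately followed by $[B]$, the number of $[A]$'s plus the number of $[AB]$'s is $i$, and the number of $[B]$'s plus the number of $[AB]$'s is $j$. Let $t(i,j)$ be the number of simple $(i,j)$-protocols. Hotelling protocols: Alice has $m$ strategy sets (move types) and Bob has $n$. A Hotelling protocol is a finite sequence of turns, where at each turn a (possibly empty) set of Alice's move types and a (possibly empty) set of Bob's move types is prescribed, such that: each of Alice's $m$ types is used at exactly one turn and each of Bob's $n$ types is used at exactly one turn; at every turn at least one player makes at least one move; and there are no two consecutive turns at both of which Alice does not play, nor two consecutive turns at both of which Bob does not play. Let $u(m,n)$ be the number of Hotelling protocols. Writing ${m\brace i}$ for Stirling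 numbers of the second kind, the paper computes $$u(m,n)=\sum_{i\le m,\ j\le n} i!\,j!\,{m\brace i}{n\brace j}\,t(i,j).$$ Further notation: $\zeta\approx 0.295598$ is the real root of $y^3+y^2+3y-1$. $\Psi_m(i)=i!{m\brace i}\zeta^{ -i/2}$, $\Theta_m=\sum_{i\le m}\Psi_m(i)$, and $$\widehat u(m,n)=\sum_{i\le m,\ j\le n} i!\,j!\,{m\brace i}{n\brace j}\,\zeta^{ -(i+j)/2}=\Theta_m\Theta_n.$$ -}

module Defs where

open import Data.Fin.Base using (Fin; join; splitAt)
open import Data.Fin.Properties using (any?; all?; injective⇒≤; splitAt-join)
  renaming (_≟_ to _≟ᶠ_)
open import Data.Fin.Subset using (Subset; inside; outside; _∈_; Nonempty; Empty)
open import Data.Fin.Subset.Properties using (_∈?_; nonempty?)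
open import Data.Integer.Base using (+_)
open import Data.List.Base using (List; []; _∷_; length; filter; map; cartesianProductWith; cartesianProduct; upTo)
open import Data.Nat.ListAction using (sum)
import Data.Nat.Base as ℕ
open ℕ using (ℕ; zero; suc; _!)
import Data.Nat.Properties as ℕ
open import Data.Product using (∃-syntax; ∃!; _×_; _,_; proj₁; proj₂)
import Data.Rational.Base as ℚ
open ℚ using (ℚ; 0ℚ; 1ℚ; ½)
import Data.Rational.Properties as ℚ
open import Data.Rational.Solver using (module +-*-Solver)
open import Data.Sum.Base using (_⊎_; inj₁; inj₂)
open import Data.Vec.Base using (Vec; []; _∷_; lookup)
open import Data.Vec.Relation.Unary.Linked using (Linked; linked?)
open import Relation.Binary.PropositionalEquality using (_≡_; refl; sym; trans; cong; cong₂; subst; subst₂)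
open import Relation.Nullary using (¬_; Dec)
open import Relation.Nullary.Decidable using (_×-dec_; _⊎-dec_; _→-dec_; ¬?; map′)
open import Relation.Unary using (Decidable)

-- A real number is a Cauchy sequence of rationals; equality of reals is _≃_.

Eventually : (ℕ → Set) → Set
Eventually P = ∃[ N ] ∀ n → N ℕ.≤ n → P n

record ℝ : Set where
  constructor mkℝ
  field
    seq    : ℕ → ℚ
    cauchy : ∀ ε → 0ℚ ℚ.< ε →
             ∃[ N ] ∀ m n → N ℕ.≤ m → N ℕ.≤ n → ℚ.∣ seq m ℚ.- seq n ∣ ℚ.< ε
open ℝ public

infix 4 _≃_ _≤_

_≃_ : ℝ → ℝ → Set
x ≃ y = ∀ ε → 0ℚ ℚ.< ε → Eventually λ n → ℚ.∣ seq x n ℚ.- seq y n ∣ ℚ.< ε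

_≤_ : ℝ → ℝ → Set
x ≤ y = ∀ ε → 0ℚ ℚ.< ε → Eventually λ n → seq x n ℚ.< seq y n ℚ.+ ε

private open module ℚ-Solver = +-*-Solver

half>0 : ∀ {ε} → 0ℚ ℚ.< ε → 0ℚ ℚ.< ½ ℚ.* ε
half>0 {ε} 0<ε = subst (ℚ._< ½ ℚ.* ε) (ℚ.*-zeroʳ ½) (ℚ.*-monoʳ-<-pos ½ 0<ε)

half+half : ∀ ε → ½ ℚ.* ε ℚ.+ ½ ℚ.* ε ≡ ε
half+half ε = trans (sym (ℚ.*-distribʳ-+ ε ½ ½)) (ℚ.*-identityˡ ε)

∣-∣-swap : ∀ p q → ℚ.∣ p ℚ.- q ∣ ≡ ℚ.∣ q ℚ.- p ∣
∣-∣-swap p q = trans (sym (ℚ.∣-p∣≡∣p∣ (p ℚ.- q)))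
  (cong ℚ.∣_∣ (solve 2 (λ p q → :- (p :- q) := q :- p) refl p q))

∣p∣≤∣q∣+∣p-q∣ : ∀ p q → ℚ.∣ p ∣ ℚ.≤ ℚ.∣ q ∣ ℚ.+ ℚ.∣ p ℚ.- q ∣
∣p∣≤∣q∣+∣p-q∣ p q = subst (λ r → ℚ.∣ r ∣ ℚ.≤ ℚ.∣ q ∣ ℚ.+ ℚ.∣ p ℚ.- q ∣)
  (solve 2 (λ p q → q :+ (p :- q) := p) refl p q) (ℚ.∣p+q∣≤∣p∣+∣q∣ q (p ℚ.- q))

∣p∣-∣q∣≤∣p-q∣ : ∀ p q → ℚ.∣ p ∣ ℚ.- ℚ.∣ q ∣ ℚ.≤ ℚ.∣ p ℚ.- q ∣
∣p∣-∣q∣≤∣p-q∣ p q = subst (ℚ.∣ p ∣ ℚ.- ℚ.∣ q ∣ ℚ.≤_)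
  (solve 2 (λ a b → (a :+ b) :- a := b) refl ℚ.∣ q ∣ ℚ.∣ p ℚ.- q ∣)
  (ℚ.+-monoˡ-≤ (ℚ.- ℚ.∣ q ∣) (∣p∣≤∣q∣+∣p-q∣ p q))

∣∣p∣-∣q∣∣≤∣p-q∣ : ∀ p q → ℚ.∣ ℚ.∣ p ∣ ℚ.- ℚ.∣ q ∣ ∣ ℚ.≤ ℚ.∣ p ℚ.- q ∣
∣∣p∣-∣q∣∣≤∣p-q∣ p q with ℚ.∣p∣≡p∨∣p∣≡-p (ℚ.∣ p ∣ ℚ.- ℚ.∣ q ∣)
... | inj₁ eq rewrite eq = ∣p∣-∣q∣≤∣p-q∣ p q
... | inj₂ eq rewrite eq = subst₂ ℚ._≤_
  (solve 2 (λ a b → b :- a := :- (a :- b)) refl ℚ.∣ p ∣ ℚ.∣ q ∣)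
  (∣-∣-swap q p) (∣p∣-∣q∣≤∣p-q∣ q p)

∣p-p∣≡0 : ∀ p → ℚ.∣ p ℚ.- p ∣ ≡ 0ℚ
∣p-p∣≡0 p = cong ℚ.∣_∣ (ℚ.+-inverseʳ p)

eventually-bounded : ∀ x → ∃[ B ] ℚ.Positive B × Eventually λ n → ℚ.∣ seq x n ∣ ℚ.≤ B
eventually-bounded x with cauchy x 1ℚ (ℚ.positive⁻¹ 1ℚ)
... | N , close = B , B>0 , N , bound
  where
  B : ℚ
  B = ℚ.∣ seq x N ∣ ℚ.+ 1ℚ
  B>0 : ℚ.Positive B
  B>0 = ℚ.positive (ℚ.+-mono-≤-< (ℚ.0≤∣p∣ (seq x N)) (ℚ.positive⁻¹ 1ℚ))
  bound : ∀ n → N ℕ.≤ n → ℚ.∣ seq x n ∣ ℚ.≤ B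
  bound n N≤n = ℚ.≤-trans (∣p∣≤∣q∣+∣p-q∣ (seq x n) (seq x N))
    (ℚ.+-monoʳ-≤ ℚ.∣ seq x N ∣ (ℚ.<⇒≤ (close n N N≤n ℕ.≤-refl)))

scaled : ∀ B → ℚ.Positive B → ∀ ε → 0ℚ ℚ.< ε → ∃[ δ ] 0ℚ ℚ.< δ × B ℚ.* δ ≡ ε
scaled B B>0 ε 0<ε = ε ℚ.* B⁻¹ , ℚ.positive⁻¹ _ {{δ>0}} , eq
  where
  instance
    _ = B>0
    B≢0 = ℚ.pos⇒nonZero B
    _ = ℚ.positive 0<ε
  B⁻¹ : ℚ
  B⁻¹ = ℚ.1/ B
  δ>0 : ℚ.Positive (ε ℚ.* B⁻¹)
  δ>0 = ℚ.pos*pos⇒pos ε B⁻¹ {{ℚ.1/pos⇒pos B}}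
  eq : B ℚ.* (ε ℚ.* B⁻¹) ≡ ε
  eq = trans (solve 3 (λ b e i → b :* (e :* i) := e :* (b :* i)) refl B ε B⁻¹)
    (trans (cong (ε ℚ.*_) (ℚ.*-inverseʳ B)) (ℚ.*-identityʳ ε))

*-bound : ∀ {a b B d} → ℚ.Positive B → ℚ.∣ a ∣ ℚ.≤ B → ℚ.∣ b ∣ ℚ.< d → ℚ.∣ a ℚ.* b ∣ ℚ.< B ℚ.* d
*-bound {a} {b} {B} {d} B>0 a≤ b< = subst (ℚ._< B ℚ.* d) (sym (ℚ.∣p*q∣≡∣p∣*∣q∣ a b))
  (ℚ.≤-<-trans (ℚ.*-monoʳ-≤-nonNeg ℚ.∣ b ∣ {{ℚ.∣-∣-nonNeg b}} a≤)
    (ℚ.*-monoʳ-<-pos B {{B>0}} b<))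

infix  9 -_
infixr 8 _^_
infixl 7 _*_
infixl 6 _+_ _-_

fromℚ : ℚ → ℝ
fromℚ q = mkℝ (λ _ → q) λ ε 0<ε → 0 , λ _ _ _ _ → subst (ℚ._< ε) (sym (∣p-p∣≡0 q)) 0<ε

_+_ : ℝ → ℝ → ℝ
x + y = mkℝ (λ n → seq x n ℚ.+ seq y n) λ ε 0<ε →
  let (N , x-close) = cauchy x (½ ℚ.* ε) (half>0 0<ε)
      (M , y-close) = cauchy y (½ ℚ.* ε) (half>0 0<ε)
  in N ℕ.⊔ M , λ m n m≥ n≥ → subst₂ ℚ._<_
    (cong ℚ.∣_∣ (solve 4 (λ a b c d → (a :- b) :+ (c :- d) := (a :+ c) :- (b :+ d)) refl
      (seq x m) (seq x n) (seq y m) (seq y n)))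
    (half+half ε)
    (ℚ.≤-<-trans (ℚ.∣p+q∣≤∣p∣+∣q∣ (seq x m ℚ.- seq x n) (seq y m ℚ.- seq y n))
      (ℚ.+-mono-<
        (x-close m n (ℕ.m⊔n≤o⇒m≤o N M m≥) (ℕ.m⊔n≤o⇒m≤o N M n≥))
        (y-close m n (ℕ.m⊔n≤o⇒n≤o N M m≥) (ℕ.m⊔n≤o⇒n≤o N M n≥))))

-_ : ℝ → ℝ
- x = mkℝ (λ n → ℚ.- seq x n) λ ε 0<ε →
  let (N , close) = cauchy x ε 0<ε
  in N , λ m n m≥ n≥ → subst (ℚ._< ε)
    (trans (∣-∣-swap (seq x m) (seq x n)) (cong ℚ.∣_∣
      (solve 2 (λ a b → b :- a := :- a :- :- b) refl (seq x m) (seq x n))))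
    (close m n m≥ n≥)

_-_ : ℝ → ℝ → ℝ
x - y = x + (- y)

_*_ : ℝ → ℝ → ℝ
x * y = mkℝ (λ n → seq x n ℚ.* seq y n) λ ε 0<ε →
  let (A , A>0 , N₁ , x≤A) = eventually-bounded x
      (B , B>0 , N₂ , y≤B) = eventually-bounded y
      (δ , δ>0 , Aδ≡) = scaled A A>0 (½ ℚ.* ε) (half>0 0<ε)
      (η , η>0 , Bη≡) = scaled B B>0 (½ ℚ.* ε) (half>0 0<ε)
      (N₃ , y-close) = cauchy y δ δ>0
      (N₄ , x-close) = cauchy x η η>0
  in (N₁ ℕ.⊔ N₂) ℕ.⊔ (N₃ ℕ.⊔ N₄) , λ m n m≥ n≥ →
    let m≥₁₂ = ℕ.m⊔n≤o⇒m≤o (N₁ ℕ.⊔ N₂) (N₃ ℕ.⊔ N₄) m≥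
        n≥₁₂ = ℕ.m⊔n≤o⇒m≤o (N₁ ℕ.⊔ N₂) (N₃ ℕ.⊔ N₄) n≥
        m≥₃₄ = ℕ.m⊔n≤o⇒n≤o (N₁ ℕ.⊔ N₂) (N₃ ℕ.⊔ N₄) m≥
        n≥₃₄ = ℕ.m⊔n≤o⇒n≤o (N₁ ℕ.⊔ N₂) (N₃ ℕ.⊔ N₄) n≥
    in subst₂ ℚ._<_
      (cong ℚ.∣_∣ (solve 4 (λ a b c d → a :* (c :- d) :+ d :* (a :- b) := a :* c :- b :* d) refl
        (seq x m) (seq x n) (seq y m) (seq y n)))
      (trans (cong₂ ℚ._+_ Aδ≡ Bη≡) (half+half ε))
      (ℚ.≤-<-trans
        (ℚ.∣p+q∣≤∣p∣+∣q∣ (seq x m ℚ.* (seq y m ℚ.- seq y n)) (seq y n ℚ.* (seq x m ℚ.- seq x n)))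
        (ℚ.+-mono-<
          (*-bound A>0 (x≤A m (ℕ.m⊔n≤o⇒m≤o N₁ N₂ m≥₁₂))
            (y-close m n (ℕ.m⊔n≤o⇒m≤o N₃ N₄ m≥₃₄) (ℕ.m⊔n≤o⇒m≤o N₃ N₄ n≥₃₄)))
          (*-bound B>0 (y≤B n (ℕ.m⊔n≤o⇒n≤o N₁ N₂ n≥₁₂))
            (x-close m n (ℕ.m⊔n≤o⇒n≤o N₃ N₄ m≥₃₄) (ℕ.m⊔n≤o⇒n≤o N₃ N₄ n≥₃₄)))))

∣_∣ : ℝ → ℝ
∣ x ∣ = mkℝ (λ n → ℚ.∣ seq x n ∣) λ ε 0<ε →
  let (N , close) = cauchy x ε 0<ε
  in N , λ m n m≥ n≥ →
    ℚ.≤-<-trans (∣∣p∣-∣q∣∣≤∣p-q∣ (seq x m) (seq x n)) (close m n m≥ n≥)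

fromℕ : ℕ → ℝ
fromℕ n = fromℚ (+ n ℚ./ 1)

_^_ : ℝ → ℕ → ℝ
x ^ zero  = fromℕ 1
x ^ suc n = x * x ^ n

infix 5 ∑≤

∑≤ : ℕ → (ℕ → ℝ) → ℝ
∑≤ zero    f = f 0
∑≤ (suc n) f = ∑≤ n f + f (suc n)

syntax ∑≤ n (λ k → e) = ∑[ k ≤ n ] e

IsLimit : (ℕ → ℝ) → ℝ → Set
IsLimit a x = ∀ ε → 0ℚ ℚ.< ε → Eventually λ n → ∣ a n - x ∣ ≤ fromℚ ε

-- The functions √, 1/x, exp and log are given by their graphs.

_IsReciprocalOf_ : ℝ → ℝ → Set
y IsReciprocalOf x = x * y ≃ fromℕ 1

_IsSqrtOf_ : ℝ → ℝ → Set
y IsSqrtOf x = fromℕ 0 ≤ y × y * y ≃ x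

1/_! : ℕ → ℝ
1/ k ! = fromℚ (ℚ._/_ (+ 1) (k !) {{k ℕ.!≢0}})

_IsExpOf_ : ℝ → ℝ → Set
y IsExpOf x = IsLimit (λ n → ∑[ k ≤ n ] 1/ k ! * x ^ k) y

_IsLogOf_ : ℝ → ℝ → Set
y IsLogOf x = x IsExpOf y

-- a = b · n^{O(1)}, that is n^{-C} ≤ a/b ≤ n^C for n ≥ 2, with denominators
-- cleared; this is meant for positive a and b.  As n ≥ 2, a real constant C can
-- be rounded up to an integer.
_≍_·n^O[1] : (ℕ → ℝ) → (ℕ → ℝ) → Set
a ≍ b ·n^O[1] = ∃[ C ] 0 ℕ.< C × (∀ n → 2 ℕ.≤ n →
  b n ≤ fromℕ n ^ C * a n × a n ≤ fromℕ n ^ C * b n)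

Turn : ℕ → ℕ → Set
Turn m n = Subset m × Subset n

module _ {m n : ℕ} where

  alice : Turn m n → Subset m
  alice = proj₁

  bob : Turn m n → Subset n
  bob = proj₂

  record IsHotelling {k} (p : Vec (Turn m n) k) : Set where
    constructor isHotelling
    field
      alice-once : ∀ i → ∃! _≡_ λ t → i ∈ alice (lookup p t)
      bob-once   : ∀ j → ∃! _≡_ λ t → j ∈ bob (lookup p t)
      some-move  : ∀ t → Nonempty (alice (lookup p t)) ⊎ Nonempty (bob (lookup p t))
      alice-rest : Linked (λ x y → ¬ (Empty (alice x) × Empty (alice y))) p
      bob-rest   : Linked (λ x y → ¬ (Empty (bob x) × Empty (bob y))) p

  ∃!? : ∀ {k} {P : Fin k → Set} → Decidable P → Dec (∃! _≡_ P)
  ∃!? P? = map′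
    (λ (x , px , u) → x , px , λ {y} → u y)
    (λ (x , px , u) → x , px , λ y → u {y})
    (any? λ x → P? x ×-dec all? λ y → P? y →-dec (x ≟ᶠ y))

  isHotelling? : ∀ {k} → Decidable (IsHotelling {k})
  isHotelling? p = map′
    (λ (a , b , c , d , e) → isHotelling a b c d e)
    (λ (isHotelling a b c d e) → a , b , c , d , e)
    (     all? (λ i → ∃!? λ t → i ∈? alice (lookup p t))
    ×-dec all? (λ j → ∃!? λ t → j ∈? bob (lookup p t))
    ×-dec all? (λ t → nonempty? (alice (lookup p t)) ⊎-dec nonempty? (bob (lookup p t)))
    ×-dec linked? (λ x y → ¬? (¬? (nonempty? (alice x)) ×-dec ¬? (nonempty? (alice y)))) p
    ×-dec linked? (λ x y → ¬? (¬? (nonempty? (bob x)) ×-dec ¬? (nonempty? (bob y)))) p)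

  -- A protocol has at most m + n turns, so that u below misses none of them.
  turns≤m+n : ∀ {k} {p : Vec (Turn m n) k} → IsHotelling p → k ℕ.≤ m ℕ.+ n
  turns≤m+n {k} {p} h = injective⇒≤ {f = λ t → join m n (move t)} λ {s} {t} eq →
    same s t (some-move s) (some-move t)
      (trans (sym (splitAt-join m n (move s))) (trans (cong (splitAt m) eq) (splitAt-join m n (move t))))
    where
    open IsHotelling h
    choose : ∀ {t} → Nonempty (alice (lookup p t)) ⊎ Nonempty (bob (lookup p t)) → Fin m ⊎ Fin n
    choose (inj₁ (i , _)) = inj₁ i
    choose (inj₂ (j , _)) = inj₂ j
    move : Fin k → Fin m ⊎ Fin n
    move t = choose {t} (some-move t)
    same : ∀ s t (x : Nonempty (alice (lookup p s)) ⊎ Nonempty (bob (lookup p s)))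
           (y : Nonempty (alice (lookup p t)) ⊎ Nonempty (bob (lookup p t))) →
           choose {s} x ≡ choose {t} y → s ≡ t
    same s t (inj₁ (i , i∈s)) (inj₁ (.i , i∈t)) refl =
      let (_ , _ , unique) = alice-once i in trans (sym (unique i∈s)) (unique i∈t)
    same s t (inj₂ (j , j∈s)) (inj₂ (.j , j∈t)) refl =
      let (_ , _ , unique) = bob-once j in trans (sym (unique j∈s)) (unique j∈t)

vecs : ∀ {A : Set} → List A → ∀ k → List (Vec A k)
vecs xs zero    = [] ∷ []
vecs xs (suc k) = cartesianProductWith _∷_ xs (vecs xs k)

subsets : ∀ n → List (Subset n)
subsets = vecs (outside ∷ inside ∷ [])

protocols : ∀ m n k → List (Vec (Turn m n) k)
protocols m n k = filter isHotelling? (vecs (cartesianProduct (subsets m) (subsets n)) k)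

u : ℕ → ℕ → ℕ
u m n = sum (map (λ k → length (protocols m n k)) (upTo (suc (m ℕ.+ n))))

stirling₂ : ℕ → ℕ → ℕ
stirling₂ zero    zero    = 1
stirling₂ zero    (suc i) = 0
stirling₂ (suc m) zero    = 0
stirling₂ (suc m) (suc i) = suc i ℕ.* stirling₂ m (suc i) ℕ.+ stirling₂ m i

-- The argument r stands for ζ^(-1/2).
module Approximation (r : ℝ) where

  Ψ : ℕ → ℕ → ℝ
  Ψ m i = fromℕ (i ! ℕ.* stirling₂ m i) * r ^ i

  Θ : ℕ → ℝ
  Θ m = ∑[ i ≤ m ] Ψ m i

  û : ℕ → ℕ → ℝ
  û m n = Θ m * Θ n

{-# OPTIONS --safe #-}

-- Put f(m,i) = i!{m i} and r = 1/√ζ, so that r³ = r² + r + 1.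
--
-- Counting surjections by one fibre gives Θₙ = r ∑_{k≥1} C(n,k) Θₙ₋ₖ for n ≥ 1.
-- As e^L = 1 + 1/r, the numbers Θₙ Lⁿ/n! solve a renewal equation whose
-- probabilities are r Lᵏ/k! (k ≥ 1); they lie between 1/2 and 1, which is a).
--
-- Splitting off the first turn of a protocol gives a recursion for u of the same
-- kind, and a Perron eigenvector of the transfer matrix of the letters shows
-- u(m,n) ≤ (r² - r) Θₘ Θₙ.  Conversely u(n,n) ≥ ∑ᵢ f(n,i)² t(i,i).  If i + j = n,
-- an (i,j)-protocol, an [AB] and a mirrored (i,j)-protocol make an
-- (n+1,n+1)-protocol; so t(n+1,n+1) ≥ t(i,j)², where the best t(i,j) is at least
-- rⁿ/(2n + 2).  Hence r²ⁱ is at most t(i,i) up to a polynomial factor, and the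
-- Cauchy-Schwarz inequality bounds Θₙ² by u(n,n) up to such a factor.
module Submission where

-- In a) the constant 1/2 alone does not survive the induction. The recursion for Θₙ stops at k = n,
-- so the weights r Lᵏ/k! available at stage n add up to less than 1 and a constant lower bound
-- would shrink. Hence the decaying surplus in `floor`: what the term k = 1 returns of it outweighs
-- the missing mass.
--
-- In b) the constant before Θₘ Θₙ has to depend on the preceding letter. One constant for all
-- letters would grow by 2s + s² > 1, where s = √ζ, at each turn after an `[AB]`.
--
-- L is known only as an argument at which the exponential series converges to 1 + √ζ.
--
-- Real numbers cannot be compared outright. Inequalities between them are proved by refuting a
-- reversed one, and the numerical refutations end in comparisons of rationals that are decided by
-- evaluation.

open import Algebra.Bundles using (CommutativeRing; CommutativeSemiring)
open import Data.Nat.Base using (ℕ; zero; suc; z≤n; s≤s; _!)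
import Data.Nat.Base as ℕ
import Data.Nat.Properties as ℕ
open import Data.Product using (_×_; _,_; proj₁; proj₂; ∃-syntax)
open import Data.Sum.Base using (_⊎_; inj₁; inj₂)
open import Level using (0ℓ)
open import Relation.Binary.Core using (Rel)
open import Relation.Binary.PropositionalEquality as ≡ using (_≡_)
open import Relation.Binary.Structures using (IsPartialOrder)

-- Sums over intervals, antidiagonals and subsets, for use both in ℕ and in the reals

module FiniteSums (S : CommutativeSemiring 0ℓ 0ℓ) where
  open CommutativeSemiring S
  open import Relation.Binary.Reasoning.Setoid setoid
  open import Algebra.Properties.CommutativeSemigroup +-commutativeSemigroup using (interchange)

  sum : ℕ → (ℕ → Carrier) → Carrier
  sum zero    f = f 0
  sum (suc n) f = sum n f + f (suc n)

  antidiagonal : ℕ → (ℕ → ℕ → Carrier) → Carrier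
  antidiagonal zero    f = f 0 0
  antidiagonal (suc n) f = f 0 (suc n) + antidiagonal n (λ i j → f (suc i) j)

  -- The sum of f ∣S∣ ∣Sᶜ∣ over the subsets S of an n-element set.
  binomial : ℕ → (ℕ → ℕ → Carrier) → Carrier
  binomial zero    f = f 0 0
  binomial (suc n) f = binomial n (λ a b → f (suc a) b) + binomial n (λ a b → f a (suc b))

  -- Restricts a sum over subsets to the nonempty ones.
  ifPositive : (ℕ → Carrier) → ℕ → ℕ → Carrier
  ifPositive h zero    _ = 0#
  ifPositive h (suc _) b = h b

  sum-cong : ∀ n {f g} → (∀ i → i ℕ.≤ n → f i ≈ g i) → sum n f ≈ sum n g
  sum-cong zero    f≈g = f≈g 0 z≤n
  sum-cong (suc n) f≈g =
    +-cong (sum-cong n λ i i≤n → f≈g i (ℕ.m≤n⇒m≤1+n i≤n)) (f≈g (suc n) ℕ.≤-refl)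

  sum-+ : ∀ n {f g} → sum n (λ i → f i + g i) ≈ sum n f + sum n g
  sum-+ zero    = refl
  sum-+ (suc n) = trans (+-congʳ (sum-+ n)) (interchange _ _ _ _)

  sum-*ˡ : ∀ n c {f} → sum n (λ i → c * f i) ≈ c * sum n f
  sum-*ˡ zero    c = refl
  sum-*ˡ (suc n) c = trans (+-congʳ (sum-*ˡ n c)) (sym (distribˡ c _ _))

  sum-head : ∀ n {f} → sum (suc n) f ≈ f 0 + sum n (λ i → f (suc i))
  sum-head zero    = refl
  sum-head (suc n) = trans (+-congʳ (sum-head n)) (+-assoc _ _ _)

  sum-0 : ∀ n → sum n (λ _ → 0#) ≈ 0#
  sum-0 zero    = refl
  sum-0 (suc n) = trans (+-identityʳ _) (sum-0 n)

  antidiagonal-cong : ∀ n {f g} → (∀ i j → i ℕ.+ j ≡ n → f i j ≈ g i j) →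
                      antidiagonal n f ≈ antidiagonal n g
  antidiagonal-cong zero    f≈g = f≈g 0 0 ≡.refl
  antidiagonal-cong (suc n) f≈g =
    +-cong (f≈g 0 (suc n) ≡.refl) (antidiagonal-cong n λ i j eq → f≈g (suc i) j (≡.cong suc eq))

  antidiagonal-+ : ∀ n {f g} →
    antidiagonal n (λ i j → f i j + g i j) ≈ antidiagonal n f + antidiagonal n g
  antidiagonal-+ zero    = refl
  antidiagonal-+ (suc n) = trans (+-congˡ (antidiagonal-+ n)) (interchange _ _ _ _)

  antidiagonal-*ˡ : ∀ n c {f} → antidiagonal n (λ i j → c * f i j) ≈ c * antidiagonal n f
  antidiagonal-*ˡ zero    c = refl
  antidiagonal-*ˡ (suc n) c = trans (+-congˡ (antidiagonal-*ˡ n c)) (sym (distribˡ c _ _))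

  antidiagonal-last : ∀ n {f} →
    antidiagonal (suc n) f ≈ antidiagonal n (λ i j → f i (suc j)) + f (suc n) 0
  antidiagonal-last zero    = refl
  antidiagonal-last (suc n) {f} =
    trans (+-congˡ (antidiagonal-last n {λ i → f (suc i)})) (sym (+-assoc _ _ _))

  antidiagonal-sum : ∀ n (g : ℕ → Carrier) → antidiagonal n (λ i _ → g i) ≈ sum n g
  antidiagonal-sum zero    g = refl
  antidiagonal-sum (suc n) g =
    trans (+-congˡ (antidiagonal-sum n (λ i → g (suc i)))) (sym (sum-head n))

  binomial-cong : ∀ n {f g} → (∀ a b → a ℕ.+ b ≡ n → f a b ≈ g a b) → binomial n f ≈ binomial n g
  binomial-cong zero    f≈g = f≈g 0 0 ≡.refl
  binomial-cong (suc n) f≈g = +-cong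
    (binomial-cong n λ a b eq → f≈g (suc a) b (≡.cong suc eq))
    (binomial-cong n λ a b eq → f≈g a (suc b) (≡.trans (ℕ.+-suc a b) (≡.cong suc eq)))

  binomial-+ : ∀ n {f g} → binomial n (λ a b → f a b + g a b) ≈ binomial n f + binomial n g
  binomial-+ zero    = refl
  binomial-+ (suc n) = trans (+-cong (binomial-+ n) (binomial-+ n)) (interchange _ _ _ _)

  binomial-*ˡ : ∀ n c {f} → binomial n (λ a b → c * f a b) ≈ c * binomial n f
  binomial-*ˡ zero    c = refl
  binomial-*ˡ (suc n) c =
    trans (+-cong (binomial-*ˡ n c) (binomial-*ˡ n c)) (sym (distribˡ c _ _))

  sum-binomial : ∀ m n {f : ℕ → ℕ → ℕ → Carrier} →
    sum m (λ i → binomial n (f i)) ≈ binomial n (λ a b → sum m (λ i → f i a b))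
  sum-binomial zero    n = refl
  sum-binomial (suc m) n = trans (+-congʳ (sum-binomial m n)) (sym (binomial-+ n))

  sum-ifPositive : ∀ m {h : ℕ → ℕ → Carrier} a b →
    sum m (λ i → ifPositive (h i) a b) ≈ ifPositive (λ b → sum m (λ i → h i b)) a b
  sum-ifPositive m zero    b = sum-0 m
  sum-ifPositive m (suc a) b = refl

  sum-binomial-ifPositive : ∀ m n {h : ℕ → ℕ → Carrier} →
    sum m (λ i → binomial n (ifPositive (h i))) ≈ binomial n (ifPositive λ b → sum m (λ i → h i b))
  sum-binomial-ifPositive m n {h} =
    trans (sum-binomial m n) (binomial-cong n λ a b _ → sum-ifPositive m {h} a b)

  -- A nonempty subset has fewer than `n` elements in its complement, so agreement below `n` is
  -- enough. This is what makes recursions over fibres accessible to strong induction.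
  ifPositive-cong : ∀ {n f g} → (∀ b → b ℕ.< n → f b ≈ g b) →
                    ∀ a b → a ℕ.+ b ≡ n → ifPositive f a b ≈ ifPositive g a b
  ifPositive-cong f≈g zero    b eq = refl
  ifPositive-cong f≈g (suc a) b eq = f≈g b (ℕ.≤-trans (s≤s (ℕ.m≤n+m b a)) (ℕ.≤-reflexive eq))

  ifPositive-*ˡ : ∀ c {f} a b → ifPositive (λ b → c * f b) a b ≈ c * ifPositive f a b
  ifPositive-*ˡ c zero    b = sym (zeroʳ c)
  ifPositive-*ˡ c (suc a) b = refl

  binomial-ifPositive-*ˡ : ∀ n c {f} →
    binomial n (ifPositive λ b → c * f b) ≈ c * binomial n (ifPositive f)
  binomial-ifPositive-*ˡ n c {f} =
    trans (binomial-cong n λ a b _ → ifPositive-*ˡ c {f} a b) (binomial-*ˡ n c)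

  -- The empty subset, whose complement is everything, contributes `f n`.
  binomial-ifPositive : ∀ n {f} → binomial n (λ _ b → f b) ≈ f n + binomial n (ifPositive f)
  binomial-ifPositive zero    {f} = sym (+-identityʳ _)
  binomial-ifPositive (suc n) {f} = begin
    binomial n (λ _ → f) + binomial n (λ _ b → f (suc b))
      ≈⟨ +-congˡ (binomial-ifPositive n) ⟩
    binomial n (λ _ → f) + (f (suc n) + binomial n (ifPositive λ b → f (suc b)))
      ≈⟨ x∙yz≈y∙xz _ _ _ ⟩
    f (suc n) + (binomial n (λ _ → f) + binomial n (ifPositive λ b → f (suc b)))
      ≈⟨ +-congˡ (+-congˡ (binomial-cong n λ { zero b _ → refl ; (suc a) b _ → refl })) ⟩
    f (suc n) + binomial (suc n) (ifPositive f) ∎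
    where open import Algebra.Properties.CommutativeSemigroup +-commutativeSemigroup using (x∙yz≈y∙xz)

  module Monotone (_≤_ : Carrier → Carrier → Set)
                  (0≤0 : 0# ≤ 0#)
                  (+-mono : ∀ {x y u v} → x ≤ y → u ≤ v → (x + u) ≤ (y + v)) where

    sum-mono : ∀ n {f g} → (∀ i → i ℕ.≤ n → f i ≤ g i) → sum n f ≤ sum n g
    sum-mono zero    f≤g = f≤g 0 z≤n
    sum-mono (suc n) f≤g =
      +-mono (sum-mono n λ i i≤n → f≤g i (ℕ.m≤n⇒m≤1+n i≤n)) (f≤g (suc n) ℕ.≤-refl)

    binomial-mono : ∀ n {f g} → (∀ a b → a ℕ.+ b ≡ n → f a b ≤ g a b) → binomial n f ≤ binomial n g
    binomial-mono zero    f≤g = f≤g 0 0 ≡.refl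
    binomial-mono (suc n) f≤g = +-mono
      (binomial-mono n λ a b eq → f≤g (suc a) b (≡.cong suc eq))
      (binomial-mono n λ a b eq → f≤g a (suc b) (≡.trans (ℕ.+-suc a b) (≡.cong suc eq)))

    ifPositive-mono : ∀ {n f g} → (∀ b → b ℕ.< n → f b ≤ g b) →
                      ∀ a b → a ℕ.+ b ≡ n → ifPositive f a b ≤ ifPositive g a b
    ifPositive-mono f≤g zero    b eq = 0≤0
    ifPositive-mono f≤g (suc a) b eq = f≤g b (ℕ.≤-trans (s≤s (ℕ.m≤n+m b a)) (ℕ.≤-reflexive eq))

    binomial-ifPositive-mono : ∀ n {f g} → (∀ b → b ℕ.< n → f b ≤ g b) →
                               binomial n (ifPositive f) ≤ binomial n (ifPositive g)
    binomial-ifPositive-mono n f≤g = binomial-mono n (ifPositive-mono f≤g)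

-- Recursions in ℕ for surjections, protocols and simple protocols

module ProtocolCounts where
  open import Data.Nat.Base
  open import Data.Nat.Properties
  open import Data.Nat.Tactic.RingSolver using (solve-∀)
  open import Data.Product.Base using (∃₂; _×_; _,_)
  open import Data.Sum.Base using (inj₁; inj₂)
  open import Defs using (stirling₂)
  open import Relation.Binary.PropositionalEquality
  open FiniteSums +-*-commutativeSemiring public
  open Monotone _≤_ ≤-refl +-mono-≤ public

  surjections : ℕ → ℕ → ℕ
  surjections m i = i ! * stirling₂ m i

  -- The new point has `suc i` possible images; the other points cover everything, or everything
  -- except that image.
  surjections-suc : ∀ m i →
    surjections (suc m) (suc i) ≡ suc i * (surjections m (suc i) + surjections m i)
  surjections-suc m i = lemma i (i !) (stirling₂ m (suc i)) (stirling₂ m i)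
    where
    lemma : ∀ i p s t →
      (p + i * p) * (s + i * s + t) ≡ (p + i * p) * s + p * t + i * ((p + i * p) * s + p * t)
    lemma = solve-∀

  surjections-0 : ∀ i → surjections 0 (suc i) ≡ 0
  surjections-0 i = *-zeroʳ (suc i !)

  stirling₂-> : ∀ {m i} → m < i → stirling₂ m i ≡ 0
  stirling₂-> {zero}  {suc i} _         = refl
  stirling₂-> {suc m} {suc i} (s≤s m<i)
    rewrite stirling₂-> {m} {suc i} (m<n⇒m<1+n m<i) | stirling₂-> m<i | *-zeroʳ i = refl

  surjections-> : ∀ {m i} → m < i → surjections m i ≡ 0
  surjections-> {m} {i} m<i rewrite stirling₂-> m<i = *-zeroʳ (i !)

  -- A map from a subset onto i points extends by the complement to a map onto
  -- i or i + 1 points.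
  binomial-surjections : ∀ m i →
    binomial m (λ _ b → surjections b i) ≡ surjections m i + surjections m (suc i)
  binomial-surjections zero    i =
    sym (trans (cong (surjections 0 i +_) (surjections-0 i)) (+-identityʳ _))
  binomial-surjections (suc m) zero    =
    trans (cong₂ _+_ (binomial-surjections m 0)
                     (trans (binomial-*ˡ m 0 {λ _ _ → 0}) refl))
      (trans (lemma (surjections m 0) (surjections m 1)) (sym (surjections-suc m 0)))
    where
    lemma : ∀ x y → x + y + 0 ≡ 1 * (y + x)
    lemma = solve-∀
  binomial-surjections (suc m) (suc i) = begin
    binomial m (λ _ b → g b (suc i)) + binomial m (λ _ b → g (suc b) (suc i))
      ≡⟨ cong₂ _+_ (binomial-surjections m (suc i))
           (trans (binomial-cong m λ _ b _ → surjections-suc b i)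
           (trans (binomial-*ˡ m (suc i) {λ _ b → g b (suc i) + g b i})
           (cong (suc i *_) (trans (binomial-+ m)
             (cong₂ _+_ (binomial-surjections m (suc i)) (binomial-surjections m i)))))) ⟩
    g m (suc i) + g m (2 + i) + suc i * (g m (suc i) + g m (2 + i) + (g m i + g m (suc i)))
      ≡⟨ lemma i (g m i) (g m (suc i)) (g m (2 + i)) ⟩
    suc i * (g m (suc i) + g m i) + (2 + i) * (g m (2 + i) + g m (suc i))
      ≡⟨ cong₂ _+_ (surjections-suc m i) (surjections-suc m (suc i)) ⟨
    g (suc m) (suc i) + g (suc m) (2 + i) ∎
    where
    open ≡-Reasoning
    g = surjections
    lemma : ∀ i x y z → y + z + suc i * (y + z + (x + y)) ≡ suc i * (y + x) + (2 + i) * (z + y)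
    lemma = solve-∀

  -- Classifies the surjections by the fibre over one point.
  surjections-fibre : ∀ m i →
    surjections m (suc i) ≡ binomial m (ifPositive λ b → surjections b i)
  surjections-fibre m i = +-cancelˡ-≡ (surjections m i) _ _
    (trans (sym (binomial-surjections m i)) (binomial-ifPositive m))

  -- A letter records who moves at a turn; [AB] also stands for the absence of
  -- a preceding turn.
  data Letter : Set where
    [A] [B] [AB] : Letter

  following : Letter → (Letter → ℕ) → ℕ
  following [A]  f = f [B] + f [AB]
  following [B]  f = f [A] + f [AB]
  following [AB] f = f [A] + f [B] + f [AB]

  following-cong : ∀ l {f g} → (∀ l → f l ≡ g l) → following l f ≡ following l g
  following-cong [A]  f≡g = cong₂ _+_ (f≡g [B]) (f≡g [AB])
  following-cong [B]  f≡g = cong₂ _+_ (f≡g [A]) (f≡g [AB])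
  following-cong [AB] f≡g = cong₂ _+_ (cong₂ _+_ (f≡g [A]) (f≡g [B])) (f≡g [AB])

  following-mono : ∀ l {f g} → (∀ l → f l ≤ g l) → following l f ≤ following l g
  following-mono [A]  f≤g = +-mono-≤ (f≤g [B]) (f≤g [AB])
  following-mono [B]  f≤g = +-mono-≤ (f≤g [A]) (f≤g [AB])
  following-mono [AB] f≤g = +-mono-≤ (+-mono-≤ (f≤g [A]) (f≤g [B])) (f≤g [AB])

  following-*ʳ : ∀ l f c → following l f * c ≡ following l (λ l → f l * c)
  following-*ʳ [A]  f c = *-distribʳ-+ c (f [B]) (f [AB])
  following-*ʳ [B]  f c = *-distribʳ-+ c (f [A]) (f [AB])
  following-*ʳ [AB] f c = trans (*-distribʳ-+ c (f [A] + f [B]) (f [AB]))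
    (cong (_+ f [AB] * c) (*-distribʳ-+ c (f [A]) (f [B])))

  f[AB]≤following : ∀ l f → f [AB] ≤ following l f
  f[AB]≤following [A]  f = m≤n+m _ (f [B])
  f[AB]≤following [B]  f = m≤n+m _ (f [A])
  f[AB]≤following [AB] f = m≤n+m _ (f [A] + f [B])

  sum-following : ∀ n l (f : ℕ → Letter → ℕ) →
    sum n (λ k → following l (f k)) ≡ following l (λ l → sum n (λ k → f k l))
  sum-following n [A]  f = sum-+ n
  sum-following n [B]  f = sum-+ n
  sum-following n [AB] f = trans (sum-+ n) (cong (_+ sum n (λ k → f k [AB])) (sum-+ n))

  antidiagonal-following : ∀ n l (f : ℕ → ℕ → Letter → ℕ) →
    antidiagonal n (λ i j → following l (f i j)) ≡
    following l (λ l → antidiagonal n (λ i j → f i j l))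
  antidiagonal-following n [A]  f = antidiagonal-+ n
  antidiagonal-following n [B]  f = antidiagonal-+ n
  antidiagonal-following n [AB] f =
    trans (antidiagonal-+ n) (cong (_+ antidiagonal n (λ i j → f i j [AB])) (antidiagonal-+ n))

  δ₀₀ : ℕ → ℕ → ℕ
  δ₀₀ zero zero = 1
  δ₀₀ _    _    = 0

  -- A turn as an operator on counts: it sums over the nonempty sets of moves that are spent and
  -- hands to `h` only how many moves remain, since move types are interchangeable.
  move : Letter → (ℕ → ℕ → ℕ) → ℕ → ℕ → ℕ
  move [A]  h ρ σ = binomial ρ (ifPositive λ b → h b σ)
  move [B]  h ρ σ = binomial σ (ifPositive (h ρ))
  move [AB] h     = move [A] (move [B] h)

  -- The number of ways to use up ρ moves of Alice and σ moves of Bob in exactly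
  -- k turns after a turn of type l.
  playsIn : ℕ → Letter → ℕ → ℕ → ℕ
  playsIn zero    l ρ σ = δ₀₀ ρ σ
  playsIn (suc k) l ρ σ = following l λ l′ → move l′ (playsIn k l′) ρ σ

  plays : ℕ → Letter → ℕ → ℕ → ℕ
  plays K l ρ σ = sum K λ k → playsIn k l ρ σ

  sum-move : ∀ n l (h : ℕ → ℕ → ℕ → ℕ) ρ σ →
    sum n (λ k → move l (h k) ρ σ) ≡ move l (λ ρ σ → sum n (λ k → h k ρ σ)) ρ σ
  sum-move n [A]  h ρ σ = sum-binomial-ifPositive n ρ
  sum-move n [B]  h ρ σ = sum-binomial-ifPositive n σ
  sum-move n [AB] h ρ σ = trans (sum-move n [A] (λ k → move [B] (h k)) ρ σ)
    (binomial-cong ρ (ifPositive-cong λ b _ → sum-move n [B] h b σ))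

  -- Apart from the protocol without turns, a first turn can be split off, and `move` commutes with
  -- the sum over the number of turns. Both bounds on `plays` are inductions along this recursion.
  plays-suc : ∀ K l ρ σ →
    plays (suc K) l ρ σ ≡ δ₀₀ ρ σ + following l (λ l′ → move l′ (plays K l′) ρ σ)
  plays-suc K l ρ σ = trans (sum-head K) (cong (δ₀₀ ρ σ +_)
    (trans (sum-following K l λ k l′ → move l′ (playsIn k l′) ρ σ)
      (following-cong l λ l′ → sum-move K l′ (λ k → playsIn k l′) ρ σ)))

  -- The coefficients of a power series multiplied by its variable. Likewise `shift l` multiplies a
  -- series in two variables by the monomial x, y or xy of the letter `l`.
  delay : (ℕ → ℕ) → ℕ → ℕ
  delay f zero    = 0
  delay f (suc i) = f i

  shift : Letter → (ℕ → ℕ → ℕ) → ℕ → ℕ → ℕ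
  shift [A]  h i j = delay (λ i → h i j) i
  shift [B]  h i j = delay (h i) j
  shift [AB] h     = shift [A] (shift [B] h)

  -- The number of words of at most k letters that continue l and contain
  -- i moves of Alice and j moves of Bob; words k [AB] i j = t(i,j) for k ≥ i + j.
  words : ℕ → Letter → ℕ → ℕ → ℕ
  words zero    l i j = δ₀₀ i j
  words (suc k) l i j = δ₀₀ i j + following l λ l′ → shift l′ (words k l′) i j

  -- Each of `i` abstract moves is replaced by a block of an ordered partition of `ρ` concrete moves
  -- into `i` nonempty blocks.
  collapse : ℕ → (ℕ → ℕ) → ℕ → ℕ
  collapse I g ρ = sum I λ i → surjections ρ i * g i

  collapse-cong : ∀ I {f g} ρ → (∀ i → f i ≡ g i) → collapse I f ρ ≡ collapse I g ρ
  collapse-cong I ρ f≡g = sum-cong I λ i _ → cong (surjections ρ i *_) (f≡g i)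

  collapse-mono : ∀ I {f g} ρ → (∀ i → f i ≤ g i) → collapse I f ρ ≤ collapse I g ρ
  collapse-mono I ρ f≤g = sum-mono I λ i _ → *-monoʳ-≤ (surjections ρ i) (f≤g i)

  collapse-0 : ∀ I ρ → collapse I (λ _ → 0) ρ ≡ 0
  collapse-0 I ρ = trans (sum-cong I λ i _ → *-zeroʳ (surjections ρ i)) (sum-0 I)

  collapse-+ : ∀ I f g ρ → collapse I (λ i → f i + g i) ρ ≡ collapse I f ρ + collapse I g ρ
  collapse-+ I f g ρ =
    trans (sum-cong I λ i _ → *-distribˡ-+ (surjections ρ i) (f i) (g i)) (sum-+ I)

  binomial-collapse : ∀ I n (h : ℕ → ℕ → ℕ) ρ →
    collapse I (λ i → binomial n (ifPositive (h i))) ρ ≡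
    binomial n (ifPositive λ b → collapse I (λ i → h i b) ρ)
  binomial-collapse I n h ρ = trans
    (sum-cong I λ i _ → sym (binomial-ifPositive-*ˡ n (surjections ρ i)))
    (sum-binomial-ifPositive I n)

  -- By `surjections-fibre`, one abstract move amounts to one nonempty block taken away. Truncation
  -- at `I` is the only loss: the right side keeps the term of index `I`, whose delayed copy falls
  -- outside the sum on the left.
  collapse-delay : ∀ I g ρ → collapse I (delay g) ρ ≤ binomial ρ (ifPositive (collapse I g))
  collapse-delay zero    g ρ = ≤-trans (≤-reflexive (*-zeroʳ (surjections ρ 0))) z≤n
  collapse-delay (suc I) g ρ = begin
    collapse (suc I) (delay g) ρ
      ≡⟨ trans (sum-head I {λ i → surjections ρ i * delay g i}) (cong (_+ sum I (λ i → surjections ρ (suc i) * g i)) (*-zeroʳ (surjections ρ 0))) ⟩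
    sum I (λ i → surjections ρ (suc i) * g i)
      ≡⟨ sum-cong I (λ i _ → trans (cong (_* g i) (surjections-fibre ρ i))
           (trans (*-comm _ (g i)) (sym (binomial-ifPositive-*ˡ ρ (g i))))) ⟩
    sum I (λ i → binomial ρ (ifPositive λ b → g i * surjections b i))
      ≡⟨ sum-binomial-ifPositive I ρ ⟩
    binomial ρ (ifPositive λ b → sum I (λ i → g i * surjections b i))
      ≤⟨ binomial-ifPositive-mono ρ (λ b _ → ≤-trans
           (≤-reflexive (sum-cong I λ i _ → *-comm (g i) (surjections b i)))
           (m≤m+n _ (surjections b (suc I) * g (suc I)))) ⟩
    binomial ρ (ifPositive (collapse (suc I) g)) ∎
    where open ≤-Reasoning

  -- With t(i,j) for `h i j` this is the double sum of i! j! {ρ i} {σ j} t(i,j) in the formula for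
  -- u.
  weigh : ℕ → ℕ → (ℕ → ℕ → ℕ) → ℕ → ℕ → ℕ
  weigh I J h ρ σ = collapse I (λ i → collapse J (h i) σ) ρ

  weigh-shift : ∀ I J l h ρ σ → weigh I J (shift l h) ρ σ ≤ move l (weigh I J h) ρ σ
  weigh-shift I J [A] h ρ σ = ≤-trans
    (≤-reflexive (collapse-cong I ρ λ { zero → collapse-0 J σ ; (suc i) → refl }))
    (collapse-delay I (λ i → collapse J (h i) σ) ρ)
  weigh-shift I J [B] h ρ σ = ≤-trans
    (collapse-mono I ρ λ i → collapse-delay J (h i) σ)
    (≤-reflexive (binomial-collapse I σ (λ i → collapse J (h i)) ρ))
  weigh-shift I J [AB] h ρ σ = ≤-trans (weigh-shift I J [A] (shift [B] h) ρ σ)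
    (binomial-ifPositive-mono ρ λ b _ → weigh-shift I J [B] h b σ)

  collapse-supp0 : ∀ I g ρ → (∀ i → g (suc i) ≡ 0) → collapse I g ρ ≡ surjections ρ 0 * g 0
  collapse-supp0 zero    g ρ g≡0 = refl
  collapse-supp0 (suc I) g ρ g≡0 = trans (cong₂ _+_ (collapse-supp0 I g ρ g≡0)
    (trans (cong (surjections ρ (suc I) *_) (g≡0 I)) (*-zeroʳ (surjections ρ (suc I)))))
    (+-identityʳ _)

  weigh-δ₀₀ : ∀ I J ρ σ → weigh I J δ₀₀ ρ σ ≡ δ₀₀ ρ σ
  weigh-δ₀₀ I J ρ σ = trans (collapse-supp0 I _ ρ λ i → collapse-0 J σ)
    (trans (cong (surjections ρ 0 *_) (collapse-supp0 J (δ₀₀ 0) σ λ _ → refl)) (values ρ σ))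
    where
    values : ∀ ρ σ → surjections ρ 0 * (surjections σ 0 * 1) ≡ δ₀₀ ρ σ
    values zero    zero    = refl
    values zero    (suc σ) = refl
    values (suc ρ) σ       = refl

  weigh-+ : ∀ I J f g ρ σ →
    weigh I J (λ i j → f i j + g i j) ρ σ ≡ weigh I J f ρ σ + weigh I J g ρ σ
  weigh-+ I J f g ρ σ =
    trans (collapse-cong I ρ λ i → collapse-+ J (f i) (g i) σ) (collapse-+ I _ _ ρ)

  weigh-following : ∀ I J l (f : Letter → ℕ → ℕ → ℕ) ρ σ →
    weigh I J (λ i j → following l λ l′ → f l′ i j) ρ σ ≡
    following l (λ l′ → weigh I J (f l′) ρ σ)
  weigh-following I J [A]  f ρ σ = weigh-+ I J (f [B]) (f [AB]) ρ σ
  weigh-following I J [B]  f ρ σ = weigh-+ I J (f [A]) (f [AB]) ρ σ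
  weigh-following I J [AB] f ρ σ =
    trans (weigh-+ I J (λ i j → f [A] i j + f [B] i j) (f [AB]) ρ σ)
      (cong (_+ weigh I J (f [AB]) ρ σ) (weigh-+ I J (f [A]) (f [B]) ρ σ))

  move-mono : ∀ l {h h′} → (∀ ρ σ → h ρ σ ≤ h′ ρ σ) → ∀ ρ σ → move l h ρ σ ≤ move l h′ ρ σ
  move-mono [A]  h≤h′ ρ σ = binomial-ifPositive-mono ρ λ b _ → h≤h′ b σ
  move-mono [B]  h≤h′ ρ σ = binomial-ifPositive-mono σ λ b _ → h≤h′ ρ b
  move-mono [AB] h≤h′ ρ σ = move-mono [A] (λ ρ σ → move-mono [B] h≤h′ ρ σ) ρ σ

  -- The lower half of the formula for u. Both sides obey the same recursion on the first letter,
  -- and `weigh` carries `shift` into `move` up to the truncation in `collapse`.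
  weigh-words≤plays : ∀ I J K l ρ σ → weigh I J (words K l) ρ σ ≤ plays K l ρ σ
  weigh-words≤plays I J zero    l ρ σ = ≤-reflexive (weigh-δ₀₀ I J ρ σ)
  weigh-words≤plays I J (suc K) l ρ σ = begin
    weigh I J (words (suc K) l) ρ σ
      ≡⟨ weigh-+ I J δ₀₀ (λ i j → following l λ l′ → shift l′ (words K l′) i j) ρ σ ⟩
    weigh I J δ₀₀ ρ σ + weigh I J (λ i j → following l λ l′ → shift l′ (words K l′) i j) ρ σ
      ≡⟨ cong₂ _+_ (weigh-δ₀₀ I J ρ σ) (weigh-following I J l (λ l′ → shift l′ (words K l′)) ρ σ) ⟩
    δ₀₀ ρ σ + following l (λ l′ → weigh I J (shift l′ (words K l′)) ρ σ)
      ≤⟨ +-monoʳ-≤ (δ₀₀ ρ σ) (following-mono l λ l′ → ≤-trans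
           (weigh-shift I J l′ (words K l′) ρ σ)
           (move-mono l′ (λ ρ σ → weigh-words≤plays I J K l′ ρ σ) ρ σ)) ⟩
    δ₀₀ ρ σ + following l (λ l′ → move l′ (plays K l′) ρ σ)
      ≡⟨ plays-suc K l ρ σ ⟨
    plays (suc K) l ρ σ ∎
    where open ≤-Reasoning

  term≤sum : ∀ {n i} f → i ≤ n → f i ≤ sum n f
  term≤sum {zero}  {.0} f z≤n = ≤-refl
  term≤sum {suc n} {i}  f i≤1+n with m≤n⇒m<n∨m≡n i≤1+n
  ... | inj₁ (s≤s i≤n) = ≤-trans (term≤sum f i≤n) (m≤m+n _ _)
  ... | inj₂ refl      = m≤n+m _ (sum n f)

  diagonal≤plays : ∀ n K →
    sum n (λ i → surjections n i * (surjections n i * words K [AB] i i)) ≤ plays K [AB] n n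
  diagonal≤plays n K = ≤-trans
    (sum-mono n λ i i≤n → *-monoʳ-≤ (surjections n i)
      (term≤sum (λ j → surjections n j * words K [AB] i j) i≤n))
    (weigh-words≤plays n n K [AB] n n)

  swap : Letter → Letter
  swap [A]  = [B]
  swap [B]  = [A]
  swap [AB] = [AB]

  following-swap : ∀ l f → following (swap l) f ≡ following l (λ l′ → f (swap l′))
  following-swap [A]  f = refl
  following-swap [B]  f = refl
  following-swap [AB] f = cong (_+ f [AB]) (+-comm (f [A]) (f [B]))

  δ₀₀-swap : ∀ i j → δ₀₀ i j ≡ δ₀₀ j i
  δ₀₀-swap zero    zero    = refl
  δ₀₀-swap zero    (suc j) = refl
  δ₀₀-swap (suc i) zero    = refl
  δ₀₀-swap (suc i) (suc j) = refl

  delay-cong : ∀ {f g} → (∀ i → f i ≡ g i) → ∀ i → delay f i ≡ delay g i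
  delay-cong f≡g zero    = refl
  delay-cong f≡g (suc i) = f≡g i

  delay-comm : ∀ (h : ℕ → ℕ → ℕ) i j →
    delay (λ i → delay (h i) j) i ≡ delay (λ j → delay (λ i → h i j) i) j
  delay-comm h zero    zero    = refl
  delay-comm h zero    (suc j) = refl
  delay-comm h (suc i) zero    = refl
  delay-comm h (suc i) (suc j) = refl

  shift-swap : ∀ l {h h′ : ℕ → ℕ → ℕ} → (∀ i j → h i j ≡ h′ j i) →
               ∀ i j → shift l h i j ≡ shift (swap l) h′ j i
  shift-swap [A]      h≡h′ i j = delay-cong (λ i → h≡h′ i j) i
  shift-swap [B]      h≡h′ i j = delay-cong (h≡h′ i) j
  shift-swap [AB] {h} h≡h′ i j = trans (delay-comm h i j)
    (delay-cong (λ j → delay-cong (λ i → h≡h′ i j) i) j)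

  words-swap : ∀ k l i j → words k l i j ≡ words k (swap l) j i
  words-swap zero    l i j = δ₀₀-swap i j
  words-swap (suc k) l i j = cong₂ _+_ (δ₀₀-swap i j)
    (trans (following-cong l λ l′ → shift-swap l′ (words-swap k l′) i j)
      (sym (following-swap l λ l′ → shift l′ (words k l′) j i)))

  delay-superadditive : ∀ {g g′} c i′ → (∀ i → g i * c ≤ g′ (i + suc i′)) →
                        ∀ i → delay g i * c ≤ delay g′ (i + suc i′)
  delay-superadditive c i′ g≤g′ zero    = z≤n
  delay-superadditive c i′ g≤g′ (suc i) = g≤g′ i

  shift-superadditive : ∀ l {h h′} c i′ j′ → (∀ i j → h i j * c ≤ h′ (i + suc i′) (j + suc j′)) →
                        ∀ i j → shift l h i j * c ≤ shift l h′ (i + suc i′) (j + suc j′)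
  shift-superadditive [A]  c i′ j′ h≤h′ i j = delay-superadditive c i′ (λ i → h≤h′ i j) i
  shift-superadditive [B]  c i′ j′ h≤h′ i j = delay-superadditive c j′ (h≤h′ i) j
  shift-superadditive [AB] {h} {h′} c i′ j′ h≤h′ i j =
    shift-superadditive [A] {shift [B] h} {shift [B] h′} c i′ j′
      (λ i j → shift-superadditive [B] {h} {h′} c i′ j′ h≤h′ i j) i j

  shift-00 : ∀ l h → shift l h 0 0 ≡ 0
  shift-00 [A]  h = refl
  shift-00 [B]  h = refl
  shift-00 [AB] h = refl

  words-00 : ∀ k l → words k l 0 0 ≡ 1
  words-00 zero    l = refl
  words-00 (suc k) l = cong suc (trans (following-cong l λ l′ → shift-00 l′ (words k l′)) (zeros l))
    where
    zeros : ∀ l → following l (λ _ → 0) ≡ 0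
    zeros [A]  = refl
    zeros [B]  = refl
    zeros [AB] = refl

  words-[AB]≤ : ∀ k l i j → words k [AB] i j ≤ words (suc k) l (suc i) (suc j)
  words-[AB]≤ k l i j =
    f[AB]≤following l (λ l′ → shift l′ (words k l′) (suc i) (suc j))

  delay-mono : ∀ {f g} → (∀ i → f i ≤ g i) → ∀ i → delay f i ≤ delay g i
  delay-mono f≤g zero    = z≤n
  delay-mono f≤g (suc i) = f≤g i

  shift-mono : ∀ l {h h′} → (∀ i j → h i j ≤ h′ i j) → ∀ i j → shift l h i j ≤ shift l h′ i j
  shift-mono [A]  h≤h′ i j = delay-mono (λ i → h≤h′ i j) i
  shift-mono [B]  h≤h′ i j = delay-mono (h≤h′ i) j
  shift-mono [AB] h≤h′ i j = delay-mono (λ i → delay-mono (h≤h′ i) j) i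

  words-suc : ∀ k l i j → words k l i j ≤ words (suc k) l i j
  words-suc zero    l i j = m≤m+n (δ₀₀ i j) _
  words-suc (suc k) l i j = +-monoʳ-≤ (δ₀₀ i j)
    (following-mono l λ l′ → shift-mono l′ (words-suc k l′) i j)

  words-+ : ∀ d k l i j → words k l i j ≤ words (d + k) l i j
  words-+ zero    k l i j = ≤-refl
  words-+ (suc d) k l i j = ≤-trans (words-+ d k l i j) (words-suc (d + k) l i j)

  -- Two words can be joined by a letter [AB], whatever their ends.
  words-superadditive : ∀ k k′ l i j i′ j′ →
    words k l i j * words k′ [AB] i′ j′ ≤ words (k + suc k′) l (i + suc i′) (j + suc j′)
  words-superadditive k k′ l zero zero i′ j′ = begin
    -- The first word has ended; the joining `[AB]` comes next, and it may follow any letter.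
    words k l 0 0 * words k′ [AB] i′ j′        ≡⟨ cong (_* words k′ [AB] i′ j′) (words-00 k l) ⟩
    1 * words k′ [AB] i′ j′                    ≡⟨ *-identityˡ _ ⟩
    words k′ [AB] i′ j′                        ≤⟨ words-[AB]≤ k′ l i′ j′ ⟩
    words (suc k′) l (suc i′) (suc j′)         ≤⟨ words-+ k (suc k′) l (suc i′) (suc j′) ⟩
    words (k + suc k′) l (suc i′) (suc j′)     ∎
    where open ≤-Reasoning
  words-superadditive zero    k′ l zero    (suc j) i′ j′ = z≤n
  words-superadditive zero    k′ l (suc i) j       i′ j′ = z≤n
  -- Away from (0, 0) the `δ₀₀` terms on both sides vanish by computation, and only the first
  -- letters remain to be compared.
  words-superadditive (suc k) k′ l zero    (suc j) i′ j′ =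
    ≤-trans (≤-reflexive (following-*ʳ l (λ l′ → shift l′ (words k l′) 0 (suc j)) c))
      (following-mono l λ l′ → shift-superadditive l′ c i′ j′
        (λ i j → words-superadditive k k′ l′ i j i′ j′) 0 (suc j))
    where c = words k′ [AB] i′ j′
  words-superadditive (suc k) k′ l (suc i) j       i′ j′ =
    ≤-trans (≤-reflexive (following-*ʳ l (λ l′ → shift l′ (words k l′) (suc i) j) c))
      (following-mono l λ l′ → shift-superadditive l′ c i′ j′
        (λ i j → words-superadditive k k′ l′ i j i′ j′) (suc i) j)
    where c = words k′ [AB] i′ j′

  antidiagonal-words-suc : ∀ k l n →
    antidiagonal (suc n) (words (suc k) l) ≡
    following l (λ l′ → antidiagonal (suc n) (shift l′ (words k l′)))
  antidiagonal-words-suc k l n = trans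
    (antidiagonal-cong (suc n) {words (suc k) l}
      {λ i j → following l λ l′ → shift l′ (words k l′) i j}
      λ { zero (suc _) _ → refl ; (suc _) _ _ → refl })
    (antidiagonal-following (suc n) l λ i j l′ → shift l′ (words k l′) i j)

  -- In the grading by i + j a letter `[A]` or `[B]` has weight one and `[AB]` has weight two. For
  -- `[A]` the corresponding equation holds by computation; here the vanishing entry is the last
  -- one.
  antidiagonal-shift-[B] : ∀ n h → antidiagonal (suc n) (shift [B] h) ≡ antidiagonal n h
  antidiagonal-shift-[B] n h = trans (antidiagonal-last n {shift [B] h}) (+-identityʳ _)

  antidiagonal-shift-[AB] : ∀ n h → antidiagonal (2 + n) (shift [AB] h) ≡ antidiagonal n h
  antidiagonal-shift-[AB] n h = antidiagonal-shift-[B] n h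

  antidiagonal≤max : ∀ n f → ∃₂ λ i j → i + j ≡ n × antidiagonal n f ≤ suc n * f i j
  antidiagonal≤max zero    f = 0 , 0 , refl , ≤-reflexive (sym (*-identityˡ _))
  antidiagonal≤max (suc n) f with antidiagonal≤max n (λ i j → f (suc i) j)
  ... | i , j , i+j≡n , max with ≤-total (f 0 (suc n)) (f (suc i) j)
  ... | inj₁ ≤ = suc i , j , cong suc i+j≡n , +-mono-≤ ≤ max
  ... | inj₂ ≥ = 0 , suc n , refl , +-monoʳ-≤ _ (≤-trans max (*-monoʳ-≤ (suc n) ≥))

  -- A word w of the most frequent type on the antidiagonal, an [AB] and a
  -- word of the mirrored type give a word on the diagonal.
  antidiagonal²≤diagonal : ∀ n →
    antidiagonal n (words n [AB]) * antidiagonal n (words n [AB]) ≤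
    suc n * suc n * words (n + suc n) [AB] (suc n) (suc n)
  antidiagonal²≤diagonal n with antidiagonal≤max n (words n [AB])
  ... | i , j , refl , max = begin
    antidiagonal n (words n [AB]) * antidiagonal n (words n [AB])
      ≤⟨ *-mono-≤ max max ⟩
    (suc n * w i j) * (suc n * w i j)
      ≡⟨ cong (λ x → (suc n * w i j) * (suc n * x)) (words-swap n [AB] i j) ⟩
    (suc n * w i j) * (suc n * w j i)
      ≡⟨ lemma (suc n) (w i j) (w j i) ⟩
    suc n * suc n * (w i j * w j i)
      ≤⟨ *-monoʳ-≤ (suc n * suc n) (words-superadditive n n [AB] i j j i) ⟩
    suc n * suc n * words (n + suc n) [AB] (i + suc j) (j + suc i)
      ≡⟨ cong₂ (λ x y → suc n * suc n * words (n + suc n) [AB] x y)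
           (+-suc i j) (trans (+-suc j i) (cong suc (+-comm j i))) ⟩
    suc n * suc n * words (n + suc n) [AB] (suc n) (suc n) ∎
    where
    open ≤-Reasoning
    w = words n [AB]
    lemma : ∀ a x y → (a * x) * (a * y) ≡ a * a * (x * y)
    lemma = solve-∀

-- The list enumeration that defines `u` obeys the recursion of `playsIn`

module ProtocolEnumeration where
  open import Data.Bool.Base using (Bool; true; false; if_then_else_; _∧_; T)
  open import Data.Bool.Properties using (T?)
  open import Data.Empty using (⊥; ⊥-elim)
  open import Data.Fin.Base using (zero; suc)
  open import Data.Fin.Properties using (suc-injective)
  open import Data.Fin.Subset
    using (Subset; inside; outside; _∈_; _∉_; _⊆_; _─_; ∣_∣; ⊤; Nonempty; Empty)
  open import Data.Fin.Subset.Properties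
    using (_∈?_; _⊆?_; nonempty?; drop-there; x∈p∧x∉q⇒x∈p─q; p─q⊆p; ∣⊤∣≡n; ∈⊤)
  open import Data.List.Base
    using (List; []; _∷_; _++_; map; length; filter; cartesianProductWith; cartesianProduct; applyUpTo)
  import Data.Nat.ListAction as List
  open import Data.Nat.Base
  open import Data.Nat.Properties hiding (suc-injective)
  open import Data.Nat.Tactic.RingSolver using (solve-∀)
  open import Data.Product using (∃; ∃!; _×_; _,_; proj₁; proj₂)
  open import Data.Sum.Base using (_⊎_; inj₁; inj₂)
  open import Data.Unit.Base using (tt) renaming (⊤ to Unit)
  open import Data.Vec.Base using (Vec; []; _∷_; lookup; here; there)
  open import Data.Vec.Relation.Unary.Linked using (Linked; []; [-]; _∷_)
  open import Defs using (Turn; alice; bob; IsHotelling; isHotelling; isHotelling?; vecs; subsets; protocols; u)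
  open import Function.Base using (_∘_; id)
  open import Function.Bundles using (_⇔_; mk⇔; Equivalence)
  open import Relation.Binary.PropositionalEquality
  open import Relation.Nullary using (¬_; Dec; yes; no; does; contradiction)
  open import Relation.Nullary.Decidable using (_×-dec_; ¬?; does-⇔)
  open import Relation.Unary using (Decidable)
  open ProtocolCounts

  private variable
    X Y W : Set
    P     : X → Set

  total : List X → (X → ℕ) → ℕ
  total []       w = 0
  total (x ∷ xs) w = w x + total xs w

  total-++ : ∀ (xs ys : List X) {w} → total (xs ++ ys) w ≡ total xs w + total ys w
  total-++ []       ys     = refl
  total-++ (x ∷ xs) ys {w} = trans (cong (w x +_) (total-++ xs ys)) (sym (+-assoc (w x) _ _))

  total-map : ∀ (f : X → Y) xs {w} → total (map f xs) w ≡ total xs (w ∘ f)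
  total-map f []           = refl
  total-map f (x ∷ xs) {w} = cong (w (f x) +_) (total-map f xs)

  total-cong : ∀ (xs : List X) {v w} → (∀ x → v x ≡ w x) → total xs v ≡ total xs w
  total-cong []       v≡w = refl
  total-cong (x ∷ xs) v≡w = cong₂ _+_ (v≡w x) (total-cong xs v≡w)

  total-*ˡ : ∀ c (xs : List X) {w} → total xs (λ x → c * w x) ≡ c * total xs w
  total-*ˡ c []           = sym (*-zeroʳ c)
  total-*ˡ c (x ∷ xs) {w} =
    trans (cong (c * w x +_) (total-*ˡ c xs)) (sym (*-distribˡ-+ c (w x) _))

  total-0 : ∀ (xs : List X) → total xs (λ _ → 0) ≡ 0
  total-0 []       = refl
  total-0 (x ∷ xs) = total-0 xs

  total-cartesianProductWith : ∀ (f : X → Y → W) xs ys {w} →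
    total (cartesianProductWith f xs ys) w ≡ total xs (λ x → total ys (λ y → w (f x y)))
  total-cartesianProductWith f []       ys     = refl
  total-cartesianProductWith f (x ∷ xs) ys {w} =
    trans (total-++ (map (f x) ys) _)
      (cong₂ _+_ (total-map (f x) ys) (total-cartesianProductWith f xs ys))

  χ : Bool → ℕ
  χ b = if b then 1 else 0

  χ-∧ : ∀ a b → χ (a ∧ b) ≡ χ a * χ b
  χ-∧ true  b = sym (+-identityʳ (χ b))
  χ-∧ false b = refl

  length-filter : ∀ (P? : Decidable P) xs → length (filter P? xs) ≡ total xs (λ x → χ (does (P? x)))
  length-filter P? []       = refl
  length-filter P? (x ∷ xs) with does (P? x)
  ... | true  = cong suc (length-filter P? xs)
  ... | false = length-filter P? xs

  -- An element outside `R` must stay outside `S`, and an element of `R` has both options: this is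
  -- the recursion of `binomial`. So the enumeration over all subsets depends on `R` only through
  -- its size.
  total-subsets : ∀ {m} (R : Subset m) (G : ℕ → ℕ → ℕ) →
    total (subsets m) (λ S → χ (does (S ⊆? R)) * G (∣ S ∣) (∣ R ─ S ∣)) ≡ binomial (∣ R ∣) G
  total-subsets []                    G = trans (+-identityʳ _) (*-identityˡ _)
  total-subsets {suc m} (r ∷ R) G = trans
    (total-cartesianProductWith _∷_ (outside ∷ inside ∷ []) (subsets m))
    (trans (cong (total (subsets m) (λ S → w (outside ∷ S)) +_) (+-identityʳ _)) (split r))
    where
    w : Subset (suc m) → ℕ
    w S = χ (does (S ⊆? (r ∷ R))) * G (∣ S ∣) (∣ (r ∷ R) ─ S ∣)
    split : ∀ r →
      total (subsets m) (λ S → χ (does ((outside ∷ S) ⊆? (r ∷ R))) * G ∣ S ∣ ∣ (r ∷ R) ─ (outside ∷ S) ∣) +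
      total (subsets m) (λ S → χ (does ((inside ∷ S) ⊆? (r ∷ R))) * G (suc ∣ S ∣) ∣ (r ∷ R) ─ (inside ∷ S) ∣)
      ≡ binomial ∣ r ∷ R ∣ G
    split outside =
      trans (cong₂ _+_ (total-subsets R G) (total-0 (subsets m))) (+-identityʳ _)
    split inside  = trans
      (cong₂ _+_ (total-subsets R (λ a b → G a (suc b))) (total-subsets R (λ a b → G (suc a) b)))
      (+-comm (binomial ∣ R ∣ _) _)

  x∈p─q⇒x∉q : ∀ {n} (p q : Subset n) {x} → x ∈ p ─ q → x ∉ q
  x∈p─q⇒x∉q (_ ∷ p) (outside ∷ q) {suc x} x∈ x∈q =
    x∈p─q⇒x∉q p q (drop-there x∈) (drop-there x∈q)
  x∈p─q⇒x∉q (_ ∷ p) (inside ∷ q)  {suc x} x∈ x∈q =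
    x∈p─q⇒x∉q p q (drop-there x∈) (drop-there x∈q)
  x∈p─q⇒x∉q (_ ∷ p) (inside ∷ q)  {zero}  () x∈q
  x∈p─q⇒x∉q (_ ∷ p) (outside ∷ q) {zero}  x∈ ()

  module _ {m} (f : X → Subset m) where

    -- A form of the condition that recurses over the turns: each turn spends part of what is left,
    -- and at the end nothing is left.
    ExactlyOnce : ∀ {k} → Subset m → Vec X k → Set
    ExactlyOnce R []      = Empty R
    ExactlyOnce R (x ∷ p) = f x ⊆ R × ExactlyOnce (R ─ f x) p

    exactlyOnce? : ∀ {k} R (p : Vec X k) → Dec (ExactlyOnce R p)
    exactlyOnce? R []      = ¬? (nonempty? R)
    exactlyOnce? R (x ∷ p) = (f x ⊆? R) ×-dec exactlyOnce? (R ─ f x) p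

    -- The second component carries the uniqueness: an element spent at the first turn is outside
    -- the remaining set, hence absent from all later turns.
    exactlyOnce-∈ : ∀ {k} R (p : Vec X k) → ExactlyOnce R p →
      ∀ i → (i ∈ R → ∃! _≡_ λ t → i ∈ f (lookup p t)) × (i ∉ R → ∀ t → i ∉ f (lookup p t))
    exactlyOnce-∈ R []      empty   i = (λ i∈R → contradiction (i , i∈R) empty) , λ _ ()
    exactlyOnce-∈ R (x ∷ p) (⊆R , once) i
      with i ∈? f x | exactlyOnce-∈ (R ─ f x) p once i
    ... | yes i∈x | _ , never =
      (λ _ → zero , i∈x , λ { {zero} _ → refl ; {suc t} i∈ → contradiction i∈ (never (λ i∈R─x → x∈p─q⇒x∉q R (f x) i∈R─x i∈x) t) })
      , λ i∉R → contradiction (⊆R i∈x) i∉R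
    ... | no i∉x | unique , never =
      (λ i∈R → let (t , i∈t , u) = unique (x∈p∧x∉q⇒x∈p─q i∈R i∉x) in
        suc t , i∈t , λ { {zero} i∈x → contradiction i∈x i∉x ; {suc s} i∈s → cong suc (u i∈s) })
      , λ { i∉R zero → i∉x ; i∉R (suc t) → never (i∉R ∘ p─q⊆p R (f x)) t }

    ∈-exactlyOnce : ∀ {k} R (p : Vec X k) →
      (∀ i → (i ∈ R → ∃! _≡_ λ t → i ∈ f (lookup p t)) × (i ∉ R → ∀ t → i ∉ f (lookup p t))) →
      ExactlyOnce R p
    ∈-exactlyOnce R []      h (i , i∈R) with proj₁ (h i) i∈R
    ... | () , _
    ∈-exactlyOnce R (x ∷ p) h = ⊆R , ∈-exactlyOnce (R ─ f x) p λ i →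
      (λ i∈ → later i (proj₁ (h i) (p─q⊆p R (f x) i∈)) (x∈p─q⇒x∉q R (f x) i∈)) , never i
      where
      ⊆R : f x ⊆ R
      ⊆R {i} i∈x with i ∈? R
      ... | yes i∈R = i∈R
      ... | no  i∉R = contradiction i∈x (proj₂ (h i) i∉R zero)
      later : ∀ i → (∃! _≡_ λ t → i ∈ f (lookup (x ∷ p) t)) → i ∉ f x →
              ∃! _≡_ λ t → i ∈ f (lookup p t)
      later i (zero  , i∈x , _) i∉x = contradiction i∈x i∉x
      later i (suc t , i∈t , u) _   = t , i∈t , λ i∈s → suc-injective (u i∈s)
      never : ∀ i → i ∉ R ─ f x → ∀ t → i ∉ f (lookup p t)
      never i i∉ t i∈t with i ∈? f x
      ... | no  i∉x = proj₂ (h i) (λ i∈R → i∉ (x∈p∧x∉q⇒x∈p─q i∈R i∉x)) (suc t) i∈t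
      ... | yes i∈x with proj₁ (h i) (⊆R i∈x)
      ... | _ , _ , u with trans (sym (u {zero} i∈x)) (u {suc t} i∈t)
      ... | ()

  -- The value at 0 0 is a default, since `permitted` rejects an empty turn. The choice `[B]` keeps
  -- `kindOf-alice` true even there, whereas `kindOf-bob` has to assume that someone moves.
  kind : ℕ → ℕ → Letter
  kind zero    _       = [B]
  kind (suc _) zero    = [A]
  kind (suc _) (suc _) = [AB]

  permitted : Letter → ℕ → ℕ → Bool
  permitted _   zero    zero    = false
  permitted [A] (suc _) zero    = false
  permitted [B] zero    (suc _) = false
  permitted _   _       _       = true

  aliceRests bobRests : Letter → Set
  aliceRests [B] = Unit
  aliceRests _   = ⊥
  bobRests   [A] = Unit
  bobRests   _   = ⊥

  size : ∀ {n} (S : Subset n) → ((∣ S ∣) ≡ 0 × Empty S) ⊎ (∃ λ a → (∣ S ∣) ≡ suc a × Nonempty S)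
  size []            = inj₁ (refl , λ ())
  size (inside ∷ S)  = inj₂ (∣ S ∣ , refl , zero , here)
  size (outside ∷ S) with size S
  ... | inj₁ (eq , empty)         = inj₁ (eq , λ { (suc i , i∈) → empty (i , drop-there i∈) })
  ... | inj₂ (a , eq , (i , i∈S)) = inj₂ (a , eq , suc i , there i∈S)

  module _ {m n : ℕ} where

    Moves : Turn m n → Set
    Moves x = Nonempty (alice x) ⊎ Nonempty (bob x)

    After : Letter → Turn m n → Set
    After l x = ¬ (aliceRests l × Empty (alice x)) × ¬ (bobRests l × Empty (bob x))

    kindOf : Turn m n → Letter
    kindOf x = kind (∣ alice x ∣) (∣ bob x ∣)

    allowed : Letter → Turn m n → Bool
    allowed l x = permitted l (∣ alice x ∣) (∣ bob x ∣)

    legal : ∀ {k} → Letter → Vec (Turn m n) k → Bool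
    legal l []      = true
    legal l (x ∷ p) = allowed l x ∧ legal (kindOf x) p

    allowed-sound : ∀ l x → T (allowed l x) → Moves x × After l x
    allowed-sound l x ok with size (alice x) | size (bob x)
    allowed-sound l    x ok | inj₁ (a≡ , _) | inj₁ (b≡ , _) rewrite a≡ | b≡ = ⊥-elim ok
    allowed-sound [A]  x ok | inj₁ (a≡ , _) | inj₂ (_ , b≡ , b) =
      inj₂ b , (λ ()) , λ (_ , empty) → empty b
    allowed-sound [B]  x ok | inj₁ (a≡ , _) | inj₂ (_ , b≡ , b) rewrite a≡ | b≡ = ⊥-elim ok
    allowed-sound [AB] x ok | inj₁ (a≡ , _) | inj₂ (_ , b≡ , b) = inj₂ b , (λ ()) , λ ()
    allowed-sound [A]  x ok | inj₂ (_ , a≡ , a) | inj₁ (b≡ , _) rewrite a≡ | b≡ = ⊥-elim ok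
    allowed-sound [B]  x ok | inj₂ (_ , a≡ , a) | inj₁ (b≡ , _) =
      inj₁ a , (λ (_ , empty) → empty a) , λ ()
    allowed-sound [AB] x ok | inj₂ (_ , a≡ , a) | inj₁ (b≡ , _) = inj₁ a , (λ ()) , λ ()
    allowed-sound l    x ok | inj₂ (_ , a≡ , a) | inj₂ (_ , b≡ , b) =
      inj₁ a , (λ (_ , empty) → empty a) , λ (_ , empty) → empty b

    allowed-complete : ∀ l x → Moves x → After l x → T (allowed l x)
    allowed-complete l x moves after with size (alice x) | size (bob x)
    allowed-complete l x (inj₁ a) after | inj₁ (_ , empty) | inj₁ _ = contradiction a empty
    allowed-complete l x (inj₂ b) after | inj₁ _ | inj₁ (_ , empty) = contradiction b empty
    allowed-complete [A]  x moves after | inj₁ (a≡ , _) | inj₂ (_ , b≡ , _) rewrite a≡ | b≡ = tt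
    allowed-complete [B]  x moves after | inj₁ (_ , empty) | inj₂ _ =
      contradiction (tt , empty) (proj₁ after)
    allowed-complete [AB] x moves after | inj₁ (a≡ , _) | inj₂ (_ , b≡ , _) rewrite a≡ | b≡ = tt
    allowed-complete [A]  x moves after | inj₂ _ | inj₁ (_ , empty) =
      contradiction (tt , empty) (proj₂ after)
    allowed-complete [B]  x moves after | inj₂ (_ , a≡ , _) | inj₁ _ rewrite a≡ = tt
    allowed-complete [AB] x moves after | inj₂ (_ , a≡ , _) | inj₁ _ rewrite a≡ = tt
    allowed-complete [A]  x moves after | inj₂ (_ , a≡ , _) | inj₂ (_ , b≡ , _) rewrite a≡ | b≡ = tt
    allowed-complete [B]  x moves after | inj₂ (_ , a≡ , _) | inj₂ _ rewrite a≡ = tt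
    allowed-complete [AB] x moves after | inj₂ (_ , a≡ , _) | inj₂ _ rewrite a≡ = tt

    kindOf-alice : ∀ x → aliceRests (kindOf x) ⇔ Empty (alice x)
    kindOf-alice x with size (alice x) | size (bob x)
    ... | inj₁ (a≡ , empty) | _ rewrite a≡ = mk⇔ (λ _ → empty) (λ _ → tt)
    ... | inj₂ (_ , a≡ , a) | inj₁ (b≡ , _) rewrite a≡ | b≡ = mk⇔ (λ ()) (λ empty → empty a)
    ... | inj₂ (_ , a≡ , a) | inj₂ (_ , b≡ , _) rewrite a≡ | b≡ = mk⇔ (λ ()) (λ empty → empty a)

    kindOf-bob : ∀ x → Moves x → bobRests (kindOf x) ⇔ Empty (bob x)
    kindOf-bob x moves with size (alice x) | size (bob x)
    kindOf-bob x (inj₁ a) | inj₁ (_ , empty) | _ = contradiction a empty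
    kindOf-bob x (inj₂ b) | inj₁ (a≡ , _) | _ rewrite a≡ = mk⇔ (λ ()) (λ empty → empty b)
    kindOf-bob x moves | inj₂ (_ , a≡ , _) | inj₁ (b≡ , empty) rewrite a≡ | b≡ =
      mk⇔ (λ _ → empty) (λ _ → tt)
    kindOf-bob x moves | inj₂ (_ , a≡ , _) | inj₂ (_ , b≡ , b) rewrite a≡ | b≡ =
      mk⇔ (λ ()) (λ empty → empty b)

    AfterHead : ∀ {k} → Letter → Vec (Turn m n) k → Set
    AfterHead l []      = Unit
    AfterHead l (y ∷ _) = After l y

    AliceActs BobActs : Turn m n → Turn m n → Set
    AliceActs x y = ¬ (Empty (alice x) × Empty (alice y))
    BobActs   x y = ¬ (Empty (bob x) × Empty (bob y))

    Legal : ∀ {k} → Letter → Vec (Turn m n) k → Set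
    Legal l p = (∀ t → Moves (lookup p t)) × AfterHead l p × Linked AliceActs p × Linked BobActs p

    legal-sound : ∀ {k} l (p : Vec (Turn m n) k) → T (legal l p) → Legal l p
    legal-sound l []      _  = (λ ()) , tt , [] , []
    legal-sound l (x ∷ p) ok with allowed l x in allowed≡
    ... | true with allowed-sound l x (subst T (sym allowed≡) tt) | legal-sound (kindOf x) p ok
    ... | moves , after | moves′ , after′ , as , bs =
      (λ { zero → moves ; (suc t) → moves′ t }) , after , linkA p after′ as , linkB p after′ bs
      where
      linkA : ∀ {k} (p : Vec (Turn m n) k) → AfterHead (kindOf x) p →
              Linked AliceActs p → Linked AliceActs (x ∷ p)
      linkA []      _           _  = [-]
      linkA (y ∷ p) (after , _) as =
        (λ (ex , ey) → after (Equivalence.from (kindOf-alice x) ex , ey)) ∷ as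
      linkB : ∀ {k} (p : Vec (Turn m n) k) → AfterHead (kindOf x) p →
              Linked BobActs p → Linked BobActs (x ∷ p)
      linkB []      _           _  = [-]
      linkB (y ∷ p) (_ , after) bs =
        (λ (ex , ey) → after (Equivalence.from (kindOf-bob x moves) ex , ey)) ∷ bs

    legal-complete : ∀ {k} l (p : Vec (Turn m n) k) → Legal l p → T (legal l p)
    legal-complete l []      _ = tt
    legal-complete l (x ∷ p) (moves , after , as , bs)
      with allowed l x | allowed-complete l x (moves zero) after
    ... | true | _ = legal-complete (kindOf x) p
      ((λ t → moves (suc t)) , afterHead p as bs , tail as , tail bs)
      where
      tail : ∀ {R : Turn m n → Turn m n → Set} {k} {p : Vec (Turn m n) k} →
             Linked R (x ∷ p) → Linked R p
      tail [-]      = []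
      tail (_ ∷ rs) = rs
      afterHead : ∀ {k} (p : Vec (Turn m n) k) →
                  Linked AliceActs (x ∷ p) → Linked BobActs (x ∷ p) → AfterHead (kindOf x) p
      afterHead []      _       _       = tt
      afterHead (y ∷ p) (a ∷ _) (b ∷ _) =
        (λ (rests , ey) → a (Equivalence.to (kindOf-alice x) rests , ey)) ,
        (λ (rests , ey) → b (Equivalence.to (kindOf-bob x (moves zero)) rests , ey))

    Protocol : ∀ {k} → Letter → Subset m → Subset n → Vec (Turn m n) k → Set
    Protocol l R Q p = ExactlyOnce alice R p × ExactlyOnce bob Q p × T (legal l p)

    protocol? : ∀ {k} l R Q (p : Vec (Turn m n) k) → Dec (Protocol l R Q p)
    protocol? l R Q p = exactlyOnce? alice R p ×-dec exactlyOnce? bob Q p ×-dec T? (legal l p)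

    -- `IsHotelling` speaks of all turns at once. `Protocol` reads them from the left, with the
    -- previous letter and the two sets of remaining moves as its state, which is the form that can
    -- be counted recursively.
    isHotelling⇔protocol : ∀ {k} (p : Vec (Turn m n) k) → IsHotelling p ⇔ Protocol [AB] ⊤ ⊤ p
    isHotelling⇔protocol {k} p = mk⇔
      (λ (isHotelling as bs moves arest brest) →
        ∈-exactlyOnce alice ⊤ p (λ i → (λ _ → as i) , contradiction ∈⊤) ,
        ∈-exactlyOnce bob ⊤ p (λ j → (λ _ → bs j) , contradiction ∈⊤) ,
        legal-complete [AB] p (moves , unconstrained p , arest , brest))
      (λ (as , bs , ok) → let (moves , _ , arest , brest) = legal-sound [AB] p ok in
        isHotelling (λ i → proj₁ (exactlyOnce-∈ alice ⊤ p as i) ∈⊤)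
          (λ j → proj₁ (exactlyOnce-∈ bob ⊤ p bs j) ∈⊤) moves arest brest)
      where
      unconstrained : ∀ {k} (p : Vec (Turn m n) k) → AfterHead [AB] p
      unconstrained []      = tt
      unconstrained (_ ∷ _) = (λ ()) , λ ()

    protocolsAfter : ℕ → Letter → Subset m → Subset n → ℕ
    protocolsAfter k l R Q =
      total (vecs (cartesianProduct (subsets m) (subsets n)) k) λ p → χ (does (protocol? l R Q p))

  ifZero : (ℕ → ℕ) → ℕ → ℕ → ℕ
  ifZero h zero    b = h b
  ifZero h (suc _) b = 0

  binomial-0 : ∀ n → binomial n (λ _ _ → 0) ≡ 0
  binomial-0 n = binomial-*ˡ n 0 {λ _ _ → 0}

  binomial-ifZero : ∀ n h → binomial n (ifZero h) ≡ h n
  binomial-ifZero zero    h = refl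
  binomial-ifZero (suc n) h = cong₂ _+_ (binomial-0 n)
    (trans (binomial-cong n λ { zero b _ → refl ; (suc a) b _ → refl }) (binomial-ifZero n (h ∘ suc)))

  -- The contribution to a move of type l of a turn at which Alice makes a
  -- moves and Bob c moves, leaving b and d of them respectively.
  turn : Letter → (ℕ → ℕ → ℕ) → ℕ → ℕ → ℕ → ℕ → ℕ
  turn [A]  h a b c d = ifPositive (λ b → ifZero (h b) c d) a b
  turn [B]  h a b c d = ifZero (λ b → ifPositive (h b) c d) a b
  turn [AB] h a b c d = ifPositive (λ b → ifPositive (h b) c d) a b

  -- Which of `a` and `c` are positive determines the letter of the turn, so at most one summand on
  -- the right is nonzero, and it occurs exactly if that letter may follow `l`.
  permitted-turn : ∀ l (h : Letter → ℕ → ℕ → ℕ) a b c d →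
    χ (permitted l a c) * h (kind a c) b d ≡ following l (λ l′ → turn l′ (h l′) a b c d)
  permitted-turn [A]  h zero    b zero    d = refl
  permitted-turn [A]  h zero    b (suc c) d = refl
  permitted-turn [A]  h (suc a) b zero    d = refl
  permitted-turn [A]  h (suc a) b (suc c) d = +-identityʳ _
  permitted-turn [B]  h zero    b zero    d = refl
  permitted-turn [B]  h zero    b (suc c) d = refl
  permitted-turn [B]  h (suc a) b zero    d = refl
  permitted-turn [B]  h (suc a) b (suc c) d = +-identityʳ _
  permitted-turn [AB] h zero    b zero    d = refl
  permitted-turn [AB] h zero    b (suc c) d = refl
  permitted-turn [AB] h (suc a) b zero    d = sym (+-identityʳ _)
  permitted-turn [AB] h (suc a) b (suc c) d = +-identityʳ _

  binomial-turn : ∀ l h ρ σ →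
    binomial ρ (λ a b → binomial σ (turn l h a b)) ≡ move l h ρ σ
  binomial-turn [A]  h ρ σ = binomial-cong ρ
    λ { zero b _ → binomial-0 σ ; (suc a) b _ → binomial-ifZero σ (h b) }
  binomial-turn [B]  h ρ σ = trans
    (binomial-cong ρ λ { zero b _ → refl ; (suc a) b _ → binomial-0 σ })
    (binomial-ifZero ρ (λ b → binomial σ (ifPositive (h b))))
  binomial-turn [AB] h ρ σ = binomial-cong ρ
    λ { zero b _ → binomial-0 σ ; (suc a) b _ → refl }

  binomial-following : ∀ n l (f : Letter → ℕ → ℕ → ℕ) →
    binomial n (λ a b → following l λ l′ → f l′ a b) ≡ following l (λ l′ → binomial n (f l′))
  binomial-following n [A]  f = binomial-+ n
  binomial-following n [B]  f = binomial-+ n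
  binomial-following n [AB] f = trans (binomial-+ n) (cong (_+ binomial n (f [AB])) (binomial-+ n))

  module _ {m n : ℕ} where

    -- Regroups the indicator of a protocol into three conditions on its first turn and the
    -- indicator of the protocol formed by the others.
    χ-step : ∀ s a t b v w →
      χ ((s ∧ a) ∧ (t ∧ b) ∧ (v ∧ w)) ≡ χ s * (χ t * (χ v * χ (a ∧ b ∧ w)))
    χ-step s a t b v w
      rewrite χ-∧ (s ∧ a) ((t ∧ b) ∧ (v ∧ w)) | χ-∧ (t ∧ b) (v ∧ w) | χ-∧ s a | χ-∧ t b | χ-∧ v w
            | χ-∧ a (b ∧ w) | χ-∧ b w = lemma (χ s) (χ a) (χ t) (χ b) (χ v) (χ w)
      where
      lemma : ∀ s a t b v w → s * a * (t * b * (v * w)) ≡ s * (t * (v * (a * (b * w))))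
      lemma = solve-∀

    -- The first turn is a pair of sets. Summing over Bob's set and then over Alice's by
    -- `total-subsets` leaves only sizes, and the sum over sizes then splits according to the letter
    -- of the turn.
    protocolsAfter≡playsIn : ∀ k l (R : Subset m) (Q : Subset n) →
      protocolsAfter k l R Q ≡ playsIn k l (∣ R ∣) (∣ Q ∣)
    protocolsAfter≡playsIn zero    l R Q = trans (+-identityʳ _) initial
      where
      initial : χ (does (protocol? l R Q [])) ≡ δ₀₀ (∣ R ∣) (∣ Q ∣)
      initial with nonempty? R | size R | nonempty? Q | size Q
      ... | yes nonempty | inj₁ (_ , empty)        | _ | _ = contradiction nonempty empty
      ... | yes _        | inj₂ (_ , R≡ , _)       | _ | _ rewrite R≡ = refl
      ... | no empty     | inj₂ (_ , _ , nonempty) | _ | _ = contradiction nonempty empty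
      ... | no _ | inj₁ _ | yes nonempty | inj₁ (_ , empty)        = contradiction nonempty empty
      ... | no _ | inj₁ _ | no empty     | inj₂ (_ , _ , nonempty) = contradiction nonempty empty
      ... | no _ | inj₁ (R≡ , _) | yes _ | inj₂ (_ , Q≡ , _) rewrite R≡ | Q≡ = refl
      ... | no _ | inj₁ (R≡ , _) | no _  | inj₁ (Q≡ , _)     rewrite R≡ | Q≡ = refl
    protocolsAfter≡playsIn (suc k) l R Q = begin
      protocolsAfter (suc k) l R Q
        ≡⟨ trans (total-cartesianProductWith _∷_ turns (vecs turns k))
             (total-cartesianProductWith _,_ (subsets m) (subsets n)) ⟩
      total (subsets m) (λ S → total (subsets n) λ T → total (vecs turns k) λ p →
        χ (does (protocol? l R Q ((S , T) ∷ p))))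
        ≡⟨ total-cong (subsets m) (λ S → trans (total-cong (subsets n) (inner S))
             (total-*ˡ (χ (does (S ⊆? R))) (subsets n))) ⟩
      total (subsets m) (λ S → χ (does (S ⊆? R)) * total (subsets n) λ T →
        χ (does (T ⊆? Q)) * G (∣ S ∣) (∣ R ─ S ∣) (∣ T ∣) (∣ Q ─ T ∣))
        ≡⟨ total-cong (subsets m) (λ S → cong (χ (does (S ⊆? R)) *_)
             (total-subsets Q (G (∣ S ∣) (∣ R ─ S ∣)))) ⟩
      total (subsets m) (λ S → χ (does (S ⊆? R)) * binomial (∣ Q ∣) (G (∣ S ∣) (∣ R ─ S ∣)))
        ≡⟨ total-subsets R (λ a b → binomial ∣ Q ∣ (G a b)) ⟩
      binomial (∣ R ∣) (λ a b → binomial (∣ Q ∣) (G a b))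
        ≡⟨ binomial-cong ∣ R ∣ (λ a b _ → trans
             (binomial-cong ∣ Q ∣ λ c d _ → permitted-turn l (playsIn k) a b c d)
             (binomial-following ∣ Q ∣ l λ l′ → turn l′ (playsIn k l′) a b)) ⟩
      binomial (∣ R ∣) (λ a b → following l λ l′ → binomial (∣ Q ∣) (turn l′ (playsIn k l′) a b))
        ≡⟨ binomial-following ∣ R ∣ l _ ⟩
      following l (λ l′ → binomial (∣ R ∣) λ a b → binomial (∣ Q ∣) (turn l′ (playsIn k l′) a b))
        ≡⟨ following-cong l (λ l′ → binomial-turn l′ (playsIn k l′) (∣ R ∣) (∣ Q ∣)) ⟩
      playsIn (suc k) l (∣ R ∣) (∣ Q ∣) ∎
      where
      open ≡-Reasoning
      turns = cartesianProduct (subsets m) (subsets n)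
      G : ℕ → ℕ → ℕ → ℕ → ℕ
      G a b c d = χ (permitted l a c) * playsIn k (kind a c) b d
      inner : ∀ S T → total (vecs turns k) (λ p → χ (does (protocol? l R Q ((S , T) ∷ p)))) ≡
              χ (does (S ⊆? R)) * (χ (does (T ⊆? Q)) * G (∣ S ∣) (∣ R ─ S ∣) (∣ T ∣) (∣ Q ─ T ∣))
      inner S T = begin
        total (vecs turns k) (λ p → χ (does (protocol? l R Q ((S , T) ∷ p))))
          ≡⟨ total-cong (vecs turns k) (λ p → χ-step s (does (exactlyOnce? alice (R ─ S) p))
               t (does (exactlyOnce? bob (Q ─ T) p)) v (legal (kindOf (S , T)) p)) ⟩
        total (vecs turns k) (λ p → χ s * (χ t * (χ v * χ (does (protocol? (kindOf (S , T)) (R ─ S) (Q ─ T) p)))))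
          ≡⟨ trans (total-*ˡ (χ s) (vecs turns k)) (cong (χ s *_)
               (trans (total-*ˡ (χ t) (vecs turns k)) (cong (χ t *_)
               (trans (total-*ˡ (χ v) (vecs turns k)) (cong (χ v *_)
                 (protocolsAfter≡playsIn k (kindOf (S , T)) (R ─ S) (Q ─ T))))))) ⟩
        χ s * (χ t * (χ v * playsIn k (kindOf (S , T)) (∣ R ─ S ∣) (∣ Q ─ T ∣))) ∎
        where
        s = does (S ⊆? R)
        t = does (T ⊆? Q)
        v = allowed l (S , T)

  length-protocols : ∀ m n k → length (protocols m n k) ≡ playsIn k [AB] m n
  length-protocols m n k = begin
    length (protocols m n k)
      ≡⟨ length-filter isHotelling? (vecs turns k) ⟩
    total (vecs turns k) (λ p → χ (does (isHotelling? p)))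
      ≡⟨ total-cong (vecs turns k) (λ p → cong χ
           (does-⇔ (isHotelling⇔protocol p) (isHotelling? p) (protocol? [AB] ⊤ ⊤ p))) ⟩
    protocolsAfter k [AB] ⊤ ⊤
      ≡⟨ protocolsAfter≡playsIn k [AB] ⊤ ⊤ ⟩
    playsIn k [AB] (∣ ⊤ {m} ∣) (∣ ⊤ {n} ∣)
      ≡⟨ cong₂ (playsIn k [AB]) (∣⊤∣≡n m) (∣⊤∣≡n n) ⟩
    playsIn k [AB] m n ∎
    where
    open ≡-Reasoning
    turns = cartesianProduct (subsets m) (subsets n)

  sum-applyUpTo : ∀ n (f g : ℕ → ℕ) → List.sum (map f (applyUpTo g (suc n))) ≡ sum n (f ∘ g)
  sum-applyUpTo zero    f g = +-identityʳ _
  sum-applyUpTo (suc n) f g =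
    trans (cong (f (g 0) +_) (sum-applyUpTo n f (g ∘ suc))) (sym (sum-head n))

  u≡plays : ∀ m n → u m n ≡ plays (m + n) [AB] m n
  u≡plays m n = trans (sum-applyUpTo (m + n) (λ k → length (protocols m n k)) id)
    (sum-cong (m + n) λ k _ → length-protocols m n k)

-- Arithmetic in an abstract archimedean ordered ring

open import Data.Integer.Base using (+_)
import Data.Integer.Base as ℤ
import Data.Integer.Properties as ℤ
open import Data.Rational.Base using (ℚ; 0ℚ; 1ℚ; ½; _/_)
import Data.Rational.Base as ℚ
import Data.Rational.Properties as ℚ
import Data.Rational.Unnormalised.Base as ℚᵘ

-- All that the proof uses of the real numbers; working with a variable ring
-- also keeps Agda from unfolding Cauchy sequences.
record ArchimedeanRing : Set₁ where
  infix 4 _≤_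
  field
    commutativeRing : CommutativeRing 0ℓ 0ℓ
  open CommutativeRing commutativeRing public
  field
    _≤_            : Rel Carrier 0ℓ
    isPartialOrder : IsPartialOrder _≈_ _≤_
    +-mono-≤       : ∀ {x y u v} → x ≤ y → u ≤ v → x + u ≤ y + v
    *-nonNegative  : ∀ {x y} → 0# ≤ x → 0# ≤ y → 0# ≤ x * y
    0≤x²           : ∀ x → 0# ≤ x * x
    ι              : ℚ → Carrier
    ι-0            : ι 0ℚ ≈ 0#
    ι-1            : ι 1ℚ ≈ 1#
    ι-+            : ∀ p q → ι (p ℚ.+ q) ≈ ι p + ι q
    ι-*            : ∀ p q → ι (p ℚ.* q) ≈ ι p * ι q
    ι-neg          : ∀ p → ι (ℚ.- p) ≈ - ι p
    ι-mono         : ∀ {p q} → p ℚ.≤ q → ι p ≤ ι q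
    ι-reflects     : ∀ {p q} → ι p ≤ ι q → p ℚ.≤ q
    ≤-approx       : ∀ {x y} → (∀ ε → 0ℚ ℚ.< ε → x ≤ y + ι ε) → x ≤ y
    located        : ∀ x {p q} → p ℚ.< q → ι p ≤ x ⊎ x ≤ ι q
    bounded        : ∀ x → ∃[ B ] 0ℚ ℚ.< B × x ≤ ι B

module NaturalsInℚ where
  open import Data.Rational.Properties using (toℚᵘ-injective; toℚᵘ-fromℚᵘ; toℚᵘ-homo-+; toℚᵘ-homo-*; toℚᵘ-cancel-≤)
  open ℚᵘ using (mkℚᵘ; *≡*; *≤*; _≃_)
  import Data.Rational.Unnormalised.Properties as ℚᵘ
  open import Data.Integer.Tactic.RingSolver using (solve-∀)
  open ≡ using (sym; trans; cong)

  toℚᵘ-/ : ∀ n d → ℚ.toℚᵘ (n / suc d) ≃ mkℚᵘ n d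
  toℚᵘ-/ n d = toℚᵘ-fromℚᵘ (mkℚᵘ n d)

  /1-+ : ∀ m n → + (m ℕ.+ n) / 1 ≡ (+ m / 1) ℚ.+ (+ n / 1)
  /1-+ m n = toℚᵘ-injective (ℚᵘ.≃-trans (toℚᵘ-/ (+ (m ℕ.+ n)) 0) (ℚᵘ.≃-sym
    (ℚᵘ.≃-trans (toℚᵘ-homo-+ (+ m / 1) (+ n / 1))
    (ℚᵘ.≃-trans (ℚᵘ.+-cong (toℚᵘ-/ (+ m) 0) (toℚᵘ-/ (+ n) 0))
      (*≡* (trans (lemma (+ m) (+ n)) (cong (ℤ._* ℤ.1ℤ) (sym (ℤ.pos-+ m n)))))))))
    where
    lemma : ∀ x y → (x ℤ.* ℤ.1ℤ ℤ.+ y ℤ.* ℤ.1ℤ) ℤ.* ℤ.1ℤ ≡ (x ℤ.+ y) ℤ.* ℤ.1ℤ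
    lemma = solve-∀

  /1-* : ∀ m n → + (m ℕ.* n) / 1 ≡ (+ m / 1) ℚ.* (+ n / 1)
  /1-* m n = toℚᵘ-injective (ℚᵘ.≃-trans (toℚᵘ-/ (+ (m ℕ.* n)) 0) (ℚᵘ.≃-sym
    (ℚᵘ.≃-trans (toℚᵘ-homo-* (+ m / 1) (+ n / 1))
    (ℚᵘ.≃-trans (ℚᵘ.*-cong (toℚᵘ-/ (+ m) 0) (toℚᵘ-/ (+ n) 0))
      (*≡* (cong (ℤ._* ℤ.1ℤ) (sym (ℤ.pos-* m n))))))))

  /1-mono : ∀ {m n} → m ℕ.≤ n → + m / 1 ℚ.≤ + n / 1
  /1-mono {m} {n} m≤n = toℚᵘ-cancel-≤ (ℚᵘ.≤-trans (ℚᵘ.≤-reflexive (toℚᵘ-/ (+ m) 0))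
    (ℚᵘ.≤-trans (*≤* (ℤ.*-monoʳ-≤-nonNeg ℤ.1ℤ (ℤ.+≤+ m≤n)))
      (ℚᵘ.≤-reflexive (ℚᵘ.≃-sym (toℚᵘ-/ (+ n) 0)))))

  /1-inverse : ∀ n .{{_ : ℕ.NonZero n}} → (+ n / 1) ℚ.* (+ 1 / n) ≡ 1ℚ
  /1-inverse (suc n) = toℚᵘ-injective
    (ℚᵘ.≃-trans (toℚᵘ-homo-* (+ suc n / 1) (+ 1 / suc n))
    (ℚᵘ.≃-trans (ℚᵘ.*-cong (toℚᵘ-/ (+ suc n) 0) (toℚᵘ-/ (+ 1) n))
      (*≡* (lemma (+ suc n)))))
    where
    lemma : ∀ x → (x ℤ.* ℤ.1ℤ) ℤ.* ℤ.1ℤ ≡ ℤ.1ℤ ℤ.* (ℤ.1ℤ ℤ.* x)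
    lemma = solve-∀

module Toolkit (F : ArchimedeanRing) where
  open ArchimedeanRing F public
  open IsPartialOrder isPartialOrder public
    using () renaming (refl to ≤-refl; trans to ≤-trans; reflexive to ≤-reflexive; antisym to ≤-antisym)
  open import Algebra.Solver.Ring.AlmostCommutativeRing
    using (fromCommutativeRing; _-Raw-AlmostCommutative⟶_; Induced-equivalence)
  open import Relation.Binary.Bundles using (Poset)
  open import Relation.Binary.Definitions using (WeaklyDecidable)
  open import Relation.Nullary using (¬_; yes; no; contradiction)
  open import Relation.Nullary.Decidable using (True; toWitness; False; toWitnessFalse)
  open import Data.Maybe.Base using (just; nothing)
  open import Data.Empty using (⊥)

  poset : Poset 0ℓ 0ℓ 0ℓ
  poset = record { isPartialOrder = isPartialOrder }

  private
    -- Makes the rationals the coefficients of the ring solver, so that identities with constants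
    -- such as ½ or 4/3 are normalised by computing in ℚ.
    morphism : CommutativeRing.rawRing ℚ.+-*-commutativeRing
               -Raw-AlmostCommutative⟶ fromCommutativeRing commutativeRing
    morphism = record
      { ⟦_⟧ = ι ; +-homo = ι-+ ; *-homo = ι-* ; -‿homo = ι-neg ; 0-homo = ι-0 ; 1-homo = ι-1 }

    coefficient≟ : WeaklyDecidable (Induced-equivalence morphism)
    coefficient≟ p q with p ℚ.≟ q
    ... | yes ≡.refl = just refl
    ... | no  _      = nothing

  open import Algebra.Solver.Ring (CommutativeRing.rawRing ℚ.+-*-commutativeRing)
    (fromCommutativeRing commutativeRing) morphism coefficient≟ public
    using (solve; con; _:=_; _:+_; _:*_; _:-_; :-_; _:^_; Polynomial)

  open FiniteSums commutativeSemiring public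
  open Monotone _≤_ ≤-refl +-mono-≤ public

  ιℕ : ℕ → Carrier
  ιℕ n = ι (+ n / 1)

  ιℕ-+ : ∀ m n → ιℕ (m ℕ.+ n) ≈ ιℕ m + ιℕ n
  ιℕ-+ m n = trans (reflexive (≡.cong ι (NaturalsInℚ./1-+ m n))) (ι-+ _ _)

  ιℕ-* : ∀ m n → ιℕ (m ℕ.* n) ≈ ιℕ m * ιℕ n
  ιℕ-* m n = trans (reflexive (≡.cong ι (NaturalsInℚ./1-* m n))) (ι-* _ _)

  ιℕ-mono : ∀ {m n} → m ℕ.≤ n → ιℕ m ≤ ιℕ n
  ιℕ-mono m≤n = ι-mono (NaturalsInℚ./1-mono m≤n)

  -- The implicit argument is filled by evaluating the comparison in ℚ; numerical inequalities
  -- between constants thus need no further proof.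
  ι-≤ : ∀ p q {_ : True (p ℚ.≤? q)} → ι p ≤ ι q
  ι-≤ p q {p≤q} = ι-mono (toWitness p≤q)

  ι-0≤ : ∀ p {_ : True (0ℚ ℚ.≤? p)} → 0# ≤ ι p
  ι-0≤ p {0≤p} = ≤-trans (≤-reflexive (sym ι-0)) (ι-mono (toWitness 0≤p))

  ι-≰ : ∀ p q {_ : False (p ℚ.≤? q)} → ¬ (ι p ≤ ι q)
  ι-≰ p q {p≰q} ιp≤ιq = toWitnessFalse p≰q (ι-reflects ιp≤ιq)

  0≤ιℕ : ∀ n → 0# ≤ ιℕ n
  0≤ιℕ n = ≤-trans (≤-reflexive (sym ι-0)) (ιℕ-mono {0} {n} ℕ.z≤n)

  x≤x+d : ∀ {x d} → 0# ≤ d → x ≤ x + d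
  x≤x+d 0≤d = ≤-trans (≤-reflexive (sym (+-identityʳ _))) (+-mono-≤ ≤-refl 0≤d)

  ≤-by : ∀ {x y} d → 0# ≤ d → x + d ≈ y → x ≤ y
  ≤-by d 0≤d x+d≈y = ≤-trans (x≤x+d 0≤d) (≤-reflexive x+d≈y)

  x≤y⇒0≤y-x : ∀ {x y} → x ≤ y → 0# ≤ y - x
  x≤y⇒0≤y-x {x} x≤y = ≤-trans (≤-reflexive (sym (-‿inverseʳ x))) (+-mono-≤ x≤y ≤-refl)

  0≤y-x⇒x≤y : ∀ {x y} → 0# ≤ y - x → x ≤ y
  0≤y-x⇒x≤y {x} {y} 0≤ = ≤-by (y - x) 0≤ (solve 2 (λ x y → x :+ (y :- x) := y) refl x y)

  +-cancelʳ-≤ : ∀ {x y} z → x + z ≤ y + z → x ≤ y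
  +-cancelʳ-≤ {x} {y} z le = 0≤y-x⇒x≤y (≤-trans (x≤y⇒0≤y-x le)
    (≤-reflexive (solve 3 (λ x y z → (y :+ z) :- (x :+ z) := y :- x) refl x y z)))

  neg-≤ : ∀ {x y} → x ≤ y → - y ≤ - x
  neg-≤ {x} {y} x≤y = ≤-by (y - x) (x≤y⇒0≤y-x x≤y)
    (solve 2 (λ x y → :- y :+ (y :- x) := :- x) refl x y)

  *-monoʳ-≤ : ∀ {x y} z → 0# ≤ z → x ≤ y → z * x ≤ z * y
  *-monoʳ-≤ {x} {y} z 0≤z x≤y = ≤-by (z * (y - x)) (*-nonNegative 0≤z (x≤y⇒0≤y-x x≤y))
    (solve 3 (λ x y z → z :* x :+ z :* (y :- x) := z :* y) refl x y z)

  *-monoˡ-≤ : ∀ {x y} z → 0# ≤ z → x ≤ y → x * z ≤ y * z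
  *-monoˡ-≤ z 0≤z x≤y =
    ≤-trans (≤-reflexive (*-comm _ z)) (≤-trans (*-monoʳ-≤ z 0≤z x≤y) (≤-reflexive (*-comm z _)))

  *-mono-≤ : ∀ {x y u v} → 0# ≤ y → 0# ≤ u → x ≤ y → u ≤ v → x * u ≤ y * v
  *-mono-≤ {y = y} {u} 0≤y 0≤u x≤y u≤v = ≤-trans (*-monoˡ-≤ u 0≤u x≤y) (*-monoʳ-≤ y 0≤y u≤v)

  +-nonNegative : ∀ {x y} → 0# ≤ x → 0# ≤ y → 0# ≤ x + y
  +-nonNegative 0≤x 0≤y = ≤-trans (≤-reflexive (sym (+-identityʳ 0#))) (+-mono-≤ 0≤x 0≤y)

  -- Proof by contradiction for an order that is not decidable: `located` at ½ε < ε yields x - y ≥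
  -- ½ε, which is refuted, or x - y ≤ ε, and ε is arbitrary.
  ≤-stable : ∀ {x y} → (∀ ε → 0ℚ ℚ.< ε → ¬ (y + ι ε ≤ x)) → x ≤ y
  ≤-stable {x} {y} ¬> = ≤-approx λ ε 0<ε → case ε 0<ε (located (x - y) (half< ε 0<ε))
    where
    half> : ∀ ε → 0ℚ ℚ.< ε → 0ℚ ℚ.< ½ ℚ.* ε
    half> ε 0<ε = ≡.subst (ℚ._< ½ ℚ.* ε) (ℚ.*-zeroʳ ½) (ℚ.*-monoʳ-<-pos ½ 0<ε)
    half< : ∀ ε → 0ℚ ℚ.< ε → ½ ℚ.* ε ℚ.< ε
    half< ε 0<ε = ≡.subst (½ ℚ.* ε ℚ.<_) (ℚ.*-identityˡ ε) (ℚ.*-monoˡ-<-pos ε {{ℚ.positive 0<ε}} (toWitness {a? = ½ ℚ.<? 1ℚ} _))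
    case : ∀ ε → 0ℚ ℚ.< ε → ι (½ ℚ.* ε) ≤ x - y ⊎ x - y ≤ ι ε → x ≤ y + ι ε
    case ε 0<ε (inj₁ ge) = contradiction
      (≤-trans (+-mono-≤ ≤-refl ge) (≤-reflexive (solve 2 (λ x y → y :+ (x :- y) := x) refl x y)))
      (¬> (½ ℚ.* ε) (half> ε 0<ε))
    case ε 0<ε (inj₂ le) =
      ≤-trans (≤-reflexive (solve 2 (λ x y → x := y :+ (x :- y)) refl x y)) (+-mono-≤ ≤-refl le)

  ι-pos : ∀ {ε} → 0ℚ ℚ.< ε → ¬ (ι ε ≤ 0#)
  ι-pos 0<ε ιε≤0 = ℚ.<-irrefl ≡.refl (ℚ.<-≤-trans 0<ε (ι-reflects (≤-trans ιε≤0 (≤-reflexive (sym ι-0)))))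

  0≤ι : ∀ {ε} → 0ℚ ℚ.< ε → 0# ≤ ι ε
  0≤ι 0<ε = ≤-trans (≤-reflexive (sym ι-0)) (ι-mono (ℚ.<⇒≤ 0<ε))

  ≤-stable′ : ∀ {x y} → (y ≤ x → ⊥) → x ≤ y
  ≤-stable′ ¬> = ≤-stable λ ε 0<ε y+ε≤x → ¬> (≤-trans (x≤x+d (0≤ι 0<ε)) y+ε≤x)

  infixr 8 _^_
  -- The empty product is written `ιℕ 1` rather than `1#`, so that it is what the solver's `con 1ℚ`
  -- denotes.
  _^_ : Carrier → ℕ → Carrier
  x ^ zero  = ιℕ 1
  x ^ suc n = x * x ^ n

  ^-nonNegative : ∀ {x} n → 0# ≤ x → 0# ≤ x ^ n
  ^-nonNegative zero    0≤x = 0≤ιℕ 1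
  ^-nonNegative (suc n) 0≤x = *-nonNegative 0≤x (^-nonNegative n 0≤x)

  ^-+ : ∀ x m n → x ^ (m ℕ.+ n) ≈ x ^ m * x ^ n
  ^-+ x zero    n = solve 1 (λ y → y := con 1ℚ :* y) refl (x ^ n)
  ^-+ x (suc m) n = trans (*-congˡ (^-+ x m n)) (sym (*-assoc x _ _))

  *-^ : ∀ x y n → (x * y) ^ n ≈ x ^ n * y ^ n
  *-^ x y zero    = solve 0 (con 1ℚ := con 1ℚ :* con 1ℚ) refl
  *-^ x y (suc n) = trans (*-congˡ (*-^ x y n))
    (solve 4 (λ x y a b → x :* y :* (a :* b) := x :* a :* (y :* b)) refl x y (x ^ n) (y ^ n))

  ^-cong : ∀ {x y} n → x ≈ y → x ^ n ≈ y ^ n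
  ^-cong zero    x≈y = refl
  ^-cong (suc n) x≈y = *-cong x≈y (^-cong n x≈y)

  1^n≈1 : ∀ n → 1# ^ n ≈ 1#
  1^n≈1 zero    = ι-1
  1^n≈1 (suc n) = trans (*-identityˡ _) (1^n≈1 n)

  ^-mono-≤ : ∀ {x y} n → 0# ≤ x → x ≤ y → x ^ n ≤ y ^ n
  ^-mono-≤ zero    0≤x x≤y = ≤-refl
  ^-mono-≤ (suc n) 0≤x x≤y =
    *-mono-≤ (≤-trans 0≤x x≤y) (^-nonNegative n 0≤x) x≤y (^-mono-≤ n 0≤x x≤y)

-- √ζ as the root of x³ + x² + x = 1, the reciprocal of the tribonacci constant

module TribonacciConstant (F : ArchimedeanRing) where
  open Toolkit F
  open import Relation.Nullary.Decidable using (False; toWitnessFalse)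
  open import Relation.Binary.Reasoning.PartialOrder poset

  -- If p ≥ ε > 0, then ε ≤ p ≤ p q = 0. The lower bound on `q` takes the place of the absence of
  -- zero divisors.
  product-zero-≤ : ∀ {p q} → ιℕ 1 ≤ q → p * q ≈ 0# → p ≤ 0#
  product-zero-≤ {p} {q} 1≤q pq≈0 = ≤-stable λ ε 0<ε 0+ε≤p →
    let ε≤p = ≤-trans (≤-reflexive (sym (+-identityˡ _))) 0+ε≤p
        0≤p = ≤-trans (0≤ι 0<ε) ε≤p
    in ι-pos 0<ε (begin
      ι ε        ≤⟨ ε≤p ⟩
      p          ≈⟨ solve 1 (λ p → p := p :* con 1ℚ) refl p ⟩
      p * ιℕ 1   ≤⟨ *-monoʳ-≤ p 0≤p 1≤q ⟩
      p * q      ≈⟨ pq≈0 ⟩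
      0#         ∎)

  product-zero : ∀ {p q} → ιℕ 1 ≤ q → p * q ≈ 0# → p ≈ 0#
  product-zero {p} {q} 1≤q pq≈0 = ≤-antisym (product-zero-≤ 1≤q pq≈0) (begin
    0#         ≈⟨ -0≈0 ⟨
    - 0#       ≤⟨ neg-≤ (product-zero-≤ 1≤q (trans (solve 2 (λ p q → :- p :* q := :- (p :* q)) refl p q)
                    (trans (-‿cong pq≈0) -0≈0))) ⟩
    - - p      ≈⟨ solve 1 (λ p → :- :- p := p) refl p ⟩
    p          ∎)
    where
    -0≈0 : - 0# ≈ 0#
    -0≈0 = trans (sym (+-identityˡ _)) (-‿inverseʳ 0#)

  cubic : Carrier → Carrier
  cubic x = x * x * x + x * x + x

  cubicℚ : ℚ → ℚ
  cubicℚ x = x ℚ.* x ℚ.* x ℚ.+ x ℚ.* x ℚ.+ x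

  ι-cubic : ∀ q → ι (cubicℚ q) ≈ cubic (ι q)
  ι-cubic q = trans (ι-+ _ _) (+-congʳ (trans (ι-+ _ _)
    (+-cong (trans (ι-* _ _) (*-congʳ (ι-* q q))) (ι-* q q))))

  cubic-mono : ∀ {x y} → 0# ≤ x → x ≤ y → cubic x ≤ cubic y
  cubic-mono {x} {y} 0≤x x≤y = +-mono-≤ (+-mono-≤ (*-mono-≤ (*-nonNegative 0≤y 0≤y) 0≤x x²≤y² x≤y) x²≤y²) x≤y
    where
    0≤y = ≤-trans 0≤x x≤y
    x²≤y² = *-mono-≤ 0≤y 0≤x x≤y x≤y

  -- With y = x²: y³ + y² + 3y - 1 = (x³ + x² + x - 1)(x³ - x² + x + 1).
  tribonacci-root : ∀ {x y} → 0# ≤ x → x * x ≈ y →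
    y * y * y + y * y + ιℕ 3 * y - ιℕ 1 ≈ 0# → cubic x ≈ ιℕ 1
  tribonacci-root {x} {y} 0≤x x²≈y root = begin-equality
    cubic x                        ≈⟨ solve 2 (λ c o → c := c :- o :+ o) refl (cubic x) (ιℕ 1) ⟩
    cubic x - ιℕ 1 + ιℕ 1          ≈⟨ +-congʳ (product-zero 1≤q pq≈0) ⟩
    0# + ιℕ 1                      ≈⟨ +-identityˡ _ ⟩
    ιℕ 1                           ∎
    where
    q = x * x * x - x * x + x + ιℕ 1
    1≤q : ιℕ 1 ≤ q
    -- The factor `q` equals 1 + x (x - ½)² + ¾ x, so it can be cancelled.
    1≤q = ≤-by (x * ((x - ι ½) * (x - ι ½)) + ι (+ 3 / 4) * x)
      (+-nonNegative (*-nonNegative 0≤x (0≤x² _)) (*-nonNegative (ι-0≤ (+ 3 / 4)) 0≤x))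
      (solve 1 (λ x → con 1ℚ :+ (x :* ((x :- con ½) :* (x :- con ½)) :+ con (+ 3 / 4) :* x)
        := x :* x :* x :- x :* x :+ x :+ con 1ℚ) refl x)
    pq≈0 : (cubic x - ιℕ 1) * q ≈ 0#
    pq≈0 = trans
      (solve 1 (λ x → (x :* x :* x :+ x :* x :+ x :- con 1ℚ) :* (x :* x :* x :- x :* x :+ x :+ con 1ℚ) :=
        (x :* x) :* (x :* x) :* (x :* x) :+ (x :* x) :* (x :* x) :+ con (+ 3 / 1) :* (x :* x) :- con 1ℚ) refl x)
      (trans (+-congʳ (+-cong (+-cong (*-cong (*-cong x²≈y x²≈y) x²≈y) (*-cong x²≈y x²≈y)) (*-congˡ x²≈y))) root)

  -- If x ≤ a, monotonicity gives 1 = cubic x ≤ cubic a, which an evaluation in ℚ refutes.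
  ≤cubic-root : ∀ {x} a → 0# ≤ x → cubic x ≈ ιℕ 1 → {_ : False (1ℚ ℚ.≤? cubicℚ a)} → ι a ≤ x
  ≤cubic-root {x} a 0≤x root {a<} = ≤-stable′ λ x≤a → toWitnessFalse a< (ι-reflects (begin
    ι 1ℚ           ≈⟨ root ⟨
    cubic x        ≤⟨ cubic-mono 0≤x x≤a ⟩
    cubic (ι a)    ≈⟨ ι-cubic a ⟨
    ι (cubicℚ a)   ∎))

  cubic-root≤ : ∀ {x} b → 0# ≤ ι b → cubic x ≈ ιℕ 1 → {_ : False (cubicℚ b ℚ.≤? 1ℚ)} → x ≤ ι b
  cubic-root≤ {x} b 0≤b root {>b} = ≤-stable′ λ b≤x → toWitnessFalse >b (ι-reflects (begin
    ι (cubicℚ b)   ≈⟨ ι-cubic b ⟩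
    cubic (ι b)    ≤⟨ cubic-mono 0≤b b≤x ⟩
    cubic x        ≈⟨ root ⟩
    ι 1ℚ           ∎))

-- The exponential series: sign and rational bounds of a logarithm

module ExponentialSeries (F : ArchimedeanRing) where
  open Toolkit F
  open import Relation.Binary.Reasoning.PartialOrder poset
  open import Relation.Nullary using (¬_)
  open import Relation.Nullary.Decidable using (False; toWitnessFalse)
  open import Defs using (scaled; half>0; half+half)

  1/_!ℚ : ℕ → ℚ
  1/ k !ℚ = (+ 1 / (k !)) {{k ℕ.!≢0}}

  e : ℕ → Carrier
  e k = ι 1/ k !ℚ

  term : Carrier → ℕ → Carrier
  term x k = e k * x ^ k

  exp≤ : ℕ → Carrier → Carrier
  exp≤ n x = sum n (term x)

  e-inverse : ∀ n → ιℕ (n !) * e n ≈ ιℕ 1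
  e-inverse n = trans (sym (ι-* _ _)) (reflexive (≡.cong ι (NaturalsInℚ./1-inverse (n !) {{n ℕ.!≢0}})))

  0≤e : ∀ n → 0# ≤ e n
  0≤e n = ≤-trans (≤-reflexive (sym ι-0)) (ι-mono (ℚ.<⇒≤ (ℚ.positive⁻¹ _ {{ℚ.normalize-pos 1 (n !) {{n ℕ.!≢0}}}})))

  ιℕ-!-suc : ∀ n → ιℕ (suc n !) ≈ ιℕ (suc n) * ιℕ (n !)
  ιℕ-!-suc n = ιℕ-* (suc n) (n !)

  e-suc : ∀ n → ιℕ (suc n) * e (suc n) ≈ e n
  e-suc n = begin-equality
    ιℕ (suc n) * e (suc n)
      ≈⟨ solve 1 (λ x → x := con 1ℚ :* x) refl _ ⟩
    ιℕ 1 * (ιℕ (suc n) * e (suc n))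
      ≈⟨ *-congʳ (e-inverse n) ⟨
    ιℕ (n !) * e n * (ιℕ (suc n) * e (suc n))
      ≈⟨ solve 4 (λ f e s e′ → f :* e :* (s :* e′) := e :* (s :* f :* e′)) refl _ _ _ _ ⟩
    e n * (ιℕ (suc n) * ιℕ (n !) * e (suc n))
      ≈⟨ *-congˡ (trans (*-congʳ (sym (ιℕ-!-suc n))) (e-inverse (suc n))) ⟩
    e n * ιℕ 1
      ≈⟨ solve 1 (λ x → x :* con 1ℚ := x) refl _ ⟩
    e n ∎

  term-suc : ∀ x n → ιℕ (suc n) * term x (suc n) ≈ x * term x n
  term-suc x n = trans (solve 4 (λ s e x y → s :* (e :* (x :* y)) := x :* (s :* e :* y)) refl _ _ x _)
    (*-congˡ (*-congʳ (e-suc n)))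

  term-0 : ∀ x → term x 0 ≈ ιℕ 1
  term-0 x = solve 0 (con 1ℚ :* con 1ℚ := con 1ℚ) refl

  0≤term : ∀ {x} → 0# ≤ x → ∀ n → 0# ≤ term x n
  0≤term 0≤x n = *-nonNegative (0≤e n) (^-nonNegative n 0≤x)

  -- The product rule for coefficients of power series: the factor n + 1 is shared out as a + b, and
  -- each part lowers the degree by one.
  suc*antidiagonal-suc : ∀ n ψ →
    ιℕ (suc n) * antidiagonal (suc n) ψ ≈
    antidiagonal n (λ a b → ιℕ (suc a) * ψ (suc a) b) + antidiagonal n (λ a b → ιℕ (suc b) * ψ a (suc b))
  suc*antidiagonal-suc n ψ = begin-equality
    ιℕ (suc n) * antidiagonal (suc n) ψ
      ≈⟨ antidiagonal-*ˡ (suc n) (ιℕ (suc n)) {ψ} ⟨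
    antidiagonal (suc n) (λ a b → ιℕ (suc n) * ψ a b)
      ≈⟨ antidiagonal-cong (suc n) (λ a b a+b≡ → trans
           (*-congʳ (trans (reflexive (≡.cong ιℕ (≡.sym a+b≡))) (ιℕ-+ a b))) (distribʳ (ψ a b) (ιℕ a) (ιℕ b))) ⟩
    antidiagonal (suc n) (λ a b → ιℕ a * ψ a b + ιℕ b * ψ a b)
      ≈⟨ antidiagonal-+ (suc n) {λ a b → ιℕ a * ψ a b} {λ a b → ιℕ b * ψ a b} ⟩
    antidiagonal (suc n) (λ a b → ιℕ a * ψ a b) + antidiagonal (suc n) (λ a b → ιℕ b * ψ a b)
      ≈⟨ +-cong (trans (+-congʳ (0*≈0 _)) (+-identityˡ _))
           (trans (antidiagonal-last n {λ a b → ιℕ b * ψ a b}) (trans (+-congˡ (0*≈0 _)) (+-identityʳ _))) ⟩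
    antidiagonal n (λ a b → ιℕ (suc a) * ψ (suc a) b) + antidiagonal n (λ a b → ιℕ (suc b) * ψ a (suc b)) ∎
    where
    0*≈0 : ∀ x → ιℕ 0 * x ≈ 0#
    0*≈0 x = trans (*-congʳ ι-0) (zeroˡ x)

  -- binomial n weighs (a , b) with n ! / (a ! * b !).
  binomial≈antidiagonal : ∀ n ψ →
    binomial n (λ a b → ιℕ (a !) * (ιℕ (b !) * ψ a b)) ≈ ιℕ (n !) * antidiagonal n ψ
  binomial≈antidiagonal zero    ψ = solve 1 (λ x → con 1ℚ :* (con 1ℚ :* x) := con 1ℚ :* x) refl (ψ 0 0)
  binomial≈antidiagonal (suc n) ψ = begin-equality
    binomial n (λ a b → ιℕ (suc a !) * (ιℕ (b !) * ψ (suc a) b)) +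
    binomial n (λ a b → ιℕ (a !) * (ιℕ (suc b !) * ψ a (suc b)))
      ≈⟨ +-cong
           (trans (binomial-cong n λ a b _ → trans (*-congʳ (ιℕ-!-suc a))
             (solve 4 (λ s f g x → s :* f :* (g :* x) := f :* (g :* (s :* x))) refl _ _ _ _))
             (binomial≈antidiagonal n λ a b → ιℕ (suc a) * ψ (suc a) b))
           (trans (binomial-cong n λ a b _ → *-congˡ (trans (*-congʳ (ιℕ-!-suc b))
             (solve 3 (λ s g x → s :* g :* x := g :* (s :* x)) refl _ _ _)))
             (binomial≈antidiagonal n λ a b → ιℕ (suc b) * ψ a (suc b))) ⟩
    ιℕ (n !) * antidiagonal n (λ a b → ιℕ (suc a) * ψ (suc a) b) +
    ιℕ (n !) * antidiagonal n (λ a b → ιℕ (suc b) * ψ a (suc b))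
      ≈⟨ distribˡ _ _ _ ⟨
    ιℕ (n !) * (antidiagonal n (λ a b → ιℕ (suc a) * ψ (suc a) b) +
                antidiagonal n (λ a b → ιℕ (suc b) * ψ a (suc b)))
      ≈⟨ *-congˡ (suc*antidiagonal-suc n ψ) ⟨
    ιℕ (n !) * (ιℕ (suc n) * antidiagonal (suc n) ψ)
      ≈⟨ trans (solve 3 (λ f s x → f :* (s :* x) := s :* f :* x) refl _ _ _) (*-congʳ (sym (ιℕ-!-suc n))) ⟩
    ιℕ (suc n !) * antidiagonal (suc n) ψ ∎

  term-neg-antidiagonal : ∀ y n → antidiagonal (suc n) (λ l k → term (- y) l * term y k) ≈ 0#
  term-neg-antidiagonal y n = begin-equality
    P
      ≈⟨ solve 1 (λ p → p := con 1ℚ :* p) refl P ⟩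
    ιℕ 1 * P
      ≈⟨ *-congʳ (trans (*-congʳ (ιℕ-!-suc n)) (e-inverse′ n)) ⟨
    ιℕ (suc n !) * e (suc n) * P
      ≈⟨ *-congʳ (*-congʳ (ιℕ-!-suc n)) ⟩
    ιℕ (suc n) * ιℕ (n !) * e (suc n) * P
      ≈⟨ solve 4 (λ s f e p → s :* f :* e :* p := f :* e :* (s :* p)) refl _ _ _ _ ⟩
    ιℕ (n !) * e (suc n) * (ιℕ (suc n) * P)
      ≈⟨ *-congˡ (trans (suc*antidiagonal-suc n λ l k → term (- y) l * term y k) (trans (+-cong
           (trans (antidiagonal-cong n λ a b _ → trans (sym (*-assoc _ _ _))
             (trans (*-congʳ (term-suc (- y) a)) (*-assoc _ _ _))) (antidiagonal-*ˡ n (- y)))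
           (trans (antidiagonal-cong n λ a b _ → trans
             (solve 3 (λ s x z → s :* (x :* z) := x :* (s :* z)) refl _ _ _)
             (trans (*-congˡ (term-suc y b)) (solve 3 (λ x y z → x :* (y :* z) := y :* (x :* z)) refl _ _ _)))
             (antidiagonal-*ˡ n y)))
           (trans (sym (distribʳ _ (- y) y)) (trans (*-congʳ (-‿inverseˡ y)) (zeroˡ _))))) ⟩
    ιℕ (n !) * e (suc n) * 0#
      ≈⟨ zeroʳ _ ⟩
    0# ∎
    where
    P = antidiagonal (suc n) (λ l k → term (- y) l * term y k)
    e-inverse′ : ∀ n → ιℕ (suc n) * ιℕ (n !) * e (suc n) ≈ ιℕ 1
    e-inverse′ n = trans (*-congʳ (sym (ιℕ-!-suc n))) (e-inverse (suc n))

  -- e^{-y} e^y = 1, with partial sums of e^{-y} only.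
  exp-neg-antidiagonal : ∀ y n → antidiagonal n (λ l k → exp≤ l (- y) * term y k) ≈ ιℕ 1
  exp-neg-antidiagonal y zero    =
    trans (*-cong (term-0 (- y)) (term-0 y)) (solve 0 (con 1ℚ :* con 1ℚ := con 1ℚ) refl)
  exp-neg-antidiagonal y (suc n) = begin-equality
    term (- y) 0 * term y (suc n) +
    antidiagonal n (λ l k → (exp≤ l (- y) + term (- y) (suc l)) * term y k)
      ≈⟨ +-congˡ (trans (antidiagonal-cong n λ l k _ → distribʳ _ _ _) (antidiagonal-+ n)) ⟩
    term (- y) 0 * term y (suc n) +
    (antidiagonal n (λ l k → exp≤ l (- y) * term y k) + antidiagonal n (λ l k → term (- y) (suc l) * term y k))
      ≈⟨ solve 3 (λ a b c → a :+ (b :+ c) := b :+ (a :+ c)) refl _ _ _ ⟩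
    antidiagonal n (λ l k → exp≤ l (- y) * term y k) + antidiagonal (suc n) (λ l k → term (- y) l * term y k)
      ≈⟨ +-cong (exp-neg-antidiagonal y n) (term-neg-antidiagonal y n) ⟩
    ιℕ 1 + 0#
      ≈⟨ +-identityʳ _ ⟩
    ιℕ 1 ∎

  powerℚ : ℚ → ℕ → ℚ
  powerℚ q zero    = 1ℚ
  powerℚ q (suc n) = q ℚ.* powerℚ q n

  ι-powerℚ : ∀ q n → ι (powerℚ q n) ≈ ι q ^ n
  ι-powerℚ q zero    = refl
  ι-powerℚ q (suc n) = trans (ι-* _ _) (*-congˡ (ι-powerℚ q n))

  -- A copy of `exp≤` in ℚ, on which the numerical comparisons are evaluated.
  expℚ : ℕ → ℚ → ℚ
  expℚ zero    q = 1ℚ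
  expℚ (suc n) q = expℚ n q ℚ.+ 1/ suc n !ℚ ℚ.* powerℚ q (suc n)

  ι-expℚ : ∀ n q → ι (expℚ n q) ≈ exp≤ n (ι q)
  ι-expℚ zero    q = sym (term-0 (ι q))
  ι-expℚ (suc n) q = trans (ι-+ _ _) (+-cong (ι-expℚ n q) (trans (ι-* _ _) (*-congˡ (ι-powerℚ q (suc n)))))

  term-mono : ∀ {x y} → 0# ≤ x → x ≤ y → ∀ n → term x n ≤ term y n
  term-mono 0≤x x≤y n = *-monoʳ-≤ (e n) (0≤e n) (^-mono-≤ n 0≤x x≤y)

  exp≤-mono : ∀ {x y} → 0# ≤ x → x ≤ y → ∀ n → exp≤ n x ≤ exp≤ n y
  exp≤-mono 0≤x x≤y n = sum-mono n λ i _ → term-mono 0≤x x≤y i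

  exp≤-cong : ∀ {x y} n → x ≈ y → exp≤ n x ≈ exp≤ n y
  exp≤-cong n x≈y = sum-cong n λ i _ → *-congˡ (^-cong i x≈y)

  exp≤-+ : ∀ {x} → 0# ≤ x → ∀ n d → exp≤ n x ≤ exp≤ (d ℕ.+ n) x
  exp≤-+ 0≤x n zero    = ≤-refl
  exp≤-+ 0≤x n (suc d) = ≤-trans (exp≤-+ 0≤x n d) (x≤x+d (0≤term 0≤x (suc (d ℕ.+ n))))

  IsExp : Carrier → Carrier → Set
  IsExp x t = ∀ ε → 0ℚ ℚ.< ε → ∃[ N ] ∀ n → N ℕ.≤ n → exp≤ n x ≤ t + ι ε × t ≤ exp≤ n x + ι ε

  IsExp-cong : ∀ {x y t} → x ≈ y → IsExp x t → IsExp y t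
  IsExp-cong x≈y conv ε 0<ε = let (N , close) = conv ε 0<ε in N , λ n n≥ →
    let (≤t , ≥t) = close n n≥
    in ≤-trans (≤-reflexive (exp≤-cong n (sym x≈y))) ≤t ,
       ≤-trans ≥t (+-mono-≤ (≤-reflexive (exp≤-cong n x≈y)) ≤-refl)

  ι-half+half : ∀ ε → ι (½ ℚ.* ε) + ι (½ ℚ.* ε) ≈ ι ε
  ι-half+half ε = trans (sym (ι-+ _ _)) (reflexive (≡.cong ι (half+half ε)))

  ^-neg : ∀ y n → y ^ n ≈ (- y) ^ n ⊎ y ^ n ≈ - ((- y) ^ n)
  ^-neg y zero    = inj₁ refl
  ^-neg y (suc n) with ^-neg y n
  ... | inj₁ eq = inj₂ (trans (*-congˡ eq) (solve 2 (λ y p → y :* p := :- (:- y :* p)) refl y _))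
  ... | inj₂ eq = inj₁ (trans (*-congˡ eq) (solve 2 (λ y p → y :* :- p := :- y :* p) refl y _))

  -- Consecutive partial sums at -y are both close to `t`, so their difference is small, and the
  -- term at y differs from it at most in sign. Convergence at -y is the only information assumed.
  term-vanishes : ∀ {y t} → IsExp (- y) t → ∀ ε → 0ℚ ℚ.< ε → ∃[ N ] ∀ n → N ℕ.≤ n → term y (suc n) ≤ ι ε
  term-vanishes {y} {t} conv ε 0<ε = let (N , close) = conv (½ ℚ.* ε) (half>0 0<ε) in
    N , λ n n≥ → bound n (close n n≥) (close (suc n) (ℕ.m≤n⇒m≤1+n n≥))
    where
    h = ι (½ ℚ.* ε)
    bound : ∀ n → exp≤ n (- y) ≤ t + h × t ≤ exp≤ n (- y) + h →
            exp≤ (suc n) (- y) ≤ t + h × t ≤ exp≤ (suc n) (- y) + h → term y (suc n) ≤ ι ε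
    bound n (≤t , ≥t) (≤t′ , ≥t′) with ^-neg y (suc n)
    ... | inj₁ eq = begin
      term y (suc n)          ≈⟨ *-congˡ eq ⟩
      term (- y) (suc n)      ≤⟨ +-cancelʳ-≤ (exp≤ n (- y)) (begin
        term (- y) (suc n) + exp≤ n (- y)   ≈⟨ +-comm _ _ ⟩
        exp≤ (suc n) (- y)                  ≤⟨ ≤-trans ≤t′ (+-mono-≤ ≥t ≤-refl) ⟩
        exp≤ n (- y) + h + h                ≈⟨ solve 2 (λ x h → x :+ h :+ h := h :+ h :+ x) refl _ _ ⟩
        h + h + exp≤ n (- y)                ∎) ⟩
      h + h                   ≈⟨ ι-half+half ε ⟩
      ι ε                     ∎
    ... | inj₂ eq = begin
      term y (suc n)          ≈⟨ trans (*-congˡ eq) (solve 2 (λ e p → e :* :- p := :- (e :* p)) refl _ _) ⟩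
      - term (- y) (suc n)    ≤⟨ +-cancelʳ-≤ (exp≤ (suc n) (- y)) (begin
        - term (- y) (suc n) + exp≤ (suc n) (- y)   ≈⟨ solve 2 (λ t x → :- t :+ (x :+ t) := x) refl _ _ ⟩
        exp≤ n (- y)                                ≤⟨ ≤-trans ≤t (+-mono-≤ ≥t′ ≤-refl) ⟩
        exp≤ (suc n) (- y) + h + h                  ≈⟨ solve 2 (λ x h → x :+ h :+ h := h :+ h :+ x) refl _ _ ⟩
        h + h + exp≤ (suc n) (- y)                  ∎) ⟩
      h + h                   ≈⟨ ι-half+half ε ⟩
      ι ε                     ∎

  -- Everything is dropped except the last entry, which has the weight y⁰/0! = 1.
  antidiagonal-bound : ∀ {y β} → 0# ≤ y → 0# ≤ β → ∀ n (x : ℕ → Carrier) → (∀ l → β ≤ x l) →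
                       β ≤ antidiagonal n (λ l k → x l * term y k)
  antidiagonal-bound {y} {β} 0≤y 0≤β zero    x β≤x = begin
    β                 ≤⟨ β≤x 0 ⟩
    x 0               ≈⟨ solve 1 (λ x → x := x :* con 1ℚ) refl (x 0) ⟩
    x 0 * ιℕ 1        ≈⟨ *-congˡ (term-0 y) ⟨
    x 0 * term y 0    ∎
  antidiagonal-bound {y} {β} 0≤y 0≤β (suc n) x β≤x = begin
    β         ≈⟨ +-identityˡ β ⟨
    0# + β    ≤⟨ +-mono-≤ (*-nonNegative (≤-trans 0≤β (β≤x 0)) (0≤term 0≤y (suc n)))
                   (antidiagonal-bound 0≤y 0≤β n (λ l → x (suc l)) (λ l → β≤x (suc l))) ⟩
    x 0 * term y (suc n) + antidiagonal n (λ l k → x (suc l) * term y k) ∎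

  -- Each of the `M` exceptional entries is paired with a term whose index grows with `n`. That term
  -- tends to 0, so the exception costs no more than half of the ε still available.
  antidiagonal-liminf : ∀ {y β t} → 0# ≤ y → 0# ≤ β → IsExp (- y) t → ∀ M (x : ℕ → Carrier) →
    (∀ l → M ℕ.≤ l → β ≤ x l) → ∀ ε → 0ℚ ℚ.< ε →
    ∃[ N ] ∀ n → N ℕ.≤ n → β ≤ antidiagonal n (λ l k → x l * term y k) + ι ε
  antidiagonal-liminf 0≤y 0≤β conv zero    x β≤x ε 0<ε =
    0 , λ n _ → ≤-trans (antidiagonal-bound 0≤y 0≤β n x λ l → β≤x l ℕ.z≤n) (x≤x+d (0≤ι 0<ε))
  antidiagonal-liminf {y} {β} 0≤y 0≤β conv (suc M) x β≤x ε 0<ε =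
    let (B , 0<B , -x₀≤B)    = bounded (- x 0)
        (δ , 0<δ , Bδ≡)      = scaled B (ℚ.positive 0<B) (½ ℚ.* ε) (half>0 0<ε)
        (N , small)          = term-vanishes conv δ 0<δ
        (N′ , large)         = antidiagonal-liminf 0≤y 0≤β conv M (λ l → x (suc l))
                                 (λ l M≤l → β≤x (suc l) (ℕ.s≤s M≤l)) (½ ℚ.* ε) (half>0 0<ε)
    in suc (N ℕ.⊔ N′) , λ { (suc n) (ℕ.s≤s n≥) → begin
      β
        ≤⟨ large n (ℕ.m⊔n≤o⇒n≤o N N′ n≥) ⟩
      A n + h
        ≤⟨ +-mono-≤ (≤-refl {A n}) (first B 0<B -x₀≤B δ Bδ≡ n (small n (ℕ.m⊔n≤o⇒m≤o N N′ n≥))) ⟩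
      A n + (x 0 * term y (suc n) + ι ε)
        ≈⟨ solve 3 (λ a b c → a :+ (b :+ c) := b :+ a :+ c) refl _ _ _ ⟩
      x 0 * term y (suc n) + A n + ι ε ∎ }
    where
    h = ι (½ ℚ.* ε)
    A : ℕ → Carrier
    A n = antidiagonal n (λ l k → x (suc l) * term y k)
    first : ∀ B → 0ℚ ℚ.< B → - x 0 ≤ ι B → ∀ δ → B ℚ.* δ ≡ ½ ℚ.* ε → ∀ n →
            term y (suc n) ≤ ι δ → h ≤ x 0 * term y (suc n) + ι ε
    first B 0<B -x₀≤B δ Bδ≡ n ≤δ = +-cancelʳ-≤ (- x 0 * term y (suc n)) (begin
      h + - x 0 * term y (suc n)
        ≤⟨ +-mono-≤ ≤-refl (≤-trans (*-monoˡ-≤ _ (0≤term 0≤y (suc n)) -x₀≤B) (*-monoʳ-≤ (ι B) (0≤ι 0<B) ≤δ)) ⟩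
      h + ι B * ι δ
        ≈⟨ +-congˡ (trans (sym (ι-* B δ)) (reflexive (≡.cong ι Bδ≡))) ⟩
      h + h
        ≈⟨ ι-half+half ε ⟩
      ι ε
        ≈⟨ solve 3 (λ x t e → e := x :* t :+ e :+ :- x :* t) refl _ _ _ ⟩
      x 0 * term y (suc n) + ι ε + - x 0 * term y (suc n) ∎)

  -- For y ≥ 0 the partial sums of e^{-y} cannot stay above 1, because they have
  -- average 1 for the weights yᵏ/k!.
  exp-nonPositive : ∀ {y t} → 0# ≤ y → ι (+ 3 / 2) ≤ t → ¬ IsExp (- y) t
  exp-nonPositive {y} {t} 0≤y t≥ conv =
    -- With tolerance 1/8 the partial sums eventually stay above 3/2 - 1/8 = 11/8. Their weighted
    -- average is 1, which would give 11/8 ≤ 1 + 1/8.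
    let (M , close) = conv (+ 1 / 8) 0<1/8
        (N , large) = antidiagonal-liminf {y} {β} 0≤y (ι-0≤ (+ 11 / 8)) conv M (λ l → exp≤ l (- y))
                        (λ l M≤l → +-cancelʳ-≤ (ι (+ 1 / 8)) (begin
                          β + ι (+ 1 / 8)              ≈⟨ ι-+ _ _ ⟨
                          ι (+ 3 / 2)                  ≤⟨ t≥ ⟩
                          t                            ≤⟨ proj₂ (close l M≤l) ⟩
                          exp≤ l (- y) + ι (+ 1 / 8)   ∎))
                        (+ 1 / 8) 0<1/8
    in ι-≰ (+ 11 / 8) (+ 9 / 8) (begin
      β                                                              ≤⟨ large N ℕ.≤-refl ⟩
      antidiagonal N (λ l k → exp≤ l (- y) * term y k) + ι (+ 1 / 8) ≈⟨ +-congʳ (exp-neg-antidiagonal y N) ⟩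
      ιℕ 1 + ι (+ 1 / 8)                                             ≈⟨ ι-+ _ _ ⟨
      ι (+ 9 / 8)                                                    ∎)
    where
    β = ι (+ 11 / 8)
    0<1/8 : 0ℚ ℚ.< + 1 / 8
    0<1/8 = ℚ.positive⁻¹ (+ 1 / 8)

  -- A logarithm is given only through its exponential series, so its sign has to be derived before
  -- the series can be estimated termwise.
  log-nonNegative : ∀ {x t} → ι (+ 3 / 2) ≤ t → IsExp x t → 0# ≤ x
  log-nonNegative {x} t≥ conv = ≤-stable′ λ x≤0 → exp-nonPositive {(- x)}
    (≤-trans (≤-reflexive (trans (sym (-‿inverseʳ 0#)) (+-identityˡ _))) (neg-≤ x≤0)) t≥
    (IsExp-cong (solve 1 (λ x → x := :- :- x) refl x) conv)

  exp≤≤exp : ∀ {x t} → 0# ≤ x → IsExp x t → ∀ n → exp≤ n x ≤ t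
  exp≤≤exp 0≤x conv n = ≤-approx λ ε 0<ε → let (N , close) = conv ε 0<ε in
    ≤-trans (exp≤-+ 0≤x n N) (proj₁ (close (N ℕ.+ n) (ℕ.m≤m+n N n)))

  -- If b ≤ x, the n-th partial sum at b would be at most t ≤ c, against an evaluation in ℚ. The
  -- bound from below, `≤log`, needs in addition an estimate of the tail.
  log≤ : ∀ {x t} n b c → 0# ≤ ι b → 0# ≤ x → IsExp x t → t ≤ ι c →
         {_ : False (expℚ n b ℚ.≤? c)} → x ≤ ι b
  log≤ {x} {t} n b c 0≤b 0≤x conv t≤c {b>} = ≤-stable′ λ b≤x → toWitnessFalse b> (ι-reflects (begin
    ι (expℚ n b)   ≈⟨ ι-expℚ n b ⟩
    exp≤ n (ι b)   ≤⟨ exp≤-mono 0≤b b≤x n ⟩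
    exp≤ n x       ≤⟨ exp≤≤exp 0≤x conv n ⟩
    t              ≤⟨ t≤c ⟩
    ι c            ∎))

  quarter : ℕ → Carrier
  quarter n = ι (+ 1 / 4) ^ n

  0≤quarter : ∀ n → 0# ≤ quarter n
  0≤quarter n = ^-nonNegative n (ι-0≤ (+ 1 / 4))

  -- The first term is at most ½ = 2 · ¼, and each later term arises from its predecessor by a
  -- factor x/k with k ≥ 2, that is, at most ¼.
  term≤quarter : ∀ {x} → 0# ≤ x → x ≤ ι ½ → ∀ n → term x (suc n) ≤ ιℕ 2 * quarter (suc n)
  term≤quarter {x} 0≤x x≤½ zero    = begin
    e 1 * (x * ιℕ 1)              ≈⟨ solve 1 (λ x → con 1ℚ :* (x :* con 1ℚ) := x) refl x ⟩
    x                             ≤⟨ x≤½ ⟩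
    ι ½                           ≈⟨ solve 0 (con ½ := con (+ 2 / 1) :* (con (+ 1 / 4) :* con 1ℚ)) refl ⟩
    ιℕ 2 * quarter 1              ∎
  term≤quarter {x} 0≤x x≤½ (suc n) = begin
    term x (2 ℕ.+ n)                        ≈⟨ solve 1 (λ t → t := con ½ :* (con (+ 2 / 1) :* t)) refl _ ⟩
    ι ½ * (ιℕ 2 * term x (2 ℕ.+ n))         ≤⟨ *-monoʳ-≤ (ι ½) (ι-0≤ ½) (*-monoˡ-≤ _ (0≤term 0≤x (2 ℕ.+ n))
                                                 (ιℕ-mono {2} {2 ℕ.+ n} (ℕ.s≤s (ℕ.s≤s ℕ.z≤n)))) ⟩
    ι ½ * (ιℕ (2 ℕ.+ n) * term x (2 ℕ.+ n)) ≈⟨ *-congˡ (term-suc x (suc n)) ⟩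
    ι ½ * (x * term x (suc n))              ≤⟨ *-monoʳ-≤ (ι ½) (ι-0≤ ½) (*-mono-≤ (ι-0≤ ½) (0≤term 0≤x (suc n))
                                                 x≤½ (term≤quarter 0≤x x≤½ n)) ⟩
    ι ½ * (ι ½ * (ιℕ 2 * quarter (suc n)))  ≈⟨ solve 1 (λ q → con ½ :* (con ½ :* (con (+ 2 / 1) :* q)) :=
                                                 con (+ 2 / 1) :* (con (+ 1 / 4) :* q)) refl _ ⟩
    ιℕ 2 * quarter (2 ℕ.+ n)                ∎

  -- 2/3 is the sum of 2 · 4⁻ᵏ over k ≥ 1. So a partial sum together with its tail bound (2/3) 4⁻ⁿ
  -- decreases as n grows.
  exp-tail : ∀ {x} → 0# ≤ x → x ≤ ι ½ → ∀ n d →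
    exp≤ (d ℕ.+ n) x + ι (+ 2 / 3) * quarter (d ℕ.+ n) ≤ exp≤ n x + ι (+ 2 / 3) * quarter n
  exp-tail 0≤x x≤½ n zero    = ≤-refl
  exp-tail {x} 0≤x x≤½ n (suc d) = ≤-trans (begin
    exp≤ m x + term x (suc m) + c * quarter (suc m)
      ≤⟨ +-mono-≤ (+-mono-≤ ≤-refl (term≤quarter 0≤x x≤½ m)) ≤-refl ⟩
    exp≤ m x + ιℕ 2 * quarter (suc m) + c * quarter (suc m)
      ≈⟨ solve 2 (λ x q → x :+ con (+ 2 / 1) :* (con (+ 1 / 4) :* q) :+ con (+ 2 / 3) :* (con (+ 1 / 4) :* q)
           := x :+ con (+ 2 / 3) :* q) refl _ _ ⟩
    exp≤ m x + c * quarter m ∎) (exp-tail 0≤x x≤½ n d)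
    where
    m = d ℕ.+ n
    c = ι (+ 2 / 3)

  exp≤exp≤+tail : ∀ {x t} → 0# ≤ x → x ≤ ι ½ → IsExp x t → ∀ n → t ≤ exp≤ n x + ι (+ 2 / 3) * quarter n
  exp≤exp≤+tail {x} {t} 0≤x x≤½ conv n = ≤-approx λ ε 0<ε → let (N , close) = conv ε 0<ε in begin
    t                                          ≤⟨ proj₂ (close (N ℕ.+ n) (ℕ.m≤m+n N n)) ⟩
    exp≤ (N ℕ.+ n) x + ι ε                     ≤⟨ +-mono-≤ (x≤x+d (*-nonNegative (ι-0≤ (+ 2 / 3)) (0≤quarter (N ℕ.+ n)))) ≤-refl ⟩
    exp≤ (N ℕ.+ n) x + ι (+ 2 / 3) * quarter (N ℕ.+ n) + ι ε
                                               ≤⟨ +-mono-≤ (exp-tail 0≤x x≤½ n N) ≤-refl ⟩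
    exp≤ n x + ι (+ 2 / 3) * quarter n + ι ε   ∎

  ≤log : ∀ {x t} n a c → 0# ≤ x → x ≤ ι ½ → IsExp x t → ι c ≤ t →
         {_ : False (c ℚ.≤? expℚ n a ℚ.+ + 2 / 3 ℚ.* powerℚ (+ 1 / 4) n)} → ι a ≤ x
  ≤log {x} {t} n a c 0≤x x≤½ conv c≤t {a<} = ≤-stable′ λ x≤a → toWitnessFalse a< (ι-reflects (begin
    ι c                                           ≤⟨ c≤t ⟩
    t                                             ≤⟨ exp≤exp≤+tail 0≤x x≤½ conv n ⟩
    exp≤ n x + ι (+ 2 / 3) * quarter n            ≤⟨ +-mono-≤ (exp≤-mono 0≤x x≤a n) ≤-refl ⟩
    exp≤ n (ι a) + ι (+ 2 / 3) * quarter n        ≈⟨ +-cong (sym (ι-expℚ n a)) (trans (*-congˡ (sym (ι-powerℚ (+ 1 / 4) n))) (sym (ι-* _ _))) ⟩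
    ι (expℚ n a) + ι (+ 2 / 3 ℚ.* powerℚ (+ 1 / 4) n)     ≈⟨ ι-+ _ _ ⟨
    ι (expℚ n a ℚ.+ + 2 / 3 ℚ.* powerℚ (+ 1 / 4) n)       ∎))

-- Growth of Θ and of the protocol counts

module Asymptotics (F : ArchimedeanRing) where
  open Toolkit F
  open ExponentialSeries F
  open import Relation.Binary.Reasoning.PartialOrder poset
  open import Relation.Nullary.Decidable using (True)
  module C = ProtocolCounts
  open C using ([A]; [B]; [AB]; Letter)

  ιℕ-sum : ∀ n f → ιℕ (C.sum n f) ≈ sum n (λ i → ιℕ (f i))
  ιℕ-sum zero    f = refl
  ιℕ-sum (suc n) f = trans (ιℕ-+ (C.sum n f) (f (suc n))) (+-congʳ (ιℕ-sum n f))

  ιℕ-binomial : ∀ n f → ιℕ (C.binomial n f) ≈ binomial n (λ a b → ιℕ (f a b))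
  ιℕ-binomial zero    f = refl
  ιℕ-binomial (suc n) f = trans (ιℕ-+ (C.binomial n λ a b → f (suc a) b) (C.binomial n λ a b → f a (suc b)))
    (+-cong (ιℕ-binomial n λ a b → f (suc a) b) (ιℕ-binomial n λ a b → f a (suc b)))

  ιℕ-ifPositive : ∀ f a b → ιℕ (C.ifPositive f a b) ≈ ifPositive (λ b → ιℕ (f b)) a b
  ιℕ-ifPositive f zero    b = ι-0
  ιℕ-ifPositive f (suc a) b = refl

  ιℕ-binomial-ifPositive : ∀ n f →
    ιℕ (C.binomial n (C.ifPositive f)) ≈ binomial n (ifPositive λ b → ιℕ (f b))
  ιℕ-binomial-ifPositive n f =
    trans (ιℕ-binomial n (C.ifPositive f)) (binomial-cong n λ a b _ → ιℕ-ifPositive f a b)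

  sum-nonNegative : ∀ n {f} → (∀ i → 0# ≤ f i) → 0# ≤ sum n f
  sum-nonNegative zero    0≤f = 0≤f 0
  sum-nonNegative (suc n) 0≤f = +-nonNegative (sum-nonNegative n 0≤f) (0≤f (suc n))

  antidiagonal-nonNegative : ∀ n {f} → (∀ i j → 0# ≤ f i j) → 0# ≤ antidiagonal n f
  antidiagonal-nonNegative zero    0≤f = 0≤f 0 0
  antidiagonal-nonNegative (suc n) 0≤f =
    +-nonNegative (0≤f 0 (suc n)) (antidiagonal-nonNegative n λ i j → 0≤f (suc i) j)

  -- Geometric (Fubini) polynomials and their renewal equation

  module GeometricPolynomials (r : Carrier) (0≤r : 0# ≤ r) where

    Ψ : ℕ → ℕ → Carrier
    Ψ m i = ιℕ (C.surjections m i) * r ^ i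

    Θ : ℕ → Carrier
    Θ m = sum m (Ψ m)

    0≤Ψ : ∀ m i → 0# ≤ Ψ m i
    0≤Ψ m i = *-nonNegative (0≤ιℕ (C.surjections m i)) (^-nonNegative i 0≤r)

    0≤Θ : ∀ m → 0# ≤ Θ m
    0≤Θ m = sum-nonNegative m (0≤Ψ m)

    Θ-0 : Θ 0 ≈ ιℕ 1
    Θ-0 = solve 0 (con 1ℚ :* con 1ℚ := con 1ℚ) refl

    Θ-extend : ∀ b d → sum (d ℕ.+ b) (Ψ b) ≈ Θ b
    Θ-extend b zero    = refl
    Θ-extend b (suc d) = begin-equality
      sum (d ℕ.+ b) (Ψ b) + Ψ b (suc (d ℕ.+ b))
        ≈⟨ +-cong (Θ-extend b d) (*-congʳ (reflexive (≡.cong ιℕ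
             (C.surjections-> {b} {suc (d ℕ.+ b)} (ℕ.s≤s (ℕ.m≤n+m b d)))))) ⟩
      Θ b + ιℕ 0 * r ^ suc (d ℕ.+ b)
        ≈⟨ +-congˡ (trans (*-congʳ ι-0) (zeroˡ _)) ⟩
      Θ b + 0#
        ≈⟨ +-identityʳ _ ⟩
      Θ b ∎

    Θ-suc : ∀ n → Θ (suc n) ≈ r * binomial (suc n) (ifPositive Θ)
    Θ-suc n = begin-equality
      Θ (suc n)
        ≈⟨ sum-head n ⟩
      Ψ (suc n) 0 + sum n (λ i → Ψ (suc n) (suc i))
        ≈⟨ trans (+-congʳ (trans (*-congʳ ι-0) (zeroˡ _))) (+-identityˡ _) ⟩
      sum n (λ i → Ψ (suc n) (suc i))
        ≈⟨ sum-cong n (λ i _ → trans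
             (*-congʳ (trans (reflexive (≡.cong ιℕ (C.surjections-fibre (suc n) i)))
               (ιℕ-binomial-ifPositive (suc n) λ b → C.surjections b i)))
             (trans (solve 3 (λ b r p → b :* (r :* p) := r :* (p :* b)) refl _ r (r ^ i))
             (*-congˡ (trans (sym (binomial-ifPositive-*ˡ (suc n) (r ^ i)))
               (binomial-cong (suc n) (ifPositive-cong λ b _ → *-comm (r ^ i) _)))))) ⟩
      sum n (λ i → r * binomial (suc n) (ifPositive λ b → Ψ b i))
        ≈⟨ sum-*ˡ n r ⟩
      r * sum n (λ i → binomial (suc n) (ifPositive λ b → Ψ b i))
        ≈⟨ *-congˡ (sum-binomial-ifPositive n (suc n) {λ i b → Ψ b i}) ⟩
      r * binomial (suc n) (ifPositive λ b → sum n (Ψ b))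
        -- A nonempty fibre leaves b ≤ n points, and the terms of index above b vanish; hence the
        -- sum up to `n` is already Θ at b.
        ≈⟨ *-congˡ (binomial-cong (suc n) (ifPositive-cong λ { b (ℕ.s≤s b≤n) → trans
             (reflexive (≡.cong (λ m → sum m (Ψ b)) (≡.sym (ℕ.m∸n+n≡m b≤n)))) (Θ-extend b (n ℕ.∸ b)) })) ⟩
      r * binomial (suc n) (ifPositive Θ) ∎

    module Renewal (L : Carrier) (0≤L : 0# ≤ L) where

      -- The numerators of the numbers Θₙ Lⁿ/n!; the factorial is kept on the other side of each
      -- estimate.
      θ : ℕ → Carrier
      θ n = Θ n * L ^ n

      θ-suc : ∀ n → θ (suc n) ≈ r * binomial (suc n) (λ a b → L ^ a * ifPositive θ a b)
      θ-suc n = begin-equality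
        Θ (suc n) * L ^ suc n
          ≈⟨ *-congʳ (Θ-suc n) ⟩
        r * binomial (suc n) (ifPositive Θ) * L ^ suc n
          ≈⟨ solve 3 (λ r b l → r :* b :* l := r :* (l :* b)) refl _ _ _ ⟩
        r * (L ^ suc n * binomial (suc n) (ifPositive Θ))
          ≈⟨ *-congˡ (binomial-*ˡ (suc n) (L ^ suc n) {ifPositive Θ}) ⟨
        r * binomial (suc n) (λ a b → L ^ suc n * ifPositive Θ a b)
          ≈⟨ *-congˡ (binomial-cong (suc n) λ a b a+b≡ → trans
               (*-congʳ (trans (reflexive (≡.cong (L ^_) (≡.sym a+b≡))) (^-+ L a b)))
               (split a b)) ⟩
        r * binomial (suc n) (λ a b → L ^ a * ifPositive θ a b) ∎
        where
        split : ∀ a b → L ^ a * L ^ b * ifPositive Θ a b ≈ L ^ a * ifPositive θ a b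
        split zero    b = trans (zeroʳ _) (sym (zeroʳ _))
        split (suc a) b = solve 3 (λ x y z → x :* y :* z := x :* (z :* y)) refl _ _ _

      -- Putting b! g(b) for θ(b) turns the right side of `θ-suc` into n! times the convolution of g
      -- with the probabilities r Lᵃ/a!, at index n + 1.
      factorial-renewal : ∀ n g →
        r * binomial (suc n) (λ a b → L ^ a * ifPositive (λ b → ιℕ (b !) * g b) a b) ≈
        ιℕ (suc n !) * (r * antidiagonal n (λ a b → term L (suc a) * g b))
      factorial-renewal n g = begin-equality
        r * binomial (suc n) (λ a b → L ^ a * ifPositive (λ b → ιℕ (b !) * g b) a b)
          ≈⟨ *-congˡ (binomial-cong (suc n) λ a b _ → weights a b) ⟩
        r * binomial (suc n) (λ a b → ιℕ (a !) * (ιℕ (b !) * (term L a * ifPositive g a b)))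
          ≈⟨ *-congˡ (binomial≈antidiagonal (suc n) λ a b → term L a * ifPositive g a b) ⟩
        r * (ιℕ (suc n !) * (term L 0 * 0# + antidiagonal n (λ a b → term L (suc a) * g b)))
          ≈⟨ *-congˡ (*-congˡ (trans (+-congʳ (zeroʳ _)) (+-identityˡ _))) ⟩
        r * (ιℕ (suc n !) * antidiagonal n (λ a b → term L (suc a) * g b))
          ≈⟨ solve 3 (λ r f a → r :* (f :* a) := f :* (r :* a)) refl _ _ _ ⟩
        ιℕ (suc n !) * (r * antidiagonal n (λ a b → term L (suc a) * g b)) ∎
        where
        weights : ∀ a b → L ^ a * ifPositive (λ b → ιℕ (b !) * g b) a b ≈
                  ιℕ (a !) * (ιℕ (b !) * (term L a * ifPositive g a b))
        weights zero    b = trans (zeroʳ _) (sym (trans (*-congˡ (trans (*-congˡ (zeroʳ _)) (zeroʳ _))) (zeroʳ _)))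
        weights (suc a) b = begin-equality
          L ^ suc a * (ιℕ (b !) * g b)
            ≈⟨ solve 1 (λ x → x := con 1ℚ :* x) refl _ ⟩
          ιℕ 1 * (L ^ suc a * (ιℕ (b !) * g b))
            ≈⟨ *-congʳ (e-inverse (suc a)) ⟨
          ιℕ (suc a !) * e (suc a) * (L ^ suc a * (ιℕ (b !) * g b))
            ≈⟨ solve 5 (λ f e l h g → f :* e :* (l :* (h :* g)) := f :* (h :* (e :* l :* g))) refl _ _ _ _ _ ⟩
          ιℕ (suc a !) * (ιℕ (b !) * (term L (suc a) * g b)) ∎

      exp≤-head : ∀ n → exp≤ (suc n) L ≈ ιℕ 1 + sum n (λ i → term L (suc i))
      exp≤-head n = trans (sum-head n) (+-congʳ (term-0 L))

      binomial-L-mono : ∀ n {f g} → (∀ b → b ℕ.< n → f b ≤ g b) →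
        r * binomial n (λ a b → L ^ a * ifPositive f a b) ≤ r * binomial n (λ a b → L ^ a * ifPositive g a b)
      binomial-L-mono n f≤g = *-monoʳ-≤ r 0≤r (binomial-mono n λ a b a+b≡ →
        *-monoʳ-≤ (L ^ a) (^-nonNegative a 0≤L) (ifPositive-mono f≤g a b a+b≡))

      -- The constant 1 is a supersolution: the hypothesis says that partial sums of the
      -- probabilities r Lᵃ/a! for a ≥ 1 do not exceed 1. `N` serves as the bound of a strong
      -- induction.
      θ≤! : (∀ n → r * exp≤ n L ≤ ιℕ 1 + r) → ∀ N n → n ℕ.< N → θ n ≤ ιℕ (n !) * ιℕ 1
      θ≤! r*exp≤ (suc N) zero    _ = ≤-reflexive (*-congʳ Θ-0)
      θ≤! r*exp≤ (suc N) (suc n) (ℕ.s≤s n<N) = begin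
        θ (suc n)
          ≈⟨ θ-suc n ⟩
        r * binomial (suc n) (λ a b → L ^ a * ifPositive θ a b)
          ≤⟨ binomial-L-mono (suc n) (λ { b (ℕ.s≤s b≤n) → θ≤! r*exp≤ N b (ℕ.≤-<-trans b≤n n<N) }) ⟩
        r * binomial (suc n) (λ a b → L ^ a * ifPositive (λ b → ιℕ (b !) * ιℕ 1) a b)
          ≈⟨ factorial-renewal n (λ _ → ιℕ 1) ⟩
        ιℕ (suc n !) * (r * antidiagonal n (λ a b → term L (suc a) * ιℕ 1))
          -- Adding r supplies the term k = 0 and completes the sum to a partial sum of e^L.
          ≤⟨ *-monoʳ-≤ _ (0≤ιℕ (suc n !)) (+-cancelʳ-≤ r (begin
            r * antidiagonal n (λ a b → term L (suc a) * ιℕ 1) + r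
              ≈⟨ +-congʳ (*-congˡ (trans (antidiagonal-cong n λ a b _ → solve 1 (λ x → x :* con 1ℚ := x) refl _)
                   (antidiagonal-sum n λ a → term L (suc a)))) ⟩
            r * sum n (λ a → term L (suc a)) + r
              ≈⟨ solve 2 (λ r s → r :* s :+ r := r :* (con 1ℚ :+ s)) refl _ _ ⟩
            r * (ιℕ 1 + sum n (λ a → term L (suc a)))
              ≈⟨ *-congˡ (exp≤-head n) ⟨
            r * exp≤ (suc n) L
              ≤⟨ r*exp≤ (suc n) ⟩
            ιℕ 1 + r ∎)) ⟩
        ιℕ (suc n !) * ιℕ 1 ∎

      -- A subsolution of the renewal equation: the term ½ · 4⁻ⁿ pays for the
      -- part of the probability distribution beyond n.
      floor : ℕ → Carrier
      floor n = ι ½ + ι ½ * quarter n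

      !*floor≤θ : r ≤ ιℕ 2 → ι (+ 3 / 4) ≤ r * L →
        (∀ n → ιℕ 1 + r ≤ r * exp≤ n L + ι (+ 4 / 3) * quarter n) →
        ∀ N n → n ℕ.< N → ιℕ (n !) * floor n ≤ θ n
      !*floor≤θ r≤2 ¾≤rL tail (suc N) zero    _ = ≤-reflexive (trans
        (solve 0 (con 1ℚ :* (con ½ :+ con ½ :* con 1ℚ) := con 1ℚ :* con 1ℚ) refl) (*-congʳ (sym Θ-0)))
      !*floor≤θ r≤2 ¾≤rL tail (suc N) (suc n) (ℕ.s≤s n<N) = begin
        ιℕ (suc n !) * floor (suc n)
          ≤⟨ *-monoʳ-≤ _ (0≤ιℕ (suc n !)) subsolution ⟩
        ιℕ (suc n !) * (r * antidiagonal n (λ a b → term L (suc a) * floor b))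
          ≈⟨ factorial-renewal n floor ⟨
        r * binomial (suc n) (λ a b → L ^ a * ifPositive (λ b → ιℕ (b !) * floor b) a b)
          ≤⟨ binomial-L-mono (suc n) (λ { b (ℕ.s≤s b≤n) → !*floor≤θ r≤2 ¾≤rL tail N b (ℕ.≤-<-trans b≤n n<N) }) ⟩
        r * binomial (suc n) (λ a b → L ^ a * ifPositive θ a b)
          ≈⟨ θ-suc n ⟨
        θ (suc n) ∎
        where
        S = sum n (λ a → term L (suc a))
        q = quarter n
        first : L * q ≤ antidiagonal n (λ a b → term L (suc a) * quarter b)
        first = ≤-trans (≤-reflexive (*-congʳ (solve 1 (λ l → l := con 1ℚ :* (l :* con 1ℚ)) refl L))) (head≤ n)
          where
          head≤ : ∀ n → term L 1 * quarter n ≤ antidiagonal n (λ a b → term L (suc a) * quarter b)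
          head≤ zero    = ≤-refl
          head≤ (suc n) = x≤x+d (antidiagonal-nonNegative n
            λ a b → *-nonNegative (0≤term 0≤L (2 ℕ.+ a)) (0≤quarter b))
        subsolution : floor (suc n) ≤ r * antidiagonal n (λ a b → term L (suc a) * floor b)
        subsolution = begin
          ι ½ + ι ½ * (ι (+ 1 / 4) * q)
            -- In units of 4⁻ⁿ the entry a = 1 contributes ½ · ¾ = 3/8, the missing probability
            -- costs ½ · (4/3) · ¼ = 1/6, and ½ · ¼ = 1/8 is required; 1/12 is what remains.
            ≤⟨ ≤-by (ι (+ 1 / 12) * q) (*-nonNegative (ι-0≤ (+ 1 / 12)) (0≤quarter n)) refl ⟩
          ι ½ + ι ½ * (ι (+ 1 / 4) * q) + ι (+ 1 / 12) * q
            ≈⟨ solve 2 (λ q r → con ½ :+ con ½ :* (con (+ 1 / 4) :* q) :+ con (+ 1 / 12) :* q :=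
                 con ½ :* (con 1ℚ :+ r) :- con ½ :* (con (+ 4 / 3) :* (con (+ 1 / 4) :* q)) :- con ½ :* r :+ con ½ :* (con (+ 3 / 4) :* q)) refl q r ⟩
          ι ½ * (ιℕ 1 + r) - ι ½ * (ι (+ 4 / 3) * quarter (suc n)) - ι ½ * r + ι ½ * (ι (+ 3 / 4) * q)
            ≤⟨ +-mono-≤ (+-mono-≤ (+-mono-≤ (*-monoʳ-≤ (ι ½) (ι-0≤ ½) (tail (suc n))) ≤-refl) ≤-refl)
                 (*-monoʳ-≤ (ι ½) (ι-0≤ ½) (*-monoˡ-≤ q (0≤quarter n) ¾≤rL)) ⟩
          ι ½ * (r * exp≤ (suc n) L + ι (+ 4 / 3) * quarter (suc n)) - ι ½ * (ι (+ 4 / 3) * quarter (suc n)) - ι ½ * r + ι ½ * (r * L * q)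
            ≈⟨ +-congʳ (+-congʳ (+-congʳ (*-congˡ (+-congʳ (*-congˡ (exp≤-head n)))))) ⟩
          ι ½ * (r * (ιℕ 1 + S) + ι (+ 4 / 3) * quarter (suc n)) - ι ½ * (ι (+ 4 / 3) * quarter (suc n)) - ι ½ * r + ι ½ * (r * L * q)
            ≈⟨ solve 5 (λ r s t l q → con ½ :* (r :* (con 1ℚ :+ s) :+ t) :- con ½ :* t :- con ½ :* r :+ con ½ :* (r :* l :* q) :=
                 r :* (con ½ :* s :+ con ½ :* (l :* q))) refl r S (ι (+ 4 / 3) * quarter (suc n)) L q ⟩
          r * (ι ½ * S + ι ½ * (L * q))
            ≤⟨ *-monoʳ-≤ r 0≤r (+-mono-≤ ≤-refl (*-monoʳ-≤ (ι ½) (ι-0≤ ½) first)) ⟩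
          r * (ι ½ * S + ι ½ * antidiagonal n (λ a b → term L (suc a) * quarter b))
            ≈⟨ *-congˡ (+-cong (trans (*-congˡ (sym (antidiagonal-sum n λ a → term L (suc a)))) (sym (antidiagonal-*ˡ n (ι ½))))
                 (sym (antidiagonal-*ˡ n (ι ½)))) ⟩
          r * (antidiagonal n (λ a b → ι ½ * term L (suc a)) + antidiagonal n (λ a b → ι ½ * (term L (suc a) * quarter b)))
            ≈⟨ *-congˡ (trans (sym (antidiagonal-+ n)) (antidiagonal-cong n λ a b _ →
                 solve 2 (λ t q → con ½ :* t :+ con ½ :* (t :* q) := t :* (con ½ :+ con ½ :* q)) refl _ _)) ⟩
          r * antidiagonal n (λ a b → term L (suc a) * floor b) ∎

  2ab≤a²+b² : ∀ a b → ιℕ 2 * (a * b) ≤ a * a + b * b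
  2ab≤a²+b² a b = ≤-by ((a - b) * (a - b)) (0≤x² (a - b))
    (solve 2 (λ a b → con (+ 2 / 1) :* (a :* b) :+ (a :- b) :* (a :- b) := a :* a :+ b :* b) refl a b)

  -- The cross term in the expansion of (S + y)², with 2xy ≤ x² + y² applied to each summand of S.
  cauchy-schwarz-step : ∀ n (x : ℕ → Carrier) y →
    ιℕ 2 * (sum n x * y) ≤ sum n (λ i → x i * x i) + ιℕ (suc n) * (y * y)
  cauchy-schwarz-step zero    x y = ≤-trans (2ab≤a²+b² (x 0) y)
    (≤-reflexive (solve 2 (λ a b → a :+ b := a :+ con 1ℚ :* b) refl _ _))
  cauchy-schwarz-step (suc n) x y = begin
    ιℕ 2 * ((sum n x + x (suc n)) * y)
      ≈⟨ solve 3 (λ s x y → con (+ 2 / 1) :* ((s :+ x) :* y) :=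
           con (+ 2 / 1) :* (s :* y) :+ con (+ 2 / 1) :* (x :* y)) refl (sum n x) (x (suc n)) y ⟩
    ιℕ 2 * (sum n x * y) + ιℕ 2 * (x (suc n) * y)
      ≤⟨ +-mono-≤ (cauchy-schwarz-step n x y) (2ab≤a²+b² (x (suc n)) y) ⟩
    Q + ιℕ (suc n) * (y * y) + (x (suc n) * x (suc n) + y * y)
      ≈⟨ solve 4 (λ q m x y → q :+ m :* y :+ (x :+ y) := q :+ x :+ (con 1ℚ :+ m) :* y) refl Q (ιℕ (suc n)) _ _ ⟩
    Q + x (suc n) * x (suc n) + (ιℕ 1 + ιℕ (suc n)) * (y * y)
      ≈⟨ +-congˡ (*-congʳ (ιℕ-+ 1 (suc n))) ⟨
    Q + x (suc n) * x (suc n) + ιℕ (2 ℕ.+ n) * (y * y) ∎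
    where Q = sum n (λ i → x i * x i)

  cauchy-schwarz : ∀ n (x : ℕ → Carrier) → sum n x * sum n x ≤ ιℕ (suc n) * sum n (λ i → x i * x i)
  cauchy-schwarz zero    x = ≤-reflexive (solve 1 (λ a → a := con 1ℚ :* a) refl _)
  cauchy-schwarz (suc n) x = begin
    (S + y) * (S + y)
      ≈⟨ solve 2 (λ s y → (s :+ y) :* (s :+ y) := s :* s :+ con (+ 2 / 1) :* (s :* y) :+ y :* y) refl S y ⟩
    S * S + ιℕ 2 * (S * y) + y * y
      ≤⟨ +-mono-≤ (+-mono-≤ (cauchy-schwarz n x) (cauchy-schwarz-step n x y)) ≤-refl ⟩
    ιℕ (suc n) * Q + (Q + ιℕ (suc n) * (y * y)) + y * y
      ≈⟨ solve 3 (λ m q y → m :* q :+ (q :+ m :* y) :+ y := (con 1ℚ :+ m) :* (q :+ y)) refl (ιℕ (suc n)) Q _ ⟩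
    (ιℕ 1 + ιℕ (suc n)) * (Q + y * y)
      ≈⟨ *-congʳ (ιℕ-+ 1 (suc n)) ⟨
    ιℕ (2 ℕ.+ n) * (Q + y * y) ∎
    where
    S = sum n x
    y = x (suc n)
    Q = sum n (λ i → x i * x i)

  -- Protocol counts against Θ by means of the transfer matrix

  module ProtocolBounds (r s : Carrier) (rs≈1 : r * s ≈ ιℕ 1)
    (r³≈ : r * r * r ≈ r * r + r + ιℕ 1) (r≥ : ι (+ 9 / 5) ≤ r) (r≤2 : r ≤ ιℕ 2) (0≤s : 0# ≤ s) where

    0≤r : 0# ≤ r
    0≤r = ≤-trans (ι-0≤ (+ 9 / 5)) r≥

    open GeometricPolynomials r 0≤r

    0≤r-1 : 0# ≤ r - ιℕ 1
    0≤r-1 = x≤y⇒0≤y-x (≤-trans (ι-≤ 1ℚ (+ 9 / 5)) r≥)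

    r²-r≤2 : r * r - r ≤ ιℕ 2
    r²-r≤2 = begin
      r * r - r            ≈⟨ solve 1 (λ r → r :* r :- r := r :* (r :- con 1ℚ)) refl r ⟩
      r * (r - ιℕ 1)       ≤⟨ *-mono-≤ (0≤ιℕ 2) 0≤r-1 r≤2 (+-mono-≤ r≤2 ≤-refl) ⟩
      ιℕ 2 * (ιℕ 2 - ιℕ 1) ≈⟨ solve 0 (con (+ 2 / 1) :* (con (+ 2 / 1) :- con 1ℚ) := con (+ 2 / 1)) refl ⟩
      ιℕ 2                 ∎

    1≤r²-r : ιℕ 1 ≤ r * r - r
    1≤r²-r = begin
      ιℕ 1                                   ≤⟨ ι-≤ 1ℚ (+ 36 / 25) ⟩
      ι (+ 36 / 25)                          ≈⟨ solve 0 (con (+ 36 / 25) := con (+ 9 / 5) :* (con (+ 9 / 5) :- con 1ℚ)) refl ⟩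
      ι (+ 9 / 5) * (ι (+ 9 / 5) - ιℕ 1)     ≤⟨ *-mono-≤ 0≤r (x≤y⇒0≤y-x (ι-≤ 1ℚ (+ 9 / 5))) r≥ (+-mono-≤ r≥ ≤-refl) ⟩
      r * (r - ιℕ 1)                         ≈⟨ solve 1 (λ r → r :* (r :- con 1ℚ) := r :* r :- r) refl r ⟩
      r * r - r                              ∎

    -- The Perron eigenvector of the transfer matrix of simple protocols, for
    -- the eigenvalue r of the weight i + j.
    eigen : Letter → Carrier
    eigen [A]  = ιℕ 1
    eigen [B]  = ιℕ 1
    eigen [AB] = r * r - r

    1≤eigen : ∀ l → ιℕ 1 ≤ eigen l
    1≤eigen [A]  = ≤-refl
    1≤eigen [B]  = ≤-refl
    1≤eigen [AB] = 1≤r²-r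

    0≤eigen : ∀ l → 0# ≤ eigen l
    0≤eigen l = ≤-trans (0≤ιℕ 1) (1≤eigen l)

    followingR : Letter → (Letter → Carrier) → Carrier
    followingR [A]  f = f [B] + f [AB]
    followingR [B]  f = f [A] + f [AB]
    followingR [AB] f = f [A] + f [B] + f [AB]

    ιℕ-following : ∀ l f → ιℕ (C.following l f) ≈ followingR l (λ l → ιℕ (f l))
    ιℕ-following [A]  f = ιℕ-+ (f [B]) (f [AB])
    ιℕ-following [B]  f = ιℕ-+ (f [A]) (f [AB])
    ιℕ-following [AB] f = trans (ιℕ-+ (f [A] ℕ.+ f [B]) (f [AB])) (+-congʳ (ιℕ-+ (f [A]) (f [B])))

    followingR-mono : ∀ l {f g} → (∀ l → f l ≤ g l) → followingR l f ≤ followingR l g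
    followingR-mono [A]  f≤g = +-mono-≤ (f≤g [B]) (f≤g [AB])
    followingR-mono [B]  f≤g = +-mono-≤ (f≤g [A]) (f≤g [AB])
    followingR-mono [AB] f≤g = +-mono-≤ (+-mono-≤ (f≤g [A]) (f≤g [B])) (f≤g [AB])

    followingR-cong : ∀ l {f g} → (∀ l → f l ≈ g l) → followingR l f ≈ followingR l g
    followingR-cong [A]  f≈g = +-cong (f≈g [B]) (f≈g [AB])
    followingR-cong [B]  f≈g = +-cong (f≈g [A]) (f≈g [AB])
    followingR-cong [AB] f≈g = +-cong (+-cong (f≈g [A]) (f≈g [B])) (f≈g [AB])

    followingR-*ʳ : ∀ l f x → followingR l (λ l → f l * x) ≈ followingR l f * x
    followingR-*ʳ [A]  f x = sym (distribʳ x _ _)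
    followingR-*ʳ [B]  f x = sym (distribʳ x _ _)
    followingR-*ʳ [AB] f x = trans (+-congʳ (sym (distribʳ x _ _))) (sym (distribʳ x _ _))

    -- One factor `s` for each player who moves: taking away a nonempty block turns Θ into at most s
    -- Θ, by `binomial-Θ≤`.
    discount : Letter → Carrier
    discount [A]  = s
    discount [B]  = s
    discount [AB] = s * s

    rs-cancel : ∀ x → r * (s * x) ≈ x
    rs-cancel x = trans (sym (*-assoc r s x)) (trans (*-congʳ rs≈1) (trans (*-congʳ ι-1) (*-identityˡ x)))

    [r²-r]s²≈1-s : (r * r - r) * (s * s) ≈ ιℕ 1 - s
    [r²-r]s²≈1-s = begin-equality
      (r * r - r) * (s * s)                  ≈⟨ solve 2 (λ r s → (r :* r :- r) :* (s :* s) := (r :* s) :* (r :* s) :- r :* s :* s) refl r s ⟩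
      (r * s) * (r * s) - r * s * s          ≈⟨ +-cong (*-cong rs≈1 rs≈1) (-‿cong (*-congʳ rs≈1)) ⟩
      ιℕ 1 * ιℕ 1 - ιℕ 1 * s                 ≈⟨ solve 1 (λ s → con 1ℚ :* con 1ℚ :- con 1ℚ :* s := con 1ℚ :- s) refl s ⟩
      ιℕ 1 - s                               ∎

    -- The tribonacci equation r³ = r² + r + 1 divided by r, with s for 1/r.
    r²-r≈1+s : r * r - r ≈ ιℕ 1 + s
    r²-r≈1+s = begin-equality
      r * r - r                                          ≈⟨ rs-cancel _ ⟨
      r * (s * (r * r - r))                              ≈⟨ solve 2 (λ r s → r :* (s :* (r :* r :- r)) := s :* (r :* r :* r) :- s :* (r :* r)) refl r s ⟩
      s * (r * r * r) - s * (r * r)                      ≈⟨ +-congʳ (*-congˡ r³≈) ⟩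
      s * (r * r + r + ιℕ 1) - s * (r * r)               ≈⟨ solve 2 (λ r s → s :* (r :* r :+ r :+ con 1ℚ) :- s :* (r :* r) := r :* s :+ s) refl r s ⟩
      r * s + s                                          ≈⟨ +-congʳ rs≈1 ⟩
      ιℕ 1 + s                                           ∎

    eigenvector : ∀ l → followingR l (λ l′ → eigen l′ * discount l′) ≈ eigen l
    eigenvector [A]  = trans (+-congˡ [r²-r]s²≈1-s) (solve 1 (λ s → con 1ℚ :* s :+ (con 1ℚ :- s) := con 1ℚ) refl s)
    eigenvector [B]  = eigenvector [A]
    eigenvector [AB] = trans (+-congˡ [r²-r]s²≈1-s)
      (trans (solve 1 (λ s → con 1ℚ :* s :+ con 1ℚ :* s :+ (con 1ℚ :- s) := con 1ℚ :+ s) refl s) (sym r²-r≈1+s))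

    -- For m > 0 this is the equation `Θ-suc`; for m = 0 there is no nonempty subset and the left
    -- side is 0.
    binomial-Θ≤ : ∀ m → binomial m (ifPositive Θ) ≤ s * Θ m
    binomial-Θ≤ zero    = *-nonNegative 0≤s (0≤Θ 0)
    binomial-Θ≤ (suc m) = ≤-reflexive (begin-equality
      binomial (suc m) (ifPositive Θ)               ≈⟨ rs-cancel _ ⟨
      r * (s * binomial (suc m) (ifPositive Θ))     ≈⟨ solve 3 (λ r s b → r :* (s :* b) := s :* (r :* b)) refl _ _ _ ⟩
      s * (r * binomial (suc m) (ifPositive Θ))     ≈⟨ *-congˡ (Θ-suc m) ⟨
      s * Θ (suc m)                                 ∎)

    move≤ : ∀ l {h c} → 0# ≤ c → (∀ m n → ιℕ (h m n) ≤ c * (Θ m * Θ n)) →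
            ∀ m n → ιℕ (C.move l h m n) ≤ c * discount l * (Θ m * Θ n)
    move≤ [A] {h} {c} 0≤c h≤ m n = begin
      ιℕ (C.binomial m (C.ifPositive λ b → h b n))
        ≈⟨ ιℕ-binomial-ifPositive m (λ b → h b n) ⟩
      binomial m (ifPositive λ b → ιℕ (h b n))
        ≤⟨ binomial-ifPositive-mono m (λ b _ → h≤ b n) ⟩
      binomial m (ifPositive λ b → c * (Θ b * Θ n))
        ≈⟨ trans (binomial-cong m (ifPositive-cong λ b _ → solve 3 (λ c x y → c :* (x :* y) := c :* y :* x) refl _ _ _))
             (binomial-ifPositive-*ˡ m (c * Θ n)) ⟩
      c * Θ n * binomial m (ifPositive Θ)
        ≤⟨ *-monoʳ-≤ _ (*-nonNegative 0≤c (0≤Θ n)) (binomial-Θ≤ m) ⟩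
      c * Θ n * (s * Θ m)
        ≈⟨ solve 4 (λ c y s x → c :* y :* (s :* x) := c :* s :* (x :* y)) refl _ _ _ _ ⟩
      c * s * (Θ m * Θ n) ∎
    move≤ [B] {h} {c} 0≤c h≤ m n = begin
      ιℕ (C.binomial n (C.ifPositive (h m)))
        ≈⟨ ιℕ-binomial-ifPositive n (h m) ⟩
      binomial n (ifPositive λ b → ιℕ (h m b))
        ≤⟨ binomial-ifPositive-mono n (λ b _ → h≤ m b) ⟩
      binomial n (ifPositive λ b → c * (Θ m * Θ b))
        ≈⟨ trans (binomial-cong n (ifPositive-cong λ b _ → solve 3 (λ c x y → c :* (x :* y) := c :* x :* y) refl _ _ _))
             (binomial-ifPositive-*ˡ n (c * Θ m)) ⟩
      c * Θ m * binomial n (ifPositive Θ)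
        ≤⟨ *-monoʳ-≤ _ (*-nonNegative 0≤c (0≤Θ m)) (binomial-Θ≤ n) ⟩
      c * Θ m * (s * Θ n)
        ≈⟨ solve 4 (λ c y s x → c :* y :* (s :* x) := c :* s :* (y :* x)) refl _ _ _ _ ⟩
      c * s * (Θ m * Θ n) ∎
    move≤ [AB] {h} {c} 0≤c h≤ m n = ≤-trans
      (move≤ [A] {C.move [B] h} (*-nonNegative 0≤c 0≤s) (move≤ [B] {h} 0≤c h≤) m n)
      (≤-reflexive (*-congʳ (*-assoc c s s)))

    δ₀₀≤ : ∀ l m n → ιℕ (C.δ₀₀ m n) ≤ eigen l * (Θ m * Θ n)
    δ₀₀≤ l zero zero = begin
      ιℕ 1                  ≤⟨ 1≤eigen l ⟩
      eigen l               ≈⟨ solve 1 (λ x → x := x :* (con 1ℚ :* con 1ℚ)) refl _ ⟩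
      eigen l * (ιℕ 1 * ιℕ 1) ≈⟨ *-congˡ (*-cong Θ-0 Θ-0) ⟨
      eigen l * (Θ 0 * Θ 0) ∎
    δ₀₀≤ l zero    (suc n) = ≤-trans (≤-reflexive ι-0) (*-nonNegative (0≤eigen l) (*-nonNegative (0≤Θ 0) (0≤Θ (suc n))))
    δ₀₀≤ l (suc m) n       = ≤-trans (≤-reflexive ι-0) (*-nonNegative (0≤eigen l) (*-nonNegative (0≤Θ (suc m)) (0≤Θ n)))

    following-moves≤ : ∀ l {h : Letter → ℕ → ℕ → ℕ} →
      (∀ l m n → ιℕ (h l m n) ≤ eigen l * (Θ m * Θ n)) →
      ∀ m n → ιℕ (C.following l λ l′ → C.move l′ (h l′) m n) ≤ eigen l * (Θ m * Θ n)
    following-moves≤ l {h} h≤ m n = begin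
      ιℕ (C.following l λ l′ → C.move l′ (h l′) m n)
        ≈⟨ ιℕ-following l (λ l′ → C.move l′ (h l′) m n) ⟩
      followingR l (λ l′ → ιℕ (C.move l′ (h l′) m n))
        ≤⟨ followingR-mono l (λ l′ → move≤ l′ {h l′} (0≤eigen l′) (h≤ l′) m n) ⟩
      followingR l (λ l′ → eigen l′ * discount l′ * (Θ m * Θ n))
        ≈⟨ followingR-*ʳ l (λ l′ → eigen l′ * discount l′) (Θ m * Θ n) ⟩
      followingR l (λ l′ → eigen l′ * discount l′) * (Θ m * Θ n)
        ≈⟨ *-congʳ (eigenvector l) ⟩
      eigen l * (Θ m * Θ n) ∎

    plays≤ : ∀ K l m n → ιℕ (C.plays K l m n) ≤ eigen l * (Θ m * Θ n)
    plays≤ zero    l m n = δ₀₀≤ l m n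
    plays≤ (suc K) l m n = ≤-trans (≤-reflexive (reflexive (≡.cong ιℕ (C.plays-suc K l m n)))) (cases m n)
      where
      -- The two summands are never both nonzero: at (0, 0) no move is possible, and elsewhere `δ₀₀`
      -- is 0. So the constant `eigen l` does not increase from one `K` to the next.
      cases : ∀ m n → ιℕ (C.δ₀₀ m n ℕ.+ C.following l λ l′ → C.move l′ (C.plays K l′) m n) ≤ eigen l * (Θ m * Θ n)
      cases zero    zero    = ≤-trans (≤-reflexive (reflexive (≡.cong (λ k → ιℕ (suc k)) (none l)))) (δ₀₀≤ l 0 0)
        where
        none : ∀ l → C.following l (λ l′ → C.move l′ (C.plays K l′) 0 0) ≡ 0
        none [A]  = ≡.refl
        none [B]  = ≡.refl
        none [AB] = ≡.refl
      cases zero    (suc n) = following-moves≤ l {C.plays K} (plays≤ K) 0 (suc n)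
      cases (suc m) n       = following-moves≤ l {C.plays K} (plays≤ K) (suc m) n

    -- Induction on the weight: the eigenvector equation gives the sum over first letters one factor
    -- r. The ½ makes the bound true for the empty word, because the entries of `eigen` are at most
    -- 2.
    words≥ : ∀ n k → n ℕ.≤ k → ∀ l → ι ½ * eigen l * r ^ n ≤ ιℕ (C.antidiagonal n (C.words k l))
    words≥ zero k _ l = begin
      ι ½ * eigen l * ιℕ 1              ≈⟨ solve 1 (λ x → con ½ :* x :* con 1ℚ := con ½ :* x) refl _ ⟩
      ι ½ * eigen l                     ≤⟨ *-monoʳ-≤ (ι ½) (ι-0≤ ½) (eigen≤2 l) ⟩
      ι ½ * ιℕ 2                        ≈⟨ solve 0 (con ½ :* con (+ 2 / 1) := con 1ℚ) refl ⟩
      ιℕ 1                              ≈⟨ reflexive (≡.cong ιℕ (C.words-00 k l)) ⟨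
      ιℕ (C.words k l 0 0)              ∎
      where
      eigen≤2 : ∀ l → eigen l ≤ ιℕ 2
      eigen≤2 [A]  = ι-≤ 1ℚ (+ 2 / 1)
      eigen≤2 [B]  = ι-≤ 1ℚ (+ 2 / 1)
      eigen≤2 [AB] = r²-r≤2
    words≥ (suc n) (suc k) (ℕ.s≤s n≤k) l = begin
      ι ½ * eigen l * (r * r ^ n)
        ≤⟨ step n n≤k ⟩
      followingR l (λ l′ → ιℕ (C.antidiagonal (suc n) (C.shift l′ (C.words k l′))))
        ≈⟨ ιℕ-following l (λ l′ → C.antidiagonal (suc n) (C.shift l′ (C.words k l′))) ⟨
      ιℕ (C.following l λ l′ → C.antidiagonal (suc n) (C.shift l′ (C.words k l′)))
        ≈⟨ reflexive (≡.cong ιℕ (C.antidiagonal-words-suc k l n)) ⟨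
      ιℕ (C.antidiagonal (suc n) (C.words (suc k) l)) ∎
      where
      lower : ℕ → Letter → Carrier
      lower n       [A]  = ι ½ * eigen [A] * r ^ n
      lower n       [B]  = ι ½ * eigen [B] * r ^ n
      -- A word of weight one cannot begin with `[AB]`, which already has weight two.
      lower zero    [AB] = 0#
      lower (suc n) [AB] = ι ½ * eigen [AB] * r ^ n
      shifted : ∀ n → n ℕ.≤ k → ∀ l →
                lower n l ≤ ιℕ (C.antidiagonal (suc n) (C.shift l (C.words k l)))
      shifted n       n≤k [A]  = words≥ n k n≤k [A]
      shifted n       n≤k [B]  = ≤-trans (words≥ n k n≤k [B])
        (≤-reflexive (reflexive (≡.cong ιℕ (≡.sym (C.antidiagonal-shift-[B] n (C.words k [B]))))))
      shifted zero    n≤k [AB] = 0≤ιℕ (C.antidiagonal 1 (C.shift [AB] (C.words k [AB])))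
      shifted (suc n) n≤k [AB] = ≤-trans (words≥ n k (ℕ.≤-trans (ℕ.n≤1+n n) n≤k) [AB])
        (≤-reflexive (reflexive (≡.cong ιℕ (≡.sym (C.antidiagonal-shift-[AB] n (C.words k [AB]))))))
      eigen-r² : ∀ n l → ι ½ * eigen l * (r * (r * r ^ n)) ≈ followingR l (lower (suc n))
      eigen-r² n l = begin-equality
        ι ½ * eigen l * (r * (r * r ^ n))
          ≈⟨ *-congʳ (*-congˡ (eigenvector l)) ⟨
        ι ½ * followingR l (λ l′ → eigen l′ * discount l′) * (r * (r * r ^ n))
          ≈⟨ solve 3 (λ h f p → h :* f :* p := f :* (h :* p)) refl (ι ½) _ _ ⟩
        followingR l (λ l′ → eigen l′ * discount l′) * (ι ½ * (r * (r * r ^ n)))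
          ≈⟨ followingR-*ʳ l (λ l′ → eigen l′ * discount l′) _ ⟨
        followingR l (λ l′ → eigen l′ * discount l′ * (ι ½ * (r * (r * r ^ n))))
          ≈⟨ followingR-cong l undiscount ⟩
        followingR l (lower (suc n)) ∎
        where
        undiscount : ∀ l → eigen l * discount l * (ι ½ * (r * (r * r ^ n))) ≈ lower (suc n) l
        undiscount [A]  = trans (solve 4 (λ x s r p → x :* s :* (con ½ :* (r :* p)) := con ½ :* x :* (r :* (s :* p))) refl (ιℕ 1) s r _)
          (*-congˡ (rs-cancel _))
        undiscount [B]  = undiscount [A]
        undiscount [AB] = trans (solve 4 (λ x s r p → x :* (s :* s) :* (con ½ :* (r :* (r :* p))) := con ½ :* x :* (r :* (s :* (r :* (s :* p))))) refl (eigen [AB]) s r _)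
          (*-congˡ (trans (rs-cancel _) (rs-cancel _)))
      ½r≤1+ : ∀ {x} → ιℕ 1 ≤ x →
        ι ½ * ιℕ 1 * (r * ιℕ 1) ≤ x + ιℕ (C.antidiagonal 1 (C.shift [AB] (C.words k [AB])))
      ½r≤1+ {x} 1≤x = begin
        ι ½ * ιℕ 1 * (r * ιℕ 1)   ≈⟨ solve 1 (λ r → con ½ :* con 1ℚ :* (r :* con 1ℚ) := con ½ :* r) refl r ⟩
        ι ½ * r                   ≤⟨ *-monoʳ-≤ (ι ½) (ι-0≤ ½) r≤2 ⟩
        ι ½ * ιℕ 2                ≈⟨ solve 0 (con ½ :* con (+ 2 / 1) := con 1ℚ) refl ⟩
        ιℕ 1                      ≤⟨ 1≤x ⟩
        x                         ≤⟨ x≤x+d (0≤ιℕ (C.antidiagonal 1 (C.shift [AB] (C.words k [AB])))) ⟩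
        x + ιℕ (C.antidiagonal 1 (C.shift [AB] (C.words k [AB]))) ∎
      first : ∀ l → ι ½ * eigen l * (r * ιℕ 1) ≤ followingR l (λ l′ → ιℕ (C.antidiagonal 1 (C.shift l′ (C.words k l′))))
      first [A]  = ½r≤1+ (≤-reflexive (reflexive (≡.cong ιℕ (≡.sym
        (≡.trans (C.antidiagonal-shift-[B] 0 (C.words k [B])) (C.words-00 k [B]))))))
      first [B]  = ½r≤1+ (≤-reflexive (reflexive (≡.cong ιℕ (≡.sym (C.words-00 k [A])))))
      first [AB] = begin
        ι ½ * (r * r - r) * (r * ιℕ 1)
          ≈⟨ solve 1 (λ r → con ½ :* (r :* r :- r) :* (r :* con 1ℚ) := con ½ :* (r :* r :* r :- r :* r)) refl r ⟩
        ι ½ * (r * r * r - r * r)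
          ≈⟨ *-congˡ (+-congʳ r³≈) ⟩
        ι ½ * (r * r + r + ιℕ 1 - r * r)
          ≈⟨ solve 1 (λ r → con ½ :* (r :* r :+ r :+ con 1ℚ :- r :* r) := con ½ :* (r :+ con 1ℚ)) refl r ⟩
        ι ½ * (r + ιℕ 1)
          ≤⟨ *-monoʳ-≤ (ι ½) (ι-0≤ ½) (+-mono-≤ r≤2 ≤-refl) ⟩
        ι ½ * (ιℕ 2 + ιℕ 1)
          ≤⟨ ≤-by (ι ½) (ι-0≤ ½) (solve 0 (con ½ :* (con (+ 2 / 1) :+ con 1ℚ) :+ con ½ := con 1ℚ :+ con 1ℚ) refl) ⟩
        ιℕ 1 + ιℕ 1
          ≤⟨ x≤x+d (0≤ιℕ (C.antidiagonal 1 (C.shift [AB] (C.words k [AB])))) ⟩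
        ιℕ 1 + ιℕ 1 + ιℕ (C.antidiagonal 1 (C.shift [AB] (C.words k [AB])))
          ≈⟨ +-congʳ (+-cong (reflexive (≡.cong ιℕ (C.words-00 k [A])))
               (reflexive (≡.cong ιℕ (≡.trans (C.antidiagonal-shift-[B] 0 (C.words k [B])) (C.words-00 k [B]))))) ⟨
        ιℕ (C.antidiagonal 1 (C.shift [A] (C.words k [A]))) + ιℕ (C.antidiagonal 1 (C.shift [B] (C.words k [B])))
          + ιℕ (C.antidiagonal 1 (C.shift [AB] (C.words k [AB]))) ∎
      step : ∀ n → n ℕ.≤ k → ι ½ * eigen l * (r * r ^ n) ≤
             followingR l (λ l′ → ιℕ (C.antidiagonal (suc n) (C.shift l′ (C.words k l′))))
      -- At weight one the eigenvector equation would count an `[AB]` that does not fit, so this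
      -- case is checked directly.
      step zero    n≤k = first l
      step (suc n) n≤k = ≤-trans (≤-reflexive (eigen-r² n l)) (followingR-mono l (shifted (suc n) n≤k))

    -- A word on the diagonal at i is joined from two words of weight i - 1, so a factor r² is
    -- missing, and the constant c = ½ (r² - r) of `words≥` enters twice. Here 8c² = 2 r² (r - 1)²,
    -- and r - 1 ≥ 4/5 suffices as 2 · 16/25 > 1.
    r²≤8c² : r * r ≤ ιℕ 8 * ((ι ½ * (r * r - r)) * (ι ½ * (r * r - r)))
    r²≤8c² = begin
      r * r
        ≈⟨ solve 1 (λ r → r :* r := r :* r :* con 1ℚ) refl r ⟩
      r * r * ιℕ 1
        ≤⟨ *-monoʳ-≤ (r * r) (0≤x² r) 1≤2[r-1]² ⟩
      r * r * (ιℕ 2 * ((r - ιℕ 1) * (r - ιℕ 1)))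
        ≈⟨ solve 1 (λ r → r :* r :* (con (+ 2 / 1) :* ((r :- con 1ℚ) :* (r :- con 1ℚ))) :=
             con (+ 8 / 1) :* ((con ½ :* (r :* r :- r)) :* (con ½ :* (r :* r :- r)))) refl r ⟩
      ιℕ 8 * ((ι ½ * (r * r - r)) * (ι ½ * (r * r - r))) ∎
      where
      0≤4/5 = x≤y⇒0≤y-x (ι-≤ 1ℚ (+ 9 / 5))
      4/5≤r-1 = +-mono-≤ r≥ (≤-refl { - ιℕ 1})
      1≤2[r-1]² : ιℕ 1 ≤ ιℕ 2 * ((r - ιℕ 1) * (r - ιℕ 1))
      1≤2[r-1]² = begin
        ιℕ 1
          ≤⟨ ≤-by (ι (+ 7 / 25)) (ι-0≤ (+ 7 / 25)) (solve 0
               (con 1ℚ :+ con (+ 7 / 25) := con (+ 2 / 1) :* ((con (+ 9 / 5) :- con 1ℚ) :* (con (+ 9 / 5) :- con 1ℚ))) refl) ⟩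
        ιℕ 2 * ((ι (+ 9 / 5) - ιℕ 1) * (ι (+ 9 / 5) - ιℕ 1))
          ≤⟨ *-monoʳ-≤ (ιℕ 2) (0≤ιℕ 2) (*-mono-≤ 0≤r-1 0≤4/5 4/5≤r-1 4/5≤r-1) ⟩
        ιℕ 2 * ((r - ιℕ 1) * (r - ιℕ 1)) ∎

    -- For i = j + 1 the factor n² covers the (j + 1)² lost to the choice of a largest entry, and 8
    -- comes from `r²≤8c²`. The length bound n + n has room for the at most 2j + 1 letters of the
    -- joined word.
    r²ⁱ≤words : ∀ n i → i ℕ.≤ n → 1 ℕ.≤ n →
      r ^ i * r ^ i ≤ ιℕ (8 ℕ.* (n ℕ.* n)) * ιℕ (C.words (n ℕ.+ n) [AB] i i)
    r²ⁱ≤words n zero    _   1≤n = begin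
      ιℕ 1 * ιℕ 1                                               ≈⟨ ιℕ-* 1 1 ⟨
      ιℕ 1                                                      ≤⟨ ιℕ-mono {1} (ℕ.≤-trans (ℕ.*-mono-≤ 1≤n 1≤n) (ℕ.m≤n*m (n ℕ.* n) 8)) ⟩
      ιℕ (8 ℕ.* (n ℕ.* n))                                      ≈⟨ solve 1 (λ x → x := x :* con 1ℚ) refl _ ⟩
      ιℕ (8 ℕ.* (n ℕ.* n)) * ιℕ 1                               ≈⟨ *-congˡ (reflexive (≡.cong ιℕ (C.words-00 (n ℕ.+ n) [AB]))) ⟨
      ιℕ (8 ℕ.* (n ℕ.* n)) * ιℕ (C.words (n ℕ.+ n) [AB] 0 0)    ∎
    r²ⁱ≤words n (suc j) j<n 1≤n = begin
      r * r ^ j * (r * r ^ j)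
        ≈⟨ solve 2 (λ r p → r :* p :* (r :* p) := r :* r :* (p :* p)) refl r (r ^ j) ⟩
      r * r * (r ^ j * r ^ j)
        ≤⟨ *-monoˡ-≤ _ (0≤x² (r ^ j)) r²≤8c² ⟩
      ιℕ 8 * (c * c) * (r ^ j * r ^ j)
        ≈⟨ solve 3 (λ k c p → k :* (c :* c) :* (p :* p) := k :* ((c :* p) :* (c :* p))) refl (ιℕ 8) c (r ^ j) ⟩
      ιℕ 8 * ((c * r ^ j) * (c * r ^ j))
        ≤⟨ *-monoʳ-≤ (ιℕ 8) (0≤ιℕ 8) (*-mono-≤ (0≤ιℕ W) 0≤cr c≤W c≤W) ⟩
      ιℕ 8 * (ιℕ W * ιℕ W)
        ≈⟨ *-congˡ (ιℕ-* W W) ⟨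
      ιℕ 8 * ιℕ (W ℕ.* W)
        ≤⟨ *-monoʳ-≤ (ιℕ 8) (0≤ιℕ 8) (ιℕ-mono (ℕ.≤-trans (C.antidiagonal²≤diagonal j)
             (ℕ.*-mono-≤ (ℕ.*-mono-≤ j<n j<n) words≤))) ⟩
      ιℕ 8 * ιℕ (n ℕ.* n ℕ.* w)
        ≈⟨ trans (*-congˡ (ιℕ-* (n ℕ.* n) w)) (trans (sym (*-assoc _ _ _)) (*-congʳ (sym (ιℕ-* 8 (n ℕ.* n))))) ⟩
      ιℕ (8 ℕ.* (n ℕ.* n)) * ιℕ w ∎
      where
      c = ι ½ * (r * r - r)
      W = C.antidiagonal j (C.words j [AB])
      w = C.words (n ℕ.+ n) [AB] (suc j) (suc j)
      c≤W : c * r ^ j ≤ ιℕ W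
      c≤W = words≥ j j ℕ.≤-refl [AB]
      0≤cr : 0# ≤ c * r ^ j
      0≤cr = *-nonNegative (*-nonNegative (ι-0≤ ½) (0≤eigen [AB])) (^-nonNegative j 0≤r)
      words≤ : C.words (j ℕ.+ suc j) [AB] (suc j) (suc j) ℕ.≤ w
      words≤ = ≡.subst (λ k → C.words (j ℕ.+ suc j) [AB] (suc j) (suc j) ℕ.≤ C.words k [AB] (suc j) (suc j))
        (ℕ.m∸n+n≡m (ℕ.+-mono-≤ (ℕ.<⇒≤ j<n) j<n))
        (C.words-+ (n ℕ.+ n ℕ.∸ (j ℕ.+ suc j)) (j ℕ.+ suc j) [AB] (suc j) (suc j))

    Θ²≤plays : ∀ n → 1 ℕ.≤ n →
      Θ n * Θ n ≤ ιℕ (suc n ℕ.* (8 ℕ.* (n ℕ.* n))) * ιℕ (C.plays (n ℕ.+ n) [AB] n n)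
    Θ²≤plays n 1≤n = begin
      Θ n * Θ n
        ≤⟨ cauchy-schwarz n (Ψ n) ⟩
      ιℕ (suc n) * sum n (λ i → Ψ n i * Ψ n i)
        ≤⟨ *-monoʳ-≤ _ (0≤ιℕ (suc n)) (sum-mono n Ψ²≤) ⟩
      ιℕ (suc n) * sum n (λ i → k * ιℕ (f i))
        ≈⟨ *-congˡ (trans (sum-*ˡ n k) (*-congˡ (sym (ιℕ-sum n f)))) ⟩
      ιℕ (suc n) * (k * ιℕ (C.sum n f))
        ≤⟨ *-monoʳ-≤ _ (0≤ιℕ (suc n)) (*-monoʳ-≤ k (0≤ιℕ (8 ℕ.* (n ℕ.* n))) (ιℕ-mono (C.diagonal≤plays n (n ℕ.+ n)))) ⟩
      ιℕ (suc n) * (k * ιℕ (C.plays (n ℕ.+ n) [AB] n n))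
        ≈⟨ trans (sym (*-assoc _ _ _)) (*-congʳ (sym (ιℕ-* (suc n) (8 ℕ.* (n ℕ.* n))))) ⟩
      ιℕ (suc n ℕ.* (8 ℕ.* (n ℕ.* n))) * ιℕ (C.plays (n ℕ.+ n) [AB] n n) ∎
      where
      k = ιℕ (8 ℕ.* (n ℕ.* n))
      f : ℕ → ℕ
      f i = C.surjections n i ℕ.* (C.surjections n i ℕ.* C.words (n ℕ.+ n) [AB] i i)
      Ψ²≤ : ∀ i → i ℕ.≤ n → Ψ n i * Ψ n i ≤ k * ιℕ (f i)
      Ψ²≤ i i≤n = begin
        g * r ^ i * (g * r ^ i)
          ≈⟨ solve 2 (λ g p → g :* p :* (g :* p) := g :* g :* (p :* p)) refl g (r ^ i) ⟩
        g * g * (r ^ i * r ^ i)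
          ≤⟨ *-monoʳ-≤ (g * g) (0≤x² g) (r²ⁱ≤words n i i≤n 1≤n) ⟩
        g * g * (k * ιℕ (C.words (n ℕ.+ n) [AB] i i))
          ≈⟨ solve 3 (λ g k w → g :* g :* (k :* w) := k :* (g :* (g :* w))) refl g k _ ⟩
        k * (g * (g * ιℕ (C.words (n ℕ.+ n) [AB] i i)))
          ≈⟨ *-congˡ (trans (ιℕ-* (C.surjections n i) _) (*-congˡ (ιℕ-* (C.surjections n i) _))) ⟨
        k * ιℕ (f i) ∎
        where g = ιℕ (C.surjections n i)

  -- From x y = 1 follows y = x y², a product of nonnegative factors.
  reciprocal-nonNegative : ∀ {x y} → 0# ≤ x → x * y ≈ ιℕ 1 → 0# ≤ y
  reciprocal-nonNegative {x} {y} 0≤x xy≈1 = begin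
    0#            ≤⟨ *-nonNegative 0≤x (0≤x² y) ⟩
    x * (y * y)   ≈⟨ *-assoc x y y ⟨
    x * y * y     ≈⟨ *-congʳ xy≈1 ⟩
    ιℕ 1 * y      ≈⟨ solve 1 (λ y → con 1ℚ :* y := y) refl y ⟩
    y             ∎

  reciprocal≤ : ∀ {x y} a b {_ : True (0ℚ ℚ.≤? b)} {_ : True (1ℚ ℚ.≤? a ℚ.* b)} →
                0# ≤ y → x * y ≈ ιℕ 1 → ι a ≤ x → y ≤ ι b
  reciprocal≤ {x} {y} a b {0≤b} {1≤ab} 0≤y xy≈1 a≤x = begin
    y                ≈⟨ solve 1 (λ y → y := y :* con 1ℚ) refl y ⟩
    y * ιℕ 1         ≤⟨ *-monoʳ-≤ y 0≤y (ι-≤ 1ℚ (a ℚ.* b) {1≤ab}) ⟩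
    y * ι (a ℚ.* b)  ≈⟨ trans (*-congˡ (ι-* a b)) (solve 3 (λ y a b → y :* (a :* b) := a :* y :* b) refl y (ι a) (ι b)) ⟩
    ι a * y * ι b    ≤⟨ *-monoˡ-≤ (ι b) (ι-0≤ b {0≤b}) (*-monoˡ-≤ y 0≤y a≤x) ⟩
    x * y * ι b      ≈⟨ trans (*-congʳ xy≈1) (solve 1 (λ b → con 1ℚ :* b := b) refl (ι b)) ⟩
    ι b              ∎

  ≤reciprocal : ∀ {x y} a b {_ : True (0ℚ ℚ.≤? b)} {_ : True (a ℚ.* b ℚ.≤? 1ℚ)} →
                0# ≤ y → x * y ≈ ιℕ 1 → x ≤ ι a → ι b ≤ y
  ≤reciprocal {x} {y} a b {0≤b} {ab≤1} 0≤y xy≈1 x≤a = begin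
    ι b              ≈⟨ trans (*-congʳ xy≈1) (solve 1 (λ b → con 1ℚ :* b := b) refl (ι b)) ⟨
    x * y * ι b      ≤⟨ *-monoˡ-≤ (ι b) (ι-0≤ b {0≤b}) (*-monoˡ-≤ y 0≤y x≤a) ⟩
    ι a * y * ι b    ≈⟨ trans (*-congˡ (ι-* a b)) (solve 3 (λ y a b → y :* (a :* b) := a :* y :* b) refl y (ι a) (ι b)) ⟨
    y * ι (a ℚ.* b)  ≤⟨ *-monoʳ-≤ y 0≤y (ι-≤ (a ℚ.* b) 1ℚ {ab≤1}) ⟩
    y * ιℕ 1         ≈⟨ solve 1 (λ y → y :* con 1ℚ := y) refl y ⟩
    y                ∎

  ιℕ-^ : ∀ n k → ιℕ (n ℕ.^ k) ≈ ιℕ n ^ k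
  ιℕ-^ n zero    = refl
  ιℕ-^ n (suc k) = trans (ιℕ-* n (n ℕ.^ k)) (*-congˡ (ιℕ-^ n k))

  ≤ιℕ-^ : ∀ {x} n k c → 0# ≤ x → c ℕ.≤ n ℕ.^ k → ιℕ c * x ≤ ιℕ n ^ k * x
  ≤ιℕ-^ {x} n k c 0≤x c≤ = *-monoˡ-≤ x 0≤x (≤-trans (ιℕ-mono c≤) (≤-reflexive (ιℕ-^ n k)))

  -- Numerical enclosures and the two polynomial sandwiches

  module Conclusion (s r L Z : Carrier) (0≤s : 0# ≤ s)
    (root : TribonacciConstant.cubic F s ≈ ιℕ 1) (sr≈1 : s * r ≈ ιℕ 1)
    (exp : IsExp L (ιℕ 1 + s)) (LZ≈1 : L * Z ≈ ιℕ 1) where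
    open TribonacciConstant F using (≤cubic-root; cubic-root≤)

    s₁ s₂ : ℚ
    s₁ = + 543689012 / 1000000000
    s₂ = + 543689013 / 1000000000

    s₁≤s : ι s₁ ≤ s
    s₁≤s = ≤cubic-root s₁ 0≤s root

    s≤s₂ : s ≤ ι s₂
    s≤s₂ = cubic-root≤ s₂ (ι-0≤ s₂) root

    0≤r : 0# ≤ r
    0≤r = reciprocal-nonNegative 0≤s sr≈1

    9/5≤r : ι (+ 9 / 5) ≤ r
    9/5≤r = ≤reciprocal s₂ (+ 9 / 5) 0≤r sr≈1 s≤s₂

    r≤2 : r ≤ ιℕ 2
    r≤2 = reciprocal≤ s₁ (+ 2 / 1) 0≤r sr≈1 s₁≤s

    rs≈1 : r * s ≈ ιℕ 1
    rs≈1 = trans (*-comm r s) sr≈1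

    r³≈ : r * r * r ≈ r * r + r + ιℕ 1
    r³≈ = begin-equality
      r * r * r
        ≈⟨ solve 1 (λ x → x := x :* con 1ℚ) refl _ ⟩
      r * r * r * ιℕ 1
        ≈⟨ *-congˡ root ⟨
      r * r * r * (s * s * s + s * s + s)
        ≈⟨ solve 2 (λ r s → r :* r :* r :* (s :* s :* s :+ s :* s :+ s) :=
             r :* r :* (r :* s) :+ r :* ((r :* s) :* (r :* s)) :+ (r :* s) :* (r :* s) :* (r :* s)) refl r s ⟩
      r * r * (r * s) + r * ((r * s) * (r * s)) + (r * s) * (r * s) * (r * s)
        ≈⟨ +-cong (+-cong (*-congˡ rs≈1) (*-congˡ (*-cong rs≈1 rs≈1))) (*-cong (*-cong rs≈1 rs≈1) rs≈1) ⟩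
      r * r * ιℕ 1 + r * (ιℕ 1 * ιℕ 1) + ιℕ 1 * ιℕ 1 * ιℕ 1
        ≈⟨ solve 1 (λ r → r :* r :* con 1ℚ :+ r :* (con 1ℚ :* con 1ℚ) :+ con 1ℚ :* con 1ℚ :* con 1ℚ
             := r :* r :+ r :+ con 1ℚ) refl r ⟩
      r * r + r + ιℕ 1 ∎

    1+s₁≤ : ι (1ℚ ℚ.+ s₁) ≤ ιℕ 1 + s
    1+s₁≤ = ≤-trans (≤-reflexive (ι-+ 1ℚ s₁)) (+-mono-≤ ≤-refl s₁≤s)

    ≤1+s₂ : ιℕ 1 + s ≤ ι (1ℚ ℚ.+ s₂)
    ≤1+s₂ = ≤-trans (+-mono-≤ ≤-refl s≤s₂) (≤-reflexive (sym (ι-+ 1ℚ s₂)))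

    -- The precision is dictated by the lower end 5.304815 of the rounding interval of Z²: since Z²
    -- is only about 5.3048166, `L` has to be bounded above by 0.43417506 or better.
    L₁ L₂ : ℚ
    L₁ = + 43417498 / 100000000
    L₂ = + 43417503 / 100000000

    0≤L : 0# ≤ L
    0≤L = log-nonNegative (≤-trans (ι-≤ (+ 3 / 2) (1ℚ ℚ.+ s₁)) 1+s₁≤) exp

    -- A crude bound first, because the geometric tail estimate behind `L₁≤L` is valid only up to ½.
    L≤½ : L ≤ ι ½
    L≤½ = log≤ 3 ½ (1ℚ ℚ.+ s₂) (ι-0≤ ½) 0≤L exp ≤1+s₂

    L≤L₂ : L ≤ ι L₂
    L≤L₂ = log≤ 10 L₂ (1ℚ ℚ.+ s₂) (ι-0≤ L₂) 0≤L exp ≤1+s₂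

    L₁≤L : ι L₁ ≤ L
    -- At twelve terms the tail bound (2/3) 4⁻¹² is about 4 · 10⁻⁸.
    L₁≤L = ≤log 12 L₁ (1ℚ ℚ.+ s₁) 0≤L L≤½ exp 1+s₁≤

    0≤Z : 0# ≤ Z
    0≤Z = reciprocal-nonNegative 0≤L LZ≈1

    Z₁ Z₂ : ℚ
    Z₁ = + 23032185 / 10000000
    Z₂ = + 2303219 / 1000000

    Z₁≤Z : ι Z₁ ≤ Z
    Z₁≤Z = ≤reciprocal L₂ Z₁ 0≤Z LZ≈1 L≤L₂

    Z≤Z₂ : Z ≤ ι Z₂
    Z≤Z₂ = reciprocal≤ L₁ Z₂ 0≤Z LZ≈1 L₁≤L

    Z₁²≤Z² : ι (Z₁ ℚ.* Z₁) ≤ Z * Z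
    Z₁²≤Z² = ≤-trans (≤-reflexive (ι-* Z₁ Z₁)) (*-mono-≤ 0≤Z (ι-0≤ Z₁) Z₁≤Z Z₁≤Z)

    Z²≤Z₂² : Z * Z ≤ ι (Z₂ ℚ.* Z₂)
    Z²≤Z₂² = ≤-trans (*-mono-≤ (ι-0≤ Z₂) 0≤Z Z≤Z₂ Z≤Z₂) (≤-reflexive (sym (ι-* Z₂ Z₂)))

    open GeometricPolynomials r 0≤r public
    open Renewal L 0≤L
    open ProtocolBounds r s rs≈1 r³≈ 9/5≤r r≤2 0≤s using (plays≤; Θ²≤plays; r²-r≤2)

    r[1+s]≈1+r : r * (ιℕ 1 + s) ≈ ιℕ 1 + r
    r[1+s]≈1+r = trans (solve 2 (λ r s → r :* (con 1ℚ :+ s) := r :* s :+ r) refl r s) (+-congʳ rs≈1)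

    -- As e^L = 1 + s and r s = 1, the weights r Lᵏ/k! over all k ≥ 0 have the sum 1 + r, of which k
    -- = 0 takes r.
    r*exp≤ : ∀ n → r * exp≤ n L ≤ ιℕ 1 + r
    r*exp≤ n = ≤-trans (*-monoʳ-≤ r 0≤r (exp≤≤exp 0≤L exp n)) (≤-reflexive r[1+s]≈1+r)

    ≤r*exp : ∀ n → ιℕ 1 + r ≤ r * exp≤ n L + ι (+ 4 / 3) * quarter n
    ≤r*exp n = begin
      ιℕ 1 + r                                              ≈⟨ r[1+s]≈1+r ⟨
      r * (ιℕ 1 + s)                                        ≤⟨ *-monoʳ-≤ r 0≤r (exp≤exp≤+tail 0≤L L≤½ exp n) ⟩
      r * (exp≤ n L + ι (+ 2 / 3) * quarter n)              ≈⟨ solve 3 (λ r e q → r :* (e :+ con (+ 2 / 3) :* q) := r :* e :+ r :* (con (+ 2 / 3) :* q)) refl r _ _ ⟩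
      r * exp≤ n L + r * (ι (+ 2 / 3) * quarter n)          ≤⟨ +-mono-≤ ≤-refl (*-monoˡ-≤ _ (*-nonNegative (ι-0≤ (+ 2 / 3)) (0≤quarter n)) r≤2) ⟩
      r * exp≤ n L + ιℕ 2 * (ι (+ 2 / 3) * quarter n)       ≈⟨ +-congˡ (solve 1 (λ q → con (+ 2 / 1) :* (con (+ 2 / 3) :* q) := con (+ 4 / 3) :* q) refl _) ⟩
      r * exp≤ n L + ι (+ 4 / 3) * quarter n                ∎

    3/4≤rL : ι (+ 3 / 4) ≤ r * L
    3/4≤rL = begin
      ι (+ 3 / 4)                ≤⟨ ι-≤ (+ 3 / 4) (+ 9 / 5 ℚ.* L₁) ⟩
      ι (+ 9 / 5 ℚ.* L₁)         ≈⟨ ι-* (+ 9 / 5) L₁ ⟩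
      ι (+ 9 / 5) * ι L₁         ≤⟨ *-mono-≤ 0≤r (ι-0≤ L₁) 9/5≤r L₁≤L ⟩
      r * L                      ∎

    X : ℕ → Carrier
    X n = ιℕ (n !) * Z ^ n

    0≤X : ∀ n → 0# ≤ X n
    0≤X n = *-nonNegative (0≤ιℕ (n !)) (^-nonNegative n 0≤Z)

    θZⁿ≈Θ : ∀ n → θ n * Z ^ n ≈ Θ n
    θZⁿ≈Θ n = begin-equality
      Θ n * L ^ n * Z ^ n       ≈⟨ *-assoc _ _ _ ⟩
      Θ n * (L ^ n * Z ^ n)     ≈⟨ *-congˡ (trans (sym (*-^ L Z n)) (trans (^-cong n (trans LZ≈1 ι-1)) (1^n≈1 n))) ⟩
      Θ n * 1#                  ≈⟨ *-identityʳ _ ⟩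
      Θ n                       ∎

    Θ≤X : ∀ n → Θ n ≤ X n
    Θ≤X n = begin
      Θ n                           ≈⟨ θZⁿ≈Θ n ⟨
      θ n * Z ^ n                   ≤⟨ *-monoˡ-≤ _ (^-nonNegative n 0≤Z) (θ≤! r*exp≤ (suc n) n ℕ.≤-refl) ⟩
      ιℕ (n !) * ιℕ 1 * Z ^ n       ≈⟨ *-congʳ (solve 1 (λ x → x :* con 1ℚ := x) refl _) ⟩
      X n                           ∎

    X≤2Θ : ∀ n → X n ≤ ιℕ 2 * Θ n
    X≤2Θ n = begin
      ιℕ (n !) * Z ^ n                          ≈⟨ solve 2 (λ f z → f :* z := con (+ 2 / 1) :* (f :* con ½ :* z)) refl _ _ ⟩
      ιℕ 2 * (ιℕ (n !) * ι ½ * Z ^ n)           ≤⟨ *-monoʳ-≤ _ (0≤ιℕ 2) (*-monoˡ-≤ _ (^-nonNegative n 0≤Z) (begin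
        ιℕ (n !) * ι ½       ≤⟨ *-monoʳ-≤ _ (0≤ιℕ (n !)) (x≤x+d (*-nonNegative (ι-0≤ ½) (0≤quarter n))) ⟩
        ιℕ (n !) * floor n   ≤⟨ !*floor≤θ r≤2 3/4≤rL ≤r*exp (suc n) n ℕ.≤-refl ⟩
        θ n                  ∎)) ⟩
      ιℕ 2 * (θ n * Z ^ n)                      ≈⟨ *-congˡ (θZⁿ≈Θ n) ⟩
      ιℕ 2 * Θ n                                ∎

    B : ℕ → Carrier
    B n = ιℕ (n !) ^ 2 * Z ^ (2 ℕ.* n)

    B≈X² : ∀ n → B n ≈ X n * X n
    B≈X² n = trans (*-congˡ (trans (^-+ Z n (n ℕ.+ 0)) (*-congˡ (reflexive (≡.cong (Z ^_) (ℕ.+-identityʳ n))))))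
      (solve 2 (λ f z → f :* (f :* con 1ℚ) :* (z :* z) := f :* z :* (f :* z)) refl _ _)

    Θ²≤X² : ∀ n → Θ n * Θ n ≤ X n * X n
    Θ²≤X² n = *-mono-≤ (0≤X n) (0≤Θ n) (Θ≤X n) (Θ≤X n)

    X²≤4Θ² : ∀ n → X n * X n ≤ ιℕ 4 * (Θ n * Θ n)
    X²≤4Θ² n = ≤-trans (*-mono-≤ (*-nonNegative (0≤ιℕ 2) (0≤Θ n)) (0≤X n) (X≤2Θ n) (X≤2Θ n))
      (≤-reflexive (solve 1 (λ t → con (+ 2 / 1) :* t :* (con (+ 2 / 1) :* t) := con (+ 4 / 1) :* (t :* t)) refl (Θ n)))

    U : ℕ → ℕ
    U n = C.plays (n ℕ.+ n) [AB] n n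

    U≤2X² : ∀ n → ιℕ (U n) ≤ ιℕ 2 * (X n * X n)
    U≤2X² n = ≤-trans (plays≤ (n ℕ.+ n) [AB] n n)
      (*-mono-≤ (0≤ιℕ 2) (0≤x² (Θ n)) r²-r≤2 (Θ²≤X² n))

    X²≤U : ∀ n → 1 ℕ.≤ n → X n * X n ≤ ιℕ (4 ℕ.* (suc n ℕ.* (8 ℕ.* (n ℕ.* n)))) * ιℕ (U n)
    X²≤U n 1≤n = ≤-trans (X²≤4Θ² n) (≤-trans (*-monoʳ-≤ (ιℕ 4) (0≤ιℕ 4) (Θ²≤plays n 1≤n))
      (≤-reflexive (trans (sym (*-assoc _ _ _)) (*-congʳ (sym (ιℕ-* 4 (suc n ℕ.* (8 ℕ.* (n ℕ.* n)))))))))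

    module _ {n} (2≤n : 2 ℕ.≤ n) where

      1≤n : 1 ℕ.≤ n
      1≤n = ℕ.≤-trans (ℕ.s≤s ℕ.z≤n) 2≤n

      2^k≤n^k : ∀ k → 2 ℕ.^ k ℕ.≤ n ℕ.^ k
      2^k≤n^k k = ℕ.^-monoˡ-≤ k 2≤n

      -- For n ≥ 2 one has 32 ≤ n⁵ and n + 1 ≤ n²; together with n² this gives the exponent 9.
      32[n+1]n²≤n⁹ : 4 ℕ.* (suc n ℕ.* (8 ℕ.* (n ℕ.* n))) ℕ.≤ n ℕ.^ 9
      32[n+1]n²≤n⁹ = ℕ.≤-trans (ℕ.≤-reflexive (lhs n)) (ℕ.≤-trans
        (ℕ.*-mono-≤ (2^k≤n^k 5) (ℕ.*-mono-≤ n+1≤n² (ℕ.≤-refl {n ℕ.* n}))) (ℕ.≤-reflexive (rhs n)))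
        where
        open import Data.Nat.Tactic.RingSolver using (solve-∀)
        lhs : ∀ n → 4 ℕ.* (suc n ℕ.* (8 ℕ.* (n ℕ.* n))) ≡ 32 ℕ.* (suc n ℕ.* (n ℕ.* n))
        lhs = solve-∀
        fourth : ∀ n → n ℕ.* n ℕ.* (n ℕ.* n) ≡ n ℕ.* (n ℕ.* (n ℕ.* (n ℕ.* 1)))
        fourth = solve-∀
        rhs : ∀ n → n ℕ.^ 5 ℕ.* (n ℕ.* n ℕ.* (n ℕ.* n)) ≡ n ℕ.^ 9
        rhs n = ≡.trans (≡.cong (n ℕ.^ 5 ℕ.*_) (fourth n)) (≡.sym (ℕ.^-distribˡ-+-* n 5 4))
        n+1≤n² : suc n ℕ.≤ n ℕ.* n
        n+1≤n² = ℕ.≤-trans (ℕ.+-monoˡ-≤ n 1≤n)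
          (ℕ.≤-trans (ℕ.≤-reflexive (≡.cong (n ℕ.+_) (≡.sym (ℕ.+-identityʳ n)))) (ℕ.*-monoˡ-≤ n 2≤n))

      Θ²≍B : B n ≤ ιℕ n ^ 2 * (Θ n * Θ n) × Θ n * Θ n ≤ ιℕ n ^ 2 * B n
      Θ²≍B =
        ≤-trans (≤-reflexive (B≈X² n)) (≤-trans (X²≤4Θ² n) (≤ιℕ-^ n 2 4 (0≤x² (Θ n)) (2^k≤n^k 2))) ,
        ≤-trans (≤-trans (Θ²≤X² n) (≤-trans (≤-reflexive (solve 1 (λ x → x := con 1ℚ :* x) refl _))
          (≤ιℕ-^ n 2 1 (0≤x² (X n)) (ℕ.≤-trans (ℕ.s≤s ℕ.z≤n) (2^k≤n^k 2)))))
          (≤-reflexive (*-congˡ (sym (B≈X² n))))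

      U≍B : B n ≤ ιℕ n ^ 9 * ιℕ (U n) × ιℕ (U n) ≤ ιℕ n ^ 9 * B n
      U≍B =
        ≤-trans (≤-reflexive (B≈X² n))
          (≤-trans (X²≤U n 1≤n) (≤ιℕ-^ n 9 _ (0≤ιℕ (U n)) 32[n+1]n²≤n⁹)) ,
        ≤-trans (≤-trans (U≤2X² n) (≤ιℕ-^ n 9 2 (0≤x² (X n))
          (ℕ.≤-trans (ℕ.s≤s (ℕ.s≤s ℕ.z≤n)) (2^k≤n^k 9))))
          (≤-reflexive (*-congˡ (sym (B≈X² n))))

-- Cauchy sequences of rationals form an archimedean ordered ring

module RealNumbers where
  open import Defs hiding (_+_; _*_; -_; _-_)
  import Defs as D
  open import Algebra.Bundles using (CommutativeRing)
  open import Data.Nat.Base using (ℕ; _⊔_)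
  import Data.Nat.Base as ℕ
  import Data.Nat.Properties as ℕ
  open import Data.Product using (_×_; _,_; ∃-syntax)
  open import Data.Rational.Base using (ℚ; 0ℚ; ½)
  import Data.Rational.Base as ℚ
  import Data.Rational.Properties as ℚ
  open import Data.Rational.Solver using (module +-*-Solver)
  open import Data.Sum.Base using (_⊎_; inj₁; inj₂)
  open import Level using (0ℓ)
  open import Relation.Binary.PropositionalEquality
  open +-*-Solver

  -- Wrapping the two relations lets Agda infer the real numbers they relate.
  infix 4 _≈_ _⊑_
  record _≈_ (x y : ℝ) : Set where
    constructor ≈⁺
    field ≈⁻ : x ≃ y
  open _≈_ public

  record _⊑_ (x y : ℝ) : Set where
    constructor ⊑⁺
    field ⊑⁻ : x ≤ y
  open _⊑_ public

  both : ∀ {P Q : ℕ → Set} → Eventually P → Eventually Q → Eventually (λ n → P n × Q n)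
  both (M , p) (N , q) = M ⊔ N , λ n n≥ → p n (ℕ.m⊔n≤o⇒m≤o M N n≥) , q n (ℕ.m⊔n≤o⇒n≤o M N n≥)

  eventually : ∀ {P Q : ℕ → Set} → (∀ n → P n → Q n) → Eventually P → Eventually Q
  eventually f (N , p) = N , λ n n≥ → f n (p n n≥)

  <-+-positive : ∀ {p q ε} → p ℚ.≤ q → 0ℚ ℚ.< ε → p ℚ.< q ℚ.+ ε
  <-+-positive {p} {q} p≤q 0<ε = subst (ℚ._< q ℚ.+ _) (ℚ.+-identityʳ p) (ℚ.+-mono-≤-< p≤q 0<ε)

  p≤∣p∣ : ∀ p → p ℚ.≤ ℚ.∣ p ∣
  p≤∣p∣ p with ℚ.≤-total 0ℚ p
  ... | inj₁ 0≤p = ℚ.≤-reflexive (sym (ℚ.0≤p⇒∣p∣≡p 0≤p))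
  ... | inj₂ p≤0 = ℚ.≤-trans p≤0 (ℚ.0≤∣p∣ p)

  ∣p-q∣<ε⇒p<q+ε : ∀ {p q ε} → ℚ.∣ p ℚ.- q ∣ ℚ.< ε → p ℚ.< q ℚ.+ ε
  ∣p-q∣<ε⇒p<q+ε {p} {q} {ε} <ε = subst (ℚ._< q ℚ.+ ε)
    (solve 2 (λ p q → q :+ (p :- q) := p) refl p q)
    (ℚ.+-monoʳ-< q (ℚ.≤-<-trans (p≤∣p∣ (p ℚ.- q)) <ε))

  <⇒∣-∣< : ∀ {p q ε} → p ℚ.< q ℚ.+ ε → q ℚ.< p ℚ.+ ε → ℚ.∣ p ℚ.- q ∣ ℚ.< ε
  <⇒∣-∣< {p} {q} {ε} p< q< with ℚ.∣p∣≡p∨∣p∣≡-p (p ℚ.- q)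
  ... | inj₁ eq = subst₂ ℚ._<_ (sym eq)
    (solve 2 (λ q ε → (q :+ ε) :- q := ε) refl q ε) (ℚ.+-monoˡ-< (ℚ.- q) p<)
  ... | inj₂ eq = subst₂ ℚ._<_
    (trans (solve 2 (λ p q → q :- p := :- (p :- q)) refl p q) (sym eq))
    (solve 2 (λ p ε → (p :+ ε) :- p := ε) refl p ε) (ℚ.+-monoˡ-< (ℚ.- p) q<)

  pointwise-≈ : ∀ {x y} → (∀ n → seq x n ≡ seq y n) → x ≈ y
  pointwise-≈ {x} {y} x≡y = ≈⁺ λ ε 0<ε → 0 , λ n _ →
    subst (ℚ._< ε) (sym (trans (cong (λ p → ℚ.∣ p ℚ.- seq y n ∣) (x≡y n)) (∣p-p∣≡0 (seq y n)))) 0<ε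

  pointwise-⊑ : ∀ {x y} → (∀ n → seq x n ℚ.≤ seq y n) → x ⊑ y
  pointwise-⊑ x≤y = ⊑⁺ λ ε 0<ε → 0 , λ n _ → <-+-positive (x≤y n) 0<ε

  ⊑-reflexive : ∀ {x y} → x ≈ y → x ⊑ y
  ⊑-reflexive (≈⁺ x≃y) = ⊑⁺ λ ε 0<ε → eventually (λ n → ∣p-q∣<ε⇒p<q+ε) (x≃y ε 0<ε)

  ⊑-antisym : ∀ {x y} → x ⊑ y → y ⊑ x → x ≈ y
  ⊑-antisym (⊑⁺ x≤y) (⊑⁺ y≤x) = ≈⁺ λ ε 0<ε →
    eventually (λ n (p , q) → <⇒∣-∣< p q) (both (x≤y ε 0<ε) (y≤x ε 0<ε))

  ⊑-trans : ∀ {x y z} → x ⊑ y → y ⊑ z → x ⊑ z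
  ⊑-trans {x} {y} {z} (⊑⁺ x≤y) (⊑⁺ y≤z) = ⊑⁺ λ ε 0<ε → eventually
    (λ n (p , q) → ℚ.<-trans p (subst (seq y n ℚ.+ ½ ℚ.* ε ℚ.<_)
      (trans (ℚ.+-assoc (seq z n) _ _) (cong (seq z n ℚ.+_) (half+half ε)))
      (ℚ.+-monoˡ-< (½ ℚ.* ε) q)))
    (both (x≤y (½ ℚ.* ε) (half>0 0<ε)) (y≤z (½ ℚ.* ε) (half>0 0<ε)))

  ≈-refl : ∀ {x} → x ≈ x
  ≈-refl = pointwise-≈ λ _ → refl

  ≈-sym : ∀ {x y} → x ≈ y → y ≈ x
  ≈-sym {x} {y} (≈⁺ x≃y) = ≈⁺ λ ε 0<ε →
    eventually (λ n → subst (ℚ._< ε) (∣-∣-swap (seq x n) (seq y n))) (x≃y ε 0<ε)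

  ≈-trans : ∀ {x y z} → x ≈ y → y ≈ z → x ≈ z
  ≈-trans x≈y y≈z = ⊑-antisym (⊑-trans (⊑-reflexive x≈y) (⊑-reflexive y≈z))
    (⊑-trans (⊑-reflexive (≈-sym y≈z)) (⊑-reflexive (≈-sym x≈y)))

  0≤p*p : ∀ p → 0ℚ ℚ.≤ p ℚ.* p
  0≤p*p p with ℚ.≤-total 0ℚ p
  ... | inj₁ 0≤p = ℚ.nonNegative⁻¹ _ {{ℚ.nonNeg*nonNeg⇒nonNeg p {{ℚ.nonNegative 0≤p}} p {{ℚ.nonNegative 0≤p}}}}
  ... | inj₂ p≤0 = subst (0ℚ ℚ.≤_) (solve 1 (λ p → (:- p) :* (:- p) := p :* p) refl p)
    (ℚ.nonNegative⁻¹ _ {{ℚ.nonNeg*nonNeg⇒nonNeg (ℚ.- p) {{ℚ.nonNegative (ℚ.neg-antimono-≤ p≤0)}} (ℚ.- p) {{ℚ.nonNegative (ℚ.neg-antimono-≤ p≤0)}}}})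

  fromℚ-reflects : ∀ {p q} → fromℚ p ⊑ fromℚ q → p ℚ.≤ q
  fromℚ-reflects {p} {q} (⊑⁺ p≤q) = ℚ.≮⇒≥ λ q<p →
    let 0<p-q = subst (ℚ._< p ℚ.- q) (ℚ.+-inverseʳ q) (ℚ.+-monoˡ-< (ℚ.- q) q<p)
        (N , p<) = p≤q (p ℚ.- q) 0<p-q
    in ℚ.<-irrefl (solve 2 (λ p q → p := q :+ (p :- q)) refl p q) (p< N ℕ.≤-refl)

  -- One entry of the sequence, beyond which it varies by less than half of q - p, is compared with
  -- the midpoint of p and q.
  located : ∀ x {p q} → p ℚ.< q → fromℚ p ⊑ x ⊎ x ⊑ fromℚ q
  located x {p} {q} p<q with cauchy x (½ ℚ.* (q ℚ.- p)) (half>0 0<q-p)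
    where
    0<q-p : 0ℚ ℚ.< q ℚ.- p
    0<q-p = subst (ℚ._< q ℚ.- p) (ℚ.+-inverseʳ p) (ℚ.+-monoˡ-< (ℚ.- p) p<q)
  ... | N , close with ℚ.≤-total (seq x N) (p ℚ.+ ½ ℚ.* (q ℚ.- p))
  ... | inj₁ xN≤ = inj₂ (⊑⁺ λ ε 0<ε → N , λ n N≤n → <-+-positive
    (ℚ.<⇒≤ (ℚ.<-≤-trans (∣p-q∣<ε⇒p<q+ε (close n N N≤n ℕ.≤-refl))
      (subst (seq x N ℚ.+ ½ ℚ.* (q ℚ.- p) ℚ.≤_)
        (trans (ℚ.+-assoc p _ _) (trans (cong (p ℚ.+_) (half+half (q ℚ.- p)))
          (solve 2 (λ p q → p :+ (q :- p) := q) refl p q)))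
        (ℚ.+-monoˡ-≤ (½ ℚ.* (q ℚ.- p)) xN≤)))) 0<ε)
  ... | inj₂ xN≥ = inj₁ (⊑⁺ λ ε 0<ε → N , λ n N≤n → <-+-positive
    (ℚ.<⇒≤ (subst₂ ℚ._<_ (solve 2 (λ p d → (p :+ d) :- d := p) refl p (½ ℚ.* (q ℚ.- p)))
      (solve 2 (λ x d → (x :+ d) :- d := x) refl (seq x n) (½ ℚ.* (q ℚ.- p)))
      (ℚ.+-monoˡ-< (ℚ.- (½ ℚ.* (q ℚ.- p)))
        (ℚ.≤-<-trans xN≥ (∣p-q∣<ε⇒p<q+ε (close N n ℕ.≤-refl N≤n)))))) 0<ε)

  bounded : ∀ x → ∃[ B ] 0ℚ ℚ.< B × x ⊑ fromℚ B
  bounded x = let (B , B>0 , N , x≤B) = eventually-bounded x in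
    B , ℚ.positive⁻¹ B {{B>0}} , ⊑⁺ λ ε 0<ε → N , λ n N≤n →
      <-+-positive (ℚ.≤-trans (p≤∣p∣ (seq x n)) (x≤B n N≤n)) 0<ε

  open import Algebra.Structures _≈_ using (IsAbelianGroup; IsRing)
  open import Algebra.Definitions _≈_ using (LeftInverse; RightInverse; Congruent₁)

  -- The operations are sealed because comparing two sums of real numbers by
  -- unfolding them compares the proofs of their Cauchy property.
  infix  9 -_
  infixl 7 _*_
  infixl 6 _+_

  opaque
    _+_ _*_ : ℝ → ℝ → ℝ
    _+_ = D._+_
    _*_ = D._*_

    -_ : ℝ → ℝ
    -_ = D.-_

  opaque
    unfolding _+_ _*_ -_

    +-mono-⊑ : ∀ {x y u v} → x ⊑ y → u ⊑ v → x + u ⊑ y + v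
    +-mono-⊑ {x} {y} {u} {v} (⊑⁺ x≤y) (⊑⁺ u≤v) = ⊑⁺ λ ε 0<ε → eventually
      (λ n (p , q) → subst (seq x n ℚ.+ seq u n ℚ.<_)
        (trans (solve 3 (λ y v h → (y :+ h) :+ (v :+ h) := (y :+ v) :+ (h :+ h)) refl
          (seq y n) (seq v n) (½ ℚ.* ε)) (cong (seq y n ℚ.+ seq v n ℚ.+_) (half+half ε)))
        (ℚ.+-mono-< p q))
      (both (x≤y (½ ℚ.* ε) (half>0 0<ε)) (u≤v (½ ℚ.* ε) (half>0 0<ε)))

    neg-⊑ : ∀ {x y} → x ⊑ y → - y ⊑ - x
    neg-⊑ {x} {y} (⊑⁺ x≤y) = ⊑⁺ λ ε 0<ε → eventually
      (λ n p → subst₂ ℚ._<_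
        (solve 2 (λ x y → x :+ (:- x :- y) := :- y) refl (seq x n) (seq y n))
        (solve 3 (λ x y ε → (y :+ ε) :+ (:- x :- y) := :- x :+ ε) refl (seq x n) (seq y n) ε)
        (ℚ.+-monoˡ-< (ℚ.- seq x n ℚ.- seq y n) p))
      (x≤y ε 0<ε)

    +-cong : ∀ {x y u v} → x ≈ y → u ≈ v → x + u ≈ y + v
    +-cong {x} {y} {u} {v} x≈y u≈v = ⊑-antisym
      (+-mono-⊑ {x} {y} {u} {v} (⊑-reflexive x≈y) (⊑-reflexive u≈v))
      (+-mono-⊑ {y} {x} {v} {u} (⊑-reflexive (≈-sym x≈y)) (⊑-reflexive (≈-sym u≈v)))

    -‿cong : ∀ {x y} → x ≈ y → - x ≈ - y
    -‿cong {x} {y} x≈y = ⊑-antisym (neg-⊑ {y} {x} (⊑-reflexive (≈-sym x≈y))) (neg-⊑ {x} {y} (⊑-reflexive x≈y))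

    *-cong : ∀ {x y u v} → x ≈ y → u ≈ v → x * u ≈ y * v
    *-cong {x} {y} {u} {v} (≈⁺ x≃y) (≈⁺ u≃v) = ≈⁺ λ ε 0<ε →
      let (A , A>0 , x≤A) = eventually-bounded x
          (B , B>0 , v≤B) = eventually-bounded v
          (δ , δ>0 , Aδ≡) = scaled A A>0 (½ ℚ.* ε) (half>0 0<ε)
          (η , η>0 , Bη≡) = scaled B B>0 (½ ℚ.* ε) (half>0 0<ε)
      in eventually
        (λ n ((x≤ , v≤) , u-v< , x-y<) → subst₂ ℚ._<_
          (cong ℚ.∣_∣ (solve 4 (λ x y u v → x :* (u :- v) :+ v :* (x :- y) := x :* u :- y :* v) refl
            (seq x n) (seq y n) (seq u n) (seq v n)))
          (trans (cong₂ ℚ._+_ Aδ≡ Bη≡) (half+half ε))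
          (ℚ.≤-<-trans (ℚ.∣p+q∣≤∣p∣+∣q∣ (seq x n ℚ.* (seq u n ℚ.- seq v n)) (seq v n ℚ.* (seq x n ℚ.- seq y n)))
            (ℚ.+-mono-< (*-bound A>0 x≤ u-v<) (*-bound B>0 v≤ x-y<))))
        (both (both x≤A v≤B) (both (u≃v δ δ>0) (x≃y η η>0)))

    -- Entries of nonnegative reals may be slightly negative, say p > -δ and q > -η. If q ≥ 0, then
    -- p q ≥ -δ q ≥ -B δ = -½ε; if q ≤ 0, then the absolute value of q is below η and that of p q
    -- below A η = ε.
    *-nonNegative : ∀ {x y} → fromℕ 0 ⊑ x → fromℕ 0 ⊑ y → fromℕ 0 ⊑ x * y
    *-nonNegative {x} {y} (⊑⁺ 0≤x) (⊑⁺ 0≤y) = ⊑⁺ λ ε 0<ε →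
      let (A , A>0 , x≤A) = eventually-bounded x
          (B , B>0 , y≤B) = eventually-bounded y
          (η , η>0 , Aη≡) = scaled A A>0 ε 0<ε
          (δ , δ>0 , Bδ≡) = scaled B B>0 (½ ℚ.* ε) (half>0 0<ε)
      in eventually
        (λ n ((x≤ , y≤) , x> , y>) → bound ε 0<ε A A>0 B B>0 η Aη≡ δ δ>0 Bδ≡ (seq x n) (seq y n) x≤ y≤ x> y>)
        (both (both x≤A y≤B) (both (0≤x δ δ>0) (0≤y η η>0)))
      where
      bound : ∀ ε → 0ℚ ℚ.< ε → ∀ A → ℚ.Positive A → ∀ B → ℚ.Positive B →
              ∀ η → A ℚ.* η ≡ ε → ∀ δ → 0ℚ ℚ.< δ → B ℚ.* δ ≡ ½ ℚ.* ε → ∀ p q →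
              ℚ.∣ p ∣ ℚ.≤ A → ℚ.∣ q ∣ ℚ.≤ B → 0ℚ ℚ.< p ℚ.+ δ → 0ℚ ℚ.< q ℚ.+ η → 0ℚ ℚ.< p ℚ.* q ℚ.+ ε
      bound ε 0<ε A A>0 B B>0 η Aη≡ δ δ>0 Bδ≡ p q p≤ q≤ p> q> with ℚ.≤-total 0ℚ q
      ... | inj₁ 0≤q = ℚ.≤-<-trans
        (ℚ.≤-trans (ℚ.nonNegative⁻¹ _ {{ℚ.nonNeg*nonNeg⇒nonNeg (p ℚ.+ δ) {{ℚ.nonNegative (ℚ.<⇒≤ p>)}} q {{ℚ.nonNegative 0≤q}}}})
          (subst₂ ℚ._≤_ (solve 3 (λ p q δ → p :* q :+ q :* δ := (p :+ δ) :* q) refl p q δ)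
            (cong (p ℚ.* q ℚ.+_) Bδ≡)
            (ℚ.+-monoʳ-≤ (p ℚ.* q) (ℚ.*-monoʳ-≤-nonNeg δ {{ℚ.nonNegative (ℚ.<⇒≤ δ>0)}}
              (subst (ℚ._≤ B) (ℚ.0≤p⇒∣p∣≡p 0≤q) q≤)))))
        (ℚ.+-monoʳ-< (p ℚ.* q) (subst (½ ℚ.* ε ℚ.<_) (half+half ε) (<-+-positive ℚ.≤-refl (half>0 0<ε))))
      ... | inj₂ q≤0 = subst (0ℚ ℚ.<_) (ℚ.+-comm ε (p ℚ.* q)) (subst (ℚ._< ε ℚ.+ p ℚ.* q)
          (ℚ.+-inverseˡ (p ℚ.* q)) (ℚ.+-monoˡ-< (p ℚ.* q)
            (ℚ.≤-<-trans -pq≤ (subst (ℚ.∣ p ℚ.* q ∣ ℚ.<_) Aη≡ (*-bound {p} {q} A>0 p≤ ∣q∣<η)))))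
        where
        ∣q∣<η : ℚ.∣ q ∣ ℚ.< η
        ∣q∣<η = subst (λ r → ℚ.∣ r ∣ ℚ.< η) (ℚ.+-identityʳ q) (<⇒∣-∣< {q} {0ℚ} {η}
          (ℚ.≤-<-trans q≤0 (ℚ.<-≤-trans q> (ℚ.+-monoˡ-≤ η q≤0))) q>)
        -pq≤ : ℚ.- (p ℚ.* q) ℚ.≤ ℚ.∣ p ℚ.* q ∣
        -pq≤ with ℚ.≤-total 0ℚ (p ℚ.* q)
        ... | inj₁ ≥0 = ℚ.≤-trans (ℚ.neg-antimono-≤ ≥0) (ℚ.0≤∣p∣ _)
        ... | inj₂ ≤0 = ℚ.≤-reflexive (trans (sym (ℚ.0≤p⇒∣p∣≡p (ℚ.neg-antimono-≤ ≤0))) (ℚ.∣-p∣≡∣p∣ (p ℚ.* q)))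

    ⊑-approx : ∀ {x y} → (∀ ε → 0ℚ ℚ.< ε → x ⊑ y + fromℚ ε) → x ⊑ y
    ⊑-approx {x} {y} approx = ⊑⁺ λ ε 0<ε → eventually
      (λ n → subst (seq x n ℚ.<_)
        (trans (ℚ.+-assoc (seq y n) _ _) (cong (seq y n ℚ.+_) (half+half ε))))
      (⊑⁻ (approx (½ ℚ.* ε) (half>0 0<ε)) (½ ℚ.* ε) (half>0 0<ε))

    inverseˡ : LeftInverse (fromℕ 0) (-_) _+_
    inverseˡ x = pointwise-≈ {(- x) + x} {fromℕ 0} λ n → ℚ.+-inverseˡ (seq x n)

    inverseʳ : RightInverse (fromℕ 0) (-_) _+_
    inverseʳ x = pointwise-≈ {x + (- x)} {fromℕ 0} λ n → ℚ.+-inverseʳ (seq x n)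

    -- For a variable f the type Congruent₁ f is compared without unfolding f.
    congruent : ∀ f → (∀ x y → x ≈ y → f x ≈ f y) → Congruent₁ f
    congruent f f-cong = f-cong _ _

    +-isAbelianGroup : IsAbelianGroup _+_ (fromℕ 0) (-_)
    +-isAbelianGroup = record
      { isGroup = record
        { isMonoid = record
          { isSemigroup = record
            { isMagma = record
              { isEquivalence = record
                { refl = λ {x} → ≈-refl {x} ; sym = λ {x} {y} → ≈-sym {x} {y}
                ; trans = λ {x} {y} {z} → ≈-trans {x} {y} {z} }
              ; ∙-cong = λ {x} {y} {u} {v} → +-cong {x} {y} {u} {v} }
            ; assoc = λ x y z →
                pointwise-≈ {(x + y) + z} {x + (y + z)} λ n → ℚ.+-assoc (seq x n) (seq y n) (seq z n) }
          ; identity = (λ x → pointwise-≈ {fromℕ 0 + x} {x} λ n → ℚ.+-identityˡ (seq x n))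
                     , (λ x → pointwise-≈ {x + fromℕ 0} {x} λ n → ℚ.+-identityʳ (seq x n)) }
        ; inverse = inverseˡ , inverseʳ
        ; ⁻¹-cong = congruent (-_) (λ x y → -‿cong {x} {y}) }
      ; comm = λ x y → pointwise-≈ {x + y} {y + x} λ n → ℚ.+-comm (seq x n) (seq y n) }

    isRing : IsRing _+_ _*_ (-_) (fromℕ 0) (fromℕ 1)
    isRing = record
      { +-isAbelianGroup = +-isAbelianGroup
      ; *-cong = λ {x} {y} {u} {v} → *-cong {x} {y} {u} {v}
      ; *-assoc = λ x y z →
          pointwise-≈ {(x * y) * z} {x * (y * z)} λ n → ℚ.*-assoc (seq x n) (seq y n) (seq z n)
      ; *-identity = (λ x → pointwise-≈ {fromℕ 1 * x} {x} λ n → ℚ.*-identityˡ (seq x n))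
                   , (λ x → pointwise-≈ {x * fromℕ 1} {x} λ n → ℚ.*-identityʳ (seq x n))
      ; distrib = (λ x y z → pointwise-≈ {x * (y + z)} {x * y + x * z}
                     λ n → ℚ.*-distribˡ-+ (seq x n) (seq y n) (seq z n))
                , (λ x y z → pointwise-≈ {(y + z) * x} {y * x + z * x}
                     λ n → ℚ.*-distribʳ-+ (seq x n) (seq y n) (seq z n)) }

    *-comm : ∀ x y → x * y ≈ y * x
    *-comm x y = pointwise-≈ {x * y} {y * x} λ n → ℚ.*-comm (seq x n) (seq y n)

    0≤x² : ∀ x → fromℕ 0 ⊑ x * x
    0≤x² x = pointwise-⊑ λ n → 0≤p*p (seq x n)

    fromℚ-+ : ∀ p q → fromℚ (p ℚ.+ q) ≈ fromℚ p + fromℚ q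
    fromℚ-+ p q = pointwise-≈ λ _ → refl

    fromℚ-* : ∀ p q → fromℚ (p ℚ.* q) ≈ fromℚ p * fromℚ q
    fromℚ-* p q = pointwise-≈ λ _ → refl

    fromℚ-neg : ∀ p → fromℚ (ℚ.- p) ≈ - fromℚ p
    fromℚ-neg p = pointwise-≈ λ _ → refl

  commutativeRing : CommutativeRing 0ℓ 0ℓ
  commutativeRing = record
    { isCommutativeRing = record
      { isRing = isRing
      ; *-comm = *-comm } }

  reals : ArchimedeanRing
  reals = record
    { commutativeRing = commutativeRing
    ; _≤_ = _⊑_
    ; isPartialOrder = record
      { isPreorder = record
        { isEquivalence = CommutativeRing.isEquivalence commutativeRing
        ; reflexive = ⊑-reflexive ; trans = ⊑-trans }
      ; antisym = ⊑-antisym }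
    ; +-mono-≤ = +-mono-⊑
    ; *-nonNegative = *-nonNegative
    ; 0≤x² = 0≤x²
    ; ι = fromℚ
    ; ι-0 = ≈-refl ; ι-1 = ≈-refl
    ; ι-+ = fromℚ-+
    ; ι-* = fromℚ-*
    ; ι-neg = fromℚ-neg
    ; ι-mono = λ p≤q → pointwise-⊑ λ _ → p≤q
    ; ι-reflects = fromℚ-reflects
    ; ≤-approx = ⊑-approx
    ; located = located
    ; bounded = bounded }

-- From the abstract ring back to the definitions used in the statement

module Transfer where
  open import Defs hiding (_+_; _*_; -_; _-_)
  import Defs as D
  open RealNumbers
  open import Data.Integer.Base using (+_)
  open import Data.Nat.Base using (ℕ; zero; suc; _!; z≤n; s≤s)
  import Data.Nat.Base as ℕ
  open import Data.Product.Base using (_×_; _,_)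
  open import Data.Rational.Base using (ℚ; _/_)
  import Data.Rational.Base as ℚ
  import Data.Rational.Properties as ℚ
  open import Data.Rational.Solver using (module +-*-Solver)
  open import Relation.Binary.PropositionalEquality
  open import Relation.Nullary.Decidable using (True; toWitness)
  open +-*-Solver
  module T = Toolkit reals
  module E = ExponentialSeries reals
  module A = Asymptotics reals

  opaque
    unfolding _+_

    -- Where the operations are sealed they agree with the original ones only up to a propositional
    -- equality, along which results are then transported.
    +≡ : ∀ x y → x D.+ y ≡ x + y
    +≡ x y = refl

    *≡ : ∀ x y → x D.* y ≡ x * y
    *≡ x y = refl

  ^≡ : ∀ x n → x ^ n ≡ x T.^ n
  ^≡ x zero    = refl
  ^≡ x (suc n) = trans (*≡ x (x ^ n)) (cong (x *_) (^≡ x n))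

  ∑≡ : ∀ n {f g : ℕ → ℝ} → (∀ k → f k ≡ g k) → ∑≤ n f ≡ T.sum n g
  ∑≡ zero    f≡g = f≡g 0
  ∑≡ (suc n) {f} f≡g = trans (+≡ (∑≤ n f) (f (suc n))) (cong₂ _+_ (∑≡ n f≡g) (f≡g (suc n)))

  expSum≡ : ∀ x n → (∑[ k ≤ n ] 1/ k ! D.* x ^ k) ≡ E.exp≤ n x
  expSum≡ x n = ∑≡ n λ k → trans (*≡ 1/ k ! (x ^ k)) (cong (1/ k ! *_) (^≡ x k))

  opaque
    unfolding _+_

    ∣-∣≤⇒⊑ : ∀ x y ε → ∣ x D.- y ∣ ≤ fromℚ ε → x ⊑ y + fromℚ ε
    ∣-∣≤⇒⊑ x y ε close = ⊑⁺ λ δ 0<δ → eventually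
      (λ n p → subst (seq x n ℚ.<_) (sym (ℚ.+-assoc (seq y n) ε δ)) (∣p-q∣<ε⇒p<q+ε p))
      (close δ 0<δ)

    ∣-∣≤⇒⊒ : ∀ x y ε → ∣ x D.- y ∣ ≤ fromℚ ε → y ⊑ x + fromℚ ε
    ∣-∣≤⇒⊒ x y ε close = ⊑⁺ λ δ 0<δ → eventually
      (λ n p → subst (seq y n ℚ.<_) (sym (ℚ.+-assoc (seq x n) ε δ))
        (∣p-q∣<ε⇒p<q+ε (subst (ℚ._< ε ℚ.+ δ) (∣-∣-swap (seq x n) (seq y n)) p)))
      (close δ 0<δ)

  isExp : ∀ {x y} → y IsExpOf x → E.IsExp x y
  isExp {x} {y} limit ε 0<ε = let (N , close) = limit ε 0<ε in N , λ n n≥ →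
    subst (λ a → a ⊑ y + fromℚ ε) (expSum≡ x n) (∣-∣≤⇒⊑ (∑[ k ≤ n ] 1/ k ! D.* x ^ k) y ε (close n n≥)) ,
    subst (λ a → y ⊑ a + fromℚ ε) (expSum≡ x n) (∣-∣≤⇒⊒ (∑[ k ≤ n ] 1/ k ! D.* x ^ k) y ε (close n n≥))

  -- Turns a rational enclosure into a decimal approximation; the two comparisons of the endpoints
  -- with q - ε and q + ε are evaluated.
  near : ∀ x a b q ε {_ : True (q ℚ.- ε ℚ.≤? a)} {_ : True (b ℚ.≤? q ℚ.+ ε)} →
         fromℚ a ⊑ x → x ⊑ fromℚ b → ∣ x D.- fromℚ q ∣ ≤ fromℚ ε
  near x a b q ε {q-ε≤a} {b≤q+ε} (⊑⁺ a≤x) (⊑⁺ x≤b) δ 0<δ = eventually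
    (λ n (a< , <b) → <⇒∣-∣< {seq x n} {q} {ε ℚ.+ δ}
      (ℚ.<-≤-trans <b (subst (b ℚ.+ δ ℚ.≤_) (ℚ.+-assoc q ε δ) (ℚ.+-monoˡ-≤ δ (toWitness b≤q+ε))))
      (subst₂ ℚ._<_ (solve 2 (λ q ε → q :- ε :+ ε := q) refl q ε)
        (solve 3 (λ x δ ε → x :+ δ :+ ε := x :+ (ε :+ δ)) refl (seq x n) δ ε)
        (ℚ.+-monoˡ-< ε (ℚ.≤-<-trans (toWitness q-ε≤a) a<))))
    (both (a≤x δ 0<δ) (x≤b δ 0<δ))

  opaque
    unfolding _+_

    tribonacciPolynomial : ∀ ζ → ζ * ζ * ζ + ζ * ζ + fromℕ 3 * ζ + (- fromℕ 1) ≈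
                           ζ ^ 3 D.+ ζ ^ 2 D.+ fromℕ 3 D.* ζ D.- fromℕ 1
    tribonacciPolynomial ζ = pointwise-≈ λ n → solve 1 (λ z →
      z :* z :* z :+ z :* z :+ con (+ 3 / 1) :* z :- con (+ 1 / 1) :=
      z :* (z :* (z :* con (+ 1 / 1))) :+ z :* (z :* con (+ 1 / 1)) :+ con (+ 3 / 1) :* z :- con (+ 1 / 1))
      refl (seq ζ n)

    square≈ : ∀ x → x * x ≈ x ^ 2
    square≈ x = pointwise-≈ λ n → cong (seq x n ℚ.*_) (sym (ℚ.*-identityʳ (seq x n)))

  tribonacci : ∀ {ζ √ζ} → ζ ^ 3 D.+ ζ ^ 2 D.+ fromℕ 3 D.* ζ D.- fromℕ 1 ≃ fromℕ 0 → √ζ IsSqrtOf ζ →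
               TribonacciConstant.cubic reals √ζ ≈ fromℕ 1
  tribonacci {ζ} {√ζ} root (0≤√ζ , √ζ²≃ζ) =
    TribonacciConstant.tribonacci-root reals {√ζ} {ζ} (⊑⁺ 0≤√ζ)
      (subst (_≈ ζ) (*≡ √ζ √ζ) (≈⁺ √ζ²≃ζ))
      (≈-trans (tribonacciPolynomial ζ) (≈⁺ root))

open import Defs
open import Relation.Binary.PropositionalEquality using (refl; sym; trans; cong; cong₂; subst; subst₂)
open Transfer
open RealNumbers using (⊑⁺; ⊑⁻; ≈⁺; _⊑_; _≈_; ⊑-trans; ⊑-reflexive; ≈-sym)

corollary9p8 : (ζ √ζ 1/√ζ L Z : ℝ) →
    ζ ^ 3 + ζ ^ 2 + fromℕ 3 * ζ - fromℕ 1 ≃ fromℕ 0 →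
    √ζ IsSqrtOf ζ →
    1/√ζ IsReciprocalOf √ζ →
    L IsLogOf (fromℕ 1 + √ζ) →
    Z IsReciprocalOf L →
    let open Approximation 1/√ζ in
    ((λ n → û n n) ≍ (λ n → fromℕ (n !) ^ 2 * Z ^ (2 ℕ.* n)) ·n^O[1])
    × ((λ n → fromℕ (u n n)) ≍ (λ n → fromℕ (n !) ^ 2 * Z ^ (2 ℕ.* n)) ·n^O[1])
    × ∣ Z - fromℚ (+ 230322 / 100000) ∣ ≤ fromℚ (+ 5 / 1000000)
    × ∣ Z ^ 2 - fromℚ (+ 530482 / 100000) ∣ ≤ fromℚ (+ 5 / 1000000)
corollary9p8 ζ √ζ 1/√ζ L Z root sqrt reciprocal log inverse =
  (2 , ℕ.s≤s ℕ.z≤n , λ n 2≤n → sandwich n 2 (û≡ n) (M.Θ²≍B 2≤n)) ,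
  (9 , ℕ.s≤s ℕ.z≤n , λ n 2≤n → sandwich n 9 (cong fromℕ (ProtocolEnumeration.u≡plays n n)) (M.U≍B 2≤n)) ,
  near Z M.Z₁ M.Z₂ (+ 230322 / 100000) (+ 5 / 1000000) M.Z₁≤Z M.Z≤Z₂ ,
  near (Z ^ 2) (M.Z₁ ℚ.* M.Z₁) (M.Z₂ ℚ.* M.Z₂) (+ 530482 / 100000) (+ 5 / 1000000)
    (⊑-trans M.Z₁²≤Z² (⊑-reflexive (square≈ Z))) (⊑-trans (⊑-reflexive (≈-sym (square≈ Z))) M.Z²≤Z₂²)
  where
  open Approximation 1/√ζ
  module M = A.Conclusion √ζ 1/√ζ L Z (⊑⁺ (proj₁ sqrt)) (tribonacci {ζ} root sqrt)
    (subst (_≈ fromℕ 1) (*≡ √ζ 1/√ζ) (≈⁺ reciprocal))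
    (subst (E.IsExp L) (+≡ (fromℕ 1) √ζ) (isExp log))
    (subst (_≈ fromℕ 1) (*≡ L Z) (≈⁺ inverse))
  Θ≡ : ∀ n → Θ n ≡ M.Θ n
  Θ≡ n = ∑≡ n λ i → let f = fromℕ (i ! ℕ.* stirling₂ n i) in
    trans (*≡ f (1/√ζ ^ i)) (cong (f T.*_) (^≡ 1/√ζ i))
  û≡ : ∀ n → û n n ≡ M.Θ n T.* M.Θ n
  û≡ n = trans (*≡ (Θ n) (Θ n)) (cong₂ T._*_ (Θ≡ n) (Θ≡ n))
  b≡ : ∀ n → fromℕ (n !) ^ 2 * Z ^ (2 ℕ.* n) ≡ M.B n
  b≡ n = trans (*≡ (fromℕ (n !) ^ 2) (Z ^ (2 ℕ.* n))) (cong₂ T._*_ (^≡ (fromℕ (n !)) 2) (^≡ Z (2 ℕ.* n)))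
  scaled≡ : ∀ n C x → fromℕ n ^ C * x ≡ fromℕ n T.^ C T.* x
  scaled≡ n C x = trans (*≡ (fromℕ n ^ C) x) (cong (T._* x) (^≡ (fromℕ n) C))
  sandwich : ∀ n C {a a′} → a ≡ a′ →
    M.B n ⊑ fromℕ n T.^ C T.* a′ × a′ ⊑ fromℕ n T.^ C T.* M.B n →
    fromℕ (n !) ^ 2 * Z ^ (2 ℕ.* n) ≤ fromℕ n ^ C * a ×
    a ≤ fromℕ n ^ C * (fromℕ (n !) ^ 2 * Z ^ (2 ℕ.* n))
  sandwich n C {a} refl (lower , upper) =
    ⊑⁻ (subst₂ _⊑_ (sym (b≡ n)) (sym (scaled≡ n C a)) lower) ,
    ⊑⁻ (subst (a ⊑_) (sym (trans (scaled≡ n C _) (cong (fromℕ n T.^ C T.*_) (b≡ n)))) upper)
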